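{- There exists an absolute constant $C>0$ such that the following holds. Let $0<\epsilon<\tfrac12$, $0\le\alpha<\tfrac12$, let $d\ge1$ be an integer and let $m=\lceil C d/\epsilon\rceil$. Let $p$ be a real polynomial of degree at most $d$, $\sigma\ge0$, and let $S=\{(x_i,y_i)\}$ be a finite set of samples for $(p,\sigma)$ that is $\alpha$-good for the size $m$ Chebyshev partition $I_1,\dots,I_m$. For each $j\in\{1,\dots,m\}$ let $\widetilde x_j\in I_j$ be chosen arbitrarily and let $\widetilde y_j=\operatorname{median}_{x_i\in I_j}y_i$. Then any polynomial $\widehat p$ of degree at most $d$ minimizing $$\max_{1\le j\le m}|\widehat p(\widetilde x_j)-\widetilde y_j|$$ over all polynomials of degree at most $d$ satisfies $$\|\widehat p-p\|_\infty\le(2+\epsilon)\sigma+\epsilon\|p\|_\infty .$$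
   Context: $\|f\|_\infty=\sup_{x\in[-1,1]}|f(x)|$. Samples: a finite set $S$ of samples for $(p,\sigma)$ is a finite indexed family of pairs $(x_i,y_i)$ with $x_i\in[-1,1]$, $y_i\in\mathbb R$, some of which are designated outliers, such that every non-outlier satisfies $|y_i-p(x_i)|\le\sigma$ (outliers have arbitrary $y_i$). The size $m$ Chebyshev partition of $[-1,1]$ is the set of intervals $I_j=[\cos\frac{\pi j}{m},\cos\frac{\pi(j-1)}{m}]$, $j\in\{1,\dots,m\}$. $S$ is $\alpha$-good for the partition if in every $I_j$ strictly less than an $\alpha$ fraction of the points $x_i\in I_j$ are outliers (so in particular every $I_j$ contains at least one $x_i$). -}

module Defs where

open import Level using (0ℓ) renaming (suc to lsuc)
open import Algebra.Bundles using (CommutativeRing; Semiring)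
open import Axiom.ExcludedMiddle using (ExcludedMiddle)
open import Data.Nat as ℕ using (ℕ; suc; _!)
open import Data.Fin using (Fin; toℕ)
open import Data.Fin.Subset using (Subset; _∉_)
open import Data.Fin.Subset.Properties using (_∈?_)
open import Data.List using (List; length; filter; map; allFin; drop; head)
open import Data.Maybe using (fromMaybe)
open import Data.Product using (∃; ∃-syntax; _,_) renaming (_×_ to _∧_)
open import Data.Vec.Functional as Vector using (Vector)
open import Relation.Binary.Bundles using (TotalOrder; DecTotalOrder)
open import Relation.Binary.Core using (Rel)
open import Relation.Binary.Structures using (IsTotalOrder)
open import Relation.Nullary using (¬_; Dec; yes; no)
open import Relation.Unary using (Pred)
import Algebra.Construct.NaturalChoice.Max as Max
import Algebra.Definitions.RawSemiring as RawSemiringDefinitions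
import Data.List.Sort as Sort
import Relation.Binary.Construct.NonStrictToStrict as ToStrict

-- The real numbers, presented as a Dedekind-complete ordered field.
-- Assuming excluded middle such a structure exists and is unique up to
-- isomorphism; equality is a setoid equality because --safe Agda has no
-- quotients.
record CompleteOrderedField : Set (lsuc 0ℓ) where
  field
    commutativeRing : CommutativeRing 0ℓ 0ℓ

  open CommutativeRing commutativeRing public

  infix  4 _≤_
  infix  8 _⁻¹

  field
    0≉1          : ¬ (0# ≈ 1#)
    -- The value of 0# ⁻¹ is left unspecified.
    _⁻¹          : Carrier → Carrier
    ⁻¹-cong      : ∀ {x y} → x ≈ y → x ⁻¹ ≈ y ⁻¹
    ⁻¹-inverse   : ∀ x → ¬ (x ≈ 0#) → x * x ⁻¹ ≈ 1#
    _≤_          : Rel Carrier 0ℓ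
    isTotalOrder : IsTotalOrder _≈_ _≤_
    +-monoˡ-≤    : ∀ z {x y} → x ≤ y → x + z ≤ y + z
    *-nonNeg     : ∀ {x y} → 0# ≤ x → 0# ≤ y → 0# ≤ x * y

  IsUpperBound : Pred Carrier 0ℓ → Pred Carrier 0ℓ
  IsUpperBound P u = ∀ x → P x → x ≤ u

  IsSupremum : Pred Carrier 0ℓ → Pred Carrier 0ℓ
  IsSupremum P s = IsUpperBound P s ∧ (∀ u → IsUpperBound P u → s ≤ u)

  field
    complete : ∀ (P : Pred Carrier 0ℓ) → ∃ P → ∃ (IsUpperBound P) → ∃ (IsSupremum P)

  totalOrder : TotalOrder 0ℓ 0ℓ 0ℓ
  totalOrder = record { isTotalOrder = isTotalOrder }

  open ToStrict _≈_ _≤_ public using (_<_)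
  open Max totalOrder public using (_⊔_)
  open RawSemiringDefinitions (Semiring.rawSemiring semiring) public using (_^_; sum) renaming (_×_ to _·_)

  infixl 7 _/_

  _/_ : Carrier → Carrier → Carrier
  x / y = x * y ⁻¹

  ∣_∣ : Carrier → Carrier
  ∣ x ∣ = x ⊔ (- x)

  fromℕ : ℕ → Carrier
  fromℕ n = n · 1#

module Reals (em : ExcludedMiddle 0ℓ) (ℝ : CompleteOrderedField) where

  open CompleteOrderedField ℝ public

  -- Description operator: some element satisfying P if there is one, and
  -- the given default otherwise.  It is applied below only to predicates
  -- that determine their element up to equality, so that, for instance,
  -- limits and suprema can be written as total functions.
  the : {A : Set} → A → Pred A 0ℓ → A
  the default P with em {∃ P}
  ... | yes (x , _) = x
  ... | no  _       = default

  _⟶_ : (ℕ → Carrier) → Carrier → Set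
  a ⟶ l = ∀ ε → 0# < ε → ∃[ N ] (∀ n → N ℕ.≤ n → ∣ a n - l ∣ < ε)

  lim : (ℕ → Carrier) → Carrier
  lim a = the 0# (a ⟶_)

  cos : Carrier → Carrier
  cos x = lim λ n → sum {n} λ k →
    (- 1#) ^ toℕ k * x ^ (2 ℕ.* toℕ k) / fromℕ ((2 ℕ.* toℕ k) !)

  IsLeastPositiveZeroOfCos : Pred Carrier 0ℓ
  IsLeastPositiveZeroOfCos x =
    0# < x ∧ cos x ≈ 0# ∧ (∀ y → 0# < y → cos y ≈ 0# → x ≤ y)

  π : Carrier
  π = fromℕ 2 * the 0# IsLeastPositiveZeroOfCos

  -- Least natural number above x, which is the usual ceiling for x ≥ 0.
  ⌈_⌉ : Carrier → ℕ
  ⌈ x ⌉ = the 0 λ n → x ≤ fromℕ n ∧ (∀ k → x ≤ fromℕ k → n ℕ.≤ k)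

  [-1,1] : Pred Carrier 0ℓ
  [-1,1] x = - 1# ≤ x ∧ x ≤ 1#

  ‖_‖∞ : (Carrier → Carrier) → Carrier
  ‖ f ‖∞ = the 0# (IsSupremum λ y → ∃[ x ] [-1,1] x ∧ y ≈ ∣ f x ∣)

  -- Polynomials of degree at most d, as coefficient families.
  Poly : ℕ → Set
  Poly d = Vector Carrier (suc d)

  ⟦_⟧ : ∀ {d} → Poly d → Carrier → Carrier
  ⟦ p ⟧ x = sum λ i → p i * x ^ toℕ i

  -- The index j : Fin m stands for j + 1 in the customary numbering 1, …, m.
  ChebyshevInterval : (m : ℕ) → Fin m → Pred Carrier 0ℓ
  ChebyshevInterval m j x =
    cos (π * fromℕ (suc (toℕ j)) / fromℕ m) ≤ x ∧ x ≤ cos (π * fromℕ (toℕ j) / fromℕ m)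

  record Samples {d : ℕ} (p : Poly d) (σ : Carrier) : Set where
    field
      size     : ℕ
      x y      : Fin size → Carrier
      outliers : Subset size
      x∈[-1,1] : ∀ i → [-1,1] (x i)
      close    : ∀ i → i ∉ outliers → ∣ y i - ⟦ p ⟧ (x i) ∣ ≤ σ

    samplesIn : Pred Carrier 0ℓ → List (Fin size)
    samplesIn I = filter (λ i → em {I (x i)}) (allFin size)

    outliersIn : Pred Carrier 0ℓ → List (Fin size)
    outliersIn I = filter (_∈? outliers) (samplesIn I)

    -- An interval without samples violates this, since 0 < α * 0 fails.
    IsGood : Carrier → ℕ → Set
    IsGood α m = ∀ (j : Fin m) → let I = ChebyshevInterval m j in
      fromℕ (length (outliersIn I)) < α * fromℕ (length (samplesIn I))

  decTotalOrder : DecTotalOrder 0ℓ 0ℓ 0ℓ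
  decTotalOrder = record
    { isDecTotalOrder = record
      { isTotalOrder = isTotalOrder
      ; _≟_          = λ _ _ → em
      ; _≤?_         = λ _ _ → em
      }
    }

  open Sort decTotalOrder public using (sort)

  -- With n entries sorted as s₀ ≤ … ≤ sₙ₋₁, this averages s at ⌊(n-1)/2⌋
  -- and ⌊n/2⌋: the middle entry twice for odd n, the two middle entries
  -- for even n.
  median : List Carrier → Carrier
  median l = (at ℕ.⌊ length l ℕ.∸ 1 /2⌋ + at ℕ.⌊ length l /2⌋) / fromℕ 2
    where
    at : ℕ → Carrier
    at k = fromMaybe 0# (head (drop k (sort l)))

  medianIn : ∀ {d} {p : Poly d} {σ} → Samples p σ → Pred Carrier 0ℓ → Carrier
  medianIn S I = median (map y (samplesIn I))
    where open Samples S

  -- Starting the maximum at 0 is harmless because the entries are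
  -- absolute values.
  maxDeviation : ∀ {d m} → Poly d → (x̃ ỹ : Vector Carrier m) → Carrier
  maxDeviation q x̃ ỹ = Vector.foldr _⊔_ 0# λ j → ∣ ⟦ q ⟧ (x̃ j) - ỹ j ∣

  IsMinimaxFit : ∀ {d m} → Poly d → (x̃ ỹ : Vector Carrier m) → Set
  IsMinimaxFit {d} p̂ x̃ ỹ = ∀ (q : Poly d) → maxDeviation p̂ x̃ ỹ ≤ maxDeviation q x̃ ỹ

{-# OPTIONS --safe #-}

-- If a polynomial f of degree at most d oscillates by at most ε/4 ‖f‖ on every cell I_j, then the
-- median ỹ_j is within σ + ε/4 ‖p‖ of p x̃_j (inliers are a majority of each cell), so the minimax
-- fit p̂ is within 2σ + ε/2 ‖p‖ of p at every x̃_j, and the oscillation bound for p̂ - p extends this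
-- to all of [-1,1] at the price of ε/4 ‖p̂ - p‖, which is absorbed on the left.
--
-- The oscillation bound is Bernstein's inequality without derivatives.  For fixed θ the function
-- f (cos (θ + t)) - f (cos (θ - t)) has the form 2 sin t · r (cos t) with deg r < d.  If M bounds ∣f∣
-- on [-1,1], then M U ± r, where sin (d t) = sin t · U (cos t), alternates weakly in sign, starting
-- with a nonnegative value, at the d zeros cos ((2k + 1) π / 2d) of the Chebyshev polynomial, and hence
-- is nonnegative to the right of the largest of them.  So ∣sin t · r (cos t)∣ ≤ M sin (d t) for small t.
--
-- All facts about cosine follow from cos (x + y) + cos (x - y) = 2 cos x cos y, proved by a Cauchy
-- product of series, together with the behaviour of cosine near 0; the sine is cos (π / 2 - x).

module Submission where

open import Defs
open import Level using (0ℓ)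
open import Axiom.ExcludedMiddle using (ExcludedMiddle)
open import Data.Nat as ℕ using (ℕ; zero; suc; _!)
open import Data.Fin as Fin using (Fin; toℕ)
open import Data.Product using (∃; ∃-syntax; _,_; proj₁; proj₂) renaming (_×_ to _∧_)
open import Algebra.Bundles using (CommutativeRing)
open import Algebra.Solver.Ring.AlmostCommutativeRing
  using (fromCommutativeRing; _-Raw-AlmostCommutative⟶_)
open import Data.Empty using (⊥; ⊥-elim)
open import Data.Fin.Subset using (_∈_; _∉_)
open import Data.Fin.Subset.Properties using (_∈?_)
open import Data.Integer as ℤ using (ℤ; +_; -[1+_])
open import Data.List using (List; []; _∷_; length; filter; map; allFin; drop; head)
open import Data.List.Relation.Binary.Permutation.Propositional.Properties using (↭-length; filter-↭)
open import Data.List.Relation.Unary.All as All using (All; []; _∷_)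
open import Data.List.Relation.Unary.AllPairs using (AllPairs; []; _∷_)
open import Data.List.Relation.Unary.Sorted.TotalOrder.Properties using (Sorted⇒AllPairs)
open import Data.Maybe using (Maybe; just; nothing; fromMaybe)
open import Data.Sum using (_⊎_; inj₁; inj₂)
open import Data.Vec.Functional as Vector using (Vector)
open import Function using (_∘_)
open import Relation.Binary.PropositionalEquality as ≡ using (_≡_)
open import Relation.Nullary using (¬_; yes; no)
open import Relation.Unary using (Pred)
import Algebra.Construct.NaturalChoice.Max as Max
import Algebra.Properties.Ring as RingProperties
import Algebra.Properties.Semiring.Mult as SemiringMult
import Algebra.Solver.Ring as RingSolver
import Data.Fin.Properties as Fin
import Data.Integer.Properties as ℤ
import Data.List.Properties as List
import Data.List.Relation.Unary.All.Properties as All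
import Data.List.Sort as Sort
import Data.Nat.Solver
import Data.Nat.Properties as ℕ
import Data.Sign as Sign
import Relation.Binary.Reasoning.PartialOrder as PartialOrderReasoning
import Relation.Binary.Reasoning.Setoid as SetoidReasoning
import Relation.Binary.Bundles

-- The reals are known only through axioms and cosine only through its series, so there is no mean
-- value theorem to turn a derivative bound into an oscillation bound; hence finite increments
-- throughout. Taking the odd part in t is what makes the comparison algebraic: after division by
-- sin t a polynomial in cos t with fewer than d + 1 coefficients remains, and d weak sign
-- conditions already control it to the right of the nodes, without counting zeros or
-- multiplicities.
--
-- The constants: an arc of length π / m gives oscillation at most 2 ‖f‖ d π / m, where the factor 2
-- comes from the crude estimate sin x ≤ 2x. The choice of `C` makes d π / m at most ε / 8, whence
-- ε/4 ‖f‖. This value suits the absorption: (1 - ε/4) ‖p̂ - p‖ ≤ 2σ + ε/2 ‖p‖, and both 2 / (1 -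
-- ε/4) ≤ 2 + ε and (ε/2) / (1 - ε/4) ≤ ε hold in the given range of ε.

private
  module NatSolver = Data.Nat.Solver.+-*-Solver

-- A ring solver with integer coefficients

module IntegerSolver (R : CommutativeRing 0ℓ 0ℓ) where
  open CommutativeRing R hiding (zero)
  open RingProperties ring
  open SemiringMult semiring using (_×_; ×-homo-+; ×1-homo-*)
  open SetoidReasoning setoid

  private
    nat : ℕ → Carrier
    nat n = n × 1#

    int : ℤ → Carrier
    int (+ n)    = nat n
    int -[1+ n ] = - nat (suc n)

    a+x-[a+y] : ∀ a x y → (a + x) - (a + y) ≈ x - y
    a+x-[a+y] a x y = begin
      (a + x) - (a + y)     ≈⟨ +-cong (+-comm a x) (sym (-‿+-comm a y)) ⟩
      (x + a) + (- a - y)   ≈⟨ +-assoc x a _ ⟩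
      x + (a + (- a - y))   ≈⟨ +-congˡ (+-assoc a (- a) (- y)) ⟨
      x + ((a - a) - y)     ≈⟨ +-congˡ (+-congʳ (-‿inverseʳ a)) ⟩
      x + (0# - y)          ≈⟨ +-congˡ (+-identityˡ _) ⟩
      x - y                 ∎

    int-⊖ : ∀ m n → int (m ℤ.⊖ n) ≈ nat m - nat n
    int-⊖ m       zero    = sym (trans (+-congˡ -0#≈0#) (+-identityʳ _))
    int-⊖ zero    (suc n) = sym (+-identityˡ _)
    int-⊖ (suc m) (suc n) = begin
      int (suc m ℤ.⊖ suc n)      ≡⟨ ≡.cong int (ℤ.[1+m]⊖[1+n]≡m⊖n m n) ⟩
      int (m ℤ.⊖ n)              ≈⟨ int-⊖ m n ⟩
      nat m - nat n              ≈⟨ a+x-[a+y] 1# (nat m) (nat n) ⟨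
      nat (suc m) - nat (suc n)  ∎

    int-+ : ∀ i j → int (i ℤ.+ j) ≈ int i + int j
    int-+ (+ m)    (+ n)    = ×-homo-+ 1# m n
    int-+ (+ m)    -[1+ n ] = int-⊖ m (suc n)
    int-+ -[1+ m ] (+ n)    = trans (int-⊖ n (suc m)) (+-comm _ _)
    int-+ -[1+ m ] -[1+ n ] = begin
      - nat (suc (suc (m ℕ.+ n)))    ≡⟨ ≡.cong (λ k → - nat (suc k)) (ℕ.+-suc m n) ⟨
      - nat (suc m ℕ.+ suc n)        ≈⟨ -‿cong (×-homo-+ 1# (suc m) (suc n)) ⟩
      - (nat (suc m) + nat (suc n))  ≈⟨ -‿+-comm _ _ ⟨
      - nat (suc m) - nat (suc n)    ∎

    int-neg : ∀ i → int (ℤ.- i) ≈ - int i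
    int-neg (+ zero)  = sym -0#≈0#
    int-neg (+ suc n) = refl
    int-neg -[1+ n ]  = sym (-‿involutive _)

    int-◃⁻ : ∀ n → int (Sign.- ℤ.◃ n) ≈ - nat n
    int-◃⁻ zero    = sym -0#≈0#
    int-◃⁻ (suc n) = refl

    int-◃⁺ : ∀ n → int (Sign.+ ℤ.◃ n) ≈ nat n
    int-◃⁺ zero    = refl
    int-◃⁺ (suc n) = refl

    int-* : ∀ i j → int (i ℤ.* j) ≈ int i * int j
    int-* (+ m)    (+ n)    = trans (int-◃⁺ (m ℕ.* n)) (×1-homo-* m n)
    int-* (+ m)    -[1+ n ] =
      trans (int-◃⁻ (m ℕ.* suc n)) (trans (-‿cong (×1-homo-* m (suc n))) (-‿distribʳ-* _ _))
    int-* -[1+ m ] (+ n)    =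
      trans (int-◃⁻ (suc m ℕ.* n)) (trans (-‿cong (×1-homo-* (suc m) n)) (-‿distribˡ-* _ _))
    int-* -[1+ m ] -[1+ n ] = begin
      nat (suc m ℕ.* suc n)            ≈⟨ ×1-homo-* (suc m) (suc n) ⟩
      nat (suc m) * nat (suc n)        ≈⟨ -‿involutive _ ⟨
      - - (nat (suc m) * nat (suc n))  ≈⟨ -‿cong (-‿distribˡ-* _ _) ⟩
      - (- nat (suc m) * nat (suc n))  ≈⟨ -‿distribʳ-* _ _ ⟩
      - nat (suc m) * - nat (suc n)    ∎

    -- Unlike int, this sends 1 and -1 to 1# and - 1# on the nose, so that
    -- constants in solver expressions match the terms they stand for.
    coeff : ℤ → Carrier
    coeff (+ 1)    = 1#
    coeff -[1+ 0 ] = - 1#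
    coeff i        = int i

    coeff≈int : ∀ i → coeff i ≈ int i
    coeff≈int (+ zero)        = refl
    coeff≈int (+ 1)           = sym (+-identityʳ 1#)
    coeff≈int (+ suc (suc n)) = refl
    coeff≈int -[1+ zero ]     = -‿cong (sym (+-identityʳ 1#))
    coeff≈int -[1+ suc n ]    = refl

    hom : ℤ.+-*-rawRing -Raw-AlmostCommutative⟶ fromCommutativeRing R
    hom = record
      { ⟦_⟧    = coeff
      ; +-homo = λ i j → trans (coeff≈int (i ℤ.+ j))
                   (trans (int-+ i j) (sym (+-cong (coeff≈int i) (coeff≈int j))))
      ; *-homo = λ i j → trans (coeff≈int (i ℤ.* j))
                   (trans (int-* i j) (sym (*-cong (coeff≈int i) (coeff≈int j))))
      ; -‿homo = λ i → trans (coeff≈int (ℤ.- i))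
                   (trans (int-neg i) (sym (-‿cong (coeff≈int i))))
      ; 0-homo = refl
      ; 1-homo = refl
      }

    -- Comparing the integers suffices for normalisation: distinct integers may have the same image,
    -- and the answer is then just `nothing`.
    coeff≟ : ∀ i j → Maybe (coeff i ≈ coeff j)
    coeff≟ i j with i ℤ.≟ j
    ... | yes ≡.refl = just refl
    ... | no  _      = nothing

  open RingSolver ℤ.+-*-rawRing (fromCommutativeRing R) hom coeff≟ public
    using (Polynomial; solve; _:=_; _:+_; _:*_; _:-_; :-_; con)

  :0 :1 :2 : ∀ {n} → Polynomial n
  :0 = con (+ 0)
  :1 = con (+ 1)
  :2 = con (+ 2)

-- Order, division and absolute value in an ordered field

module OrderedField (em : ExcludedMiddle 0ℓ) (ℝ : CompleteOrderedField) where
  open Reals em ℝ hiding (zero)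
  open IntegerSolver commutativeRing public

  open Relation.Binary.Bundles.TotalOrder totalOrder public
    using (poset)
    renaming
      ( refl to ≤-refl; reflexive to ≤-reflexive; trans to ≤-trans; antisym to ≤-antisym
      ; total to ≤-total; ≤-respˡ-≈ to ≤-respˡ; ≤-respʳ-≈ to ≤-respʳ
      )
  open Max totalOrder public using (x≤x⊔y; x≤y⊔x; ⊔-lub)

  module ≤R = PartialOrderReasoning poset
  module ≈R = SetoidReasoning setoid

  <⇒≤ : ∀ {x y} → x < y → x ≤ y
  <⇒≤ = proj₁

  ≰⇒> : ∀ {x y} → ¬ (x ≤ y) → y < x
  ≰⇒> {x} {y} x≰y with ≤-total x y
  ... | inj₁ x≤y = ⊥-elim (x≰y x≤y)
  ... | inj₂ y≤x = y≤x , λ y≈x → x≰y (≤-reflexive (sym y≈x))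

  <⇒≱ : ∀ {x y} → x < y → ¬ (y ≤ x)
  <⇒≱ (x≤y , x≉y) y≤x = x≉y (≤-antisym x≤y y≤x)

  <-≤-connex : ∀ x y → x < y ⊎ y ≤ x
  <-≤-connex x y with em {y ≤ x}
  ... | yes y≤x = inj₂ y≤x
  ... | no  y≰x = inj₁ (≰⇒> y≰x)

  <-≤-trans : ∀ {x y z} → x < y → y ≤ z → x < z
  <-≤-trans x<y y≤z = ≰⇒> λ z≤x → <⇒≱ x<y (≤-trans y≤z z≤x)

  ≤-<-trans : ∀ {x y z} → x ≤ y → y < z → x < z
  ≤-<-trans x≤y y<z = ≰⇒> λ z≤x → <⇒≱ y<z (≤-trans z≤x x≤y)

  <-respʳ : ∀ {x y z} → y ≈ z → x < y → x < z
  <-respʳ y≈z x<y = <-≤-trans x<y (≤-reflexive y≈z)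

  <-respˡ : ∀ {x y z} → x ≈ y → x < z → y < z
  <-respˡ x≈y x<z = ≤-<-trans (≤-reflexive (sym x≈y)) x<z

  x≤y⇒0≤y-x : ∀ {x y} → x ≤ y → 0# ≤ y - x
  x≤y⇒0≤y-x {x} {y} x≤y = ≤-respˡ (-‿inverseʳ x) (+-monoˡ-≤ (- x) x≤y)

  -- The format of most inequality proofs below: the slack `e` is assembled from nonnegative pieces
  -- by `_⊕_` and `_⊗_`, and the ring solver checks the identity. Contradictions typically arise in
  -- the same way, from a certificate that something positive is at most zero.
  ≤-from : ∀ {x y e} → 0# ≤ e → y ≈ x + e → x ≤ y
  ≤-from {x} {y} {e} 0≤e y≈x+e = begin
    x       ≈⟨ +-identityˡ x ⟨
    0# + x  ≤⟨ +-monoˡ-≤ x 0≤e ⟩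
    e + x   ≈⟨ +-comm e x ⟩
    x + e   ≈⟨ y≈x+e ⟨
    y       ∎
    where open ≤R

  0≤y-x⇒x≤y : ∀ {x y} → 0# ≤ y - x → x ≤ y
  0≤y-x⇒x≤y {x} {y} p = ≤-from p (solve 2 (λ x y → y := x :+ (y :- x)) refl x y)

  x<y⇒0<y-x : ∀ {x y} → x < y → 0# < y - x
  x<y⇒0<y-x {x} {y} x<y = ≰⇒> λ y-x≤0 → <⇒≱ x<y (≤-from (x≤y⇒0≤y-x y-x≤0)
    (solve 2 (λ x y → x := y :+ (:0 :- (y :- x))) refl x y))

  0<y-x⇒x<y : ∀ {x y} → 0# < y - x → x < y
  0<y-x⇒x<y {x} {y} p = ≰⇒> λ y≤x → <⇒≱ p (≤-from (x≤y⇒0≤y-x y≤x)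
    (solve 2 (λ x y → :0 := (y :- x) :+ (x :- y)) refl x y))

  infixl 6 _⊕_
  infixl 7 _⊗_

  _⊕_ : ∀ {x y} → 0# ≤ x → 0# ≤ y → 0# ≤ x + y
  0≤x ⊕ 0≤y = ≤-trans 0≤x (≤-from 0≤y refl)

  _⊗_ : ∀ {x y} → 0# ≤ x → 0# ≤ y → 0# ≤ x * y
  _⊗_ = *-nonNeg

  -- Lets an equation enter a certificate: with a factor `k` of either sign, the difference of its
  -- two sides vanishes and so counts as a nonnegative piece.
  ≈⇒0≤*[-] : ∀ {x y} k → x ≈ y → 0# ≤ k * (x - y)
  ≈⇒0≤*[-] {x} {y} k x≈y = ≤-reflexive (begin
    0#           ≈⟨ zeroʳ k ⟨
    k * 0#       ≈⟨ *-congˡ (-‿inverseʳ y) ⟨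
    k * (y - y)  ≈⟨ *-congˡ (+-congʳ x≈y) ⟨
    k * (x - y)  ∎)
    where open ≈R

  -- Ring identities modulo a hypothesis: the solver has to prove the equation only up to a multiple
  -- of `u - v`.
  ≈-from : ∀ {x y u v k} → u ≈ v → x ≈ y + k * (u - v) → x ≈ y
  ≈-from {x} {y} {u} {v} {k} u≈v eq = begin
    x                ≈⟨ eq ⟩
    y + k * (u - v)  ≈⟨ +-congˡ (*-congˡ (+-congʳ u≈v)) ⟩
    y + k * (v - v)  ≈⟨ solve 3 (λ y k v → y :+ k :* (v :- v) := y) refl y k v ⟩
    y                ∎
    where open ≈R

  +-mono-≤ : ∀ {x y u v} → x ≤ y → u ≤ v → x + u ≤ y + v
  +-mono-≤ {x} {y} {u} {v} p q = ≤-from (x≤y⇒0≤y-x p ⊕ x≤y⇒0≤y-x q)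
    (solve 4 (λ x y u v → y :+ v := x :+ u :+ ((y :- x) :+ (v :- u))) refl x y u v)

  neg-mono : ∀ {x y} → x ≤ y → - y ≤ - x
  neg-mono {x} {y} p = ≤-from (x≤y⇒0≤y-x p) (solve 2 (λ x y → :- x := :- y :+ (y :- x)) refl x y)

  *-monoˡ : ∀ {z x y} → 0# ≤ z → x ≤ y → z * x ≤ z * y
  *-monoˡ {z} {x} {y} 0≤z p = ≤-from (0≤z ⊗ x≤y⇒0≤y-x p)
    (solve 3 (λ x y z → z :* y := z :* x :+ z :* (y :- x)) refl x y z)

  *-monoʳ : ∀ {z x y} → 0# ≤ z → x ≤ y → x * z ≤ y * z
  *-monoʳ {z} {x} {y} 0≤z p = ≤-from (x≤y⇒0≤y-x p ⊗ 0≤z)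
    (solve 3 (λ x y z → y :* z := x :* z :+ (y :- x) :* z) refl x y z)

  *-mono : ∀ {x y u v} → 0# ≤ x → 0# ≤ u → x ≤ y → u ≤ v → x * u ≤ y * v
  *-mono 0≤x 0≤u p q = ≤-trans (*-monoʳ 0≤u p) (*-monoˡ (≤-trans 0≤x p) q)

  0≤x² : ∀ x → 0# ≤ x * x
  0≤x² x with ≤-total 0# x
  ... | inj₁ 0≤x = 0≤x ⊗ 0≤x
  ... | inj₂ x≤0 = ≤-respʳ (solve 1 (λ x → (:0 :- x) :* (:0 :- x) := x :* x) refl x)
                     (x≤y⇒0≤y-x x≤0 ⊗ x≤y⇒0≤y-x x≤0)

  0≤1 : 0# ≤ 1#
  0≤1 = ≤-respʳ (*-identityˡ 1#) (0≤x² 1#)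

  0<1 : 0# < 1#
  0<1 = 0≤1 , 0≉1

  fromℕ-nonNeg : ∀ n → 0# ≤ fromℕ n
  fromℕ-nonNeg zero    = ≤-refl
  fromℕ-nonNeg (suc n) = 0≤1 ⊕ fromℕ-nonNeg n

  fromℕ-pos : ∀ n → 0# < fromℕ (suc n)
  fromℕ-pos n = <-≤-trans 0<1 (≤-from (fromℕ-nonNeg n) refl)

  open SemiringMult semiring public using () renaming (×-homo-+ to ·-homo-+; ×1-homo-* to fromℕ-*)

  fromℕ-+ : ∀ m n → fromℕ (m ℕ.+ n) ≈ fromℕ m + fromℕ n
  fromℕ-+ = ·-homo-+ 1#

  fromℕ-mono : ∀ {m n} → m ℕ.≤ n → fromℕ m ≤ fromℕ n
  fromℕ-mono {n = n} ℕ.z≤n = fromℕ-nonNeg n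
  fromℕ-mono (ℕ.s≤s p) = +-mono-≤ ≤-refl (fromℕ-mono p)

  fromℕ-cancel-< : ∀ {m n} → fromℕ m < fromℕ n → m ℕ.< n
  fromℕ-cancel-< {m} {n} p with m ℕ.<? n
  ... | yes m<n = m<n
  ... | no  m≮n = ⊥-elim (<⇒≱ p (fromℕ-mono (ℕ.≮⇒≥ m≮n)))

  fromℕ-cancel-≤ : ∀ {m n} → fromℕ m ≤ fromℕ n → m ℕ.≤ n
  fromℕ-cancel-≤ {m} {n} p = ℕ.≮⇒≥ λ n<m → <⇒≱ 0<1 (≤-from (x≤y⇒0≤y-x (≤-trans (fromℕ-mono n<m) p))
    (solve 1 (λ n → :0 := :1 :+ (n :- (:1 :+ n))) refl (fromℕ n)))

  x*y≈0⇒y≈0 : ∀ {x y} → ¬ (x ≈ 0#) → x * y ≈ 0# → y ≈ 0#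
  x*y≈0⇒y≈0 {x} {y} x≉0 xy≈0 = begin
    y               ≈⟨ *-identityˡ y ⟨
    1# * y          ≈⟨ *-congʳ (⁻¹-inverse x x≉0) ⟨
    x * x ⁻¹ * y    ≈⟨ solve 3 (λ x i y → x :* i :* y := x :* y :* i) refl x (x ⁻¹) y ⟩
    x * y * x ⁻¹    ≈⟨ *-congʳ xy≈0 ⟩
    0# * x ⁻¹       ≈⟨ zeroˡ _ ⟩
    0#              ∎
    where open ≈R

  >⇒≉ : ∀ {x} → 0# < x → ¬ (x ≈ 0#)
  >⇒≉ (_ , 0≉x) x≈0 = 0≉x (sym x≈0)

  *-pos : ∀ {x y} → 0# < x → 0# < y → 0# < x * y
  *-pos 0<x 0<y = (<⇒≤ 0<x ⊗ <⇒≤ 0<y) , λ 0≈xy → >⇒≉ 0<y (x*y≈0⇒y≈0 (>⇒≉ 0<x) (sym 0≈xy))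

  +-pos-nonNeg : ∀ {x y} → 0# < x → 0# ≤ y → 0# < x + y
  +-pos-nonNeg 0<x 0≤y = <-≤-trans 0<x (≤-from 0≤y refl)

  *-cancelˡ-≤ : ∀ {x y z} → 0# < x → x * y ≤ x * z → y ≤ z
  *-cancelˡ-≤ {x} {y} {z} 0<x p with <-≤-connex z y
  ... | inj₂ y≤z = y≤z
  ... | inj₁ z<y = ⊥-elim (<⇒≱ (*-pos 0<x (x<y⇒0<y-x z<y))
    (≤-from (x≤y⇒0≤y-x p) (solve 3 (λ x y z → :0 := x :* (y :- z) :+ (x :* z :- x :* y)) refl x y z)))

  *-cancel-nonNeg : ∀ {x y} → 0# < x → 0# ≤ x * y → 0# ≤ y
  *-cancel-nonNeg {x} 0<x p = *-cancelˡ-≤ 0<x (≤-respˡ (sym (zeroʳ x)) p)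

  ⁻¹-inv : ∀ {x} → 0# < x → x * x ⁻¹ ≈ 1#
  ⁻¹-inv {x} 0<x = ⁻¹-inverse x (>⇒≉ 0<x)

  ⁻¹-pos : ∀ {x} → 0# < x → 0# < x ⁻¹
  ⁻¹-pos {x} 0<x = *-cancel-nonNeg 0<x (≤-respʳ (sym (⁻¹-inv 0<x)) 0≤1) , λ 0≈i →
    0≉1 (trans (sym (zeroʳ x)) (trans (*-congˡ 0≈i) (⁻¹-inv 0<x)))

  x/y*y≈x : ∀ x {y} → 0# < y → x / y * y ≈ x
  x/y*y≈x x {y} 0<y = begin
    x * y ⁻¹ * y    ≈⟨ solve 3 (λ x i y → x :* i :* y := x :* (y :* i)) refl x (y ⁻¹) y ⟩
    x * (y * y ⁻¹)  ≈⟨ *-congˡ (⁻¹-inv 0<y) ⟩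
    x * 1#          ≈⟨ *-identityʳ x ⟩
    x               ∎
    where open ≈R

  /-pos : ∀ {x y} → 0# < x → 0# < y → 0# < x / y
  /-pos 0<x 0<y = *-pos 0<x (⁻¹-pos 0<y)

  /-nonNeg : ∀ {x y} → 0# ≤ x → 0# < y → 0# ≤ x / y
  /-nonNeg 0≤x 0<y = 0≤x ⊗ <⇒≤ (⁻¹-pos 0<y)

  x/y≤z⇒x≤z*y : ∀ {x y z} → 0# < y → x / y ≤ z → x ≤ z * y
  x/y≤z⇒x≤z*y {x} 0<y p = ≤-respˡ (x/y*y≈x x 0<y) (*-monoʳ (<⇒≤ 0<y) p)

  x≤z*y⇒x/y≤z : ∀ {x y z} → 0# < y → x ≤ z * y → x / y ≤ z
  x≤z*y⇒x/y≤z {x} {y} {z} 0<y p = *-cancelˡ-≤ 0<y (begin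
    y * (x / y)  ≈⟨ *-comm y _ ⟩
    x / y * y    ≈⟨ x/y*y≈x x 0<y ⟩
    x            ≤⟨ p ⟩
    z * y        ≈⟨ *-comm z y ⟩
    y * z        ∎)
    where open ≤R

  z*y≤x⇒z≤x/y : ∀ {x y z} → 0# < y → z * y ≤ x → z ≤ x / y
  z*y≤x⇒z≤x/y {x} {y} {z} 0<y p = *-cancelˡ-≤ 0<y (begin
    y * z        ≈⟨ *-comm y z ⟩
    z * y        ≤⟨ p ⟩
    x            ≈⟨ x/y*y≈x x 0<y ⟨
    x / y * y    ≈⟨ *-comm _ y ⟩
    y * (x / y)  ∎)
    where open ≤R

  midpoint-- : ∀ a b → (a + b) / fromℕ 2 - (b - a) / fromℕ 2 ≈ a
  midpoint-- a b = ≈-from {k = a} (⁻¹-inv (fromℕ-pos 1))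
    (solve 3 (λ a b i → (a :+ b) :* i :- (b :- a) :* i := a :+ a :* (:2 :* i :- :1)) refl a b (fromℕ 2 ⁻¹))

  midpoint-+ : ∀ a b → (a + b) / fromℕ 2 + (b - a) / fromℕ 2 ≈ b
  midpoint-+ a b = ≈-from {k = b} (⁻¹-inv (fromℕ-pos 1))
    (solve 3 (λ a b i → (a :+ b) :* i :+ (b :- a) :* i := b :+ b :* (:2 :* i :- :1)) refl a b (fromℕ 2 ⁻¹))

  x≤∣x∣ : ∀ x → x ≤ ∣ x ∣
  x≤∣x∣ x = x≤x⊔y x (- x)

  -x≤∣x∣ : ∀ x → - x ≤ ∣ x ∣
  -x≤∣x∣ x = x≤y⊔x x (- x)

  ∣∣-lub : ∀ {x a} → x ≤ a → - x ≤ a → ∣ x ∣ ≤ a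
  ∣∣-lub = ⊔-lub

  ∣∣≤⇒-≤ : ∀ {x a} → ∣ x ∣ ≤ a → - a ≤ x
  ∣∣≤⇒-≤ {x} p = ≤-respʳ (solve 1 (λ x → :- (:- x) := x) refl x) (neg-mono (≤-trans (-x≤∣x∣ x) p))

  0≤∣x∣ : ∀ x → 0# ≤ ∣ x ∣
  0≤∣x∣ x with ≤-total 0# x
  ... | inj₁ 0≤x = ≤-trans 0≤x (x≤∣x∣ x)
  ... | inj₂ x≤0 = ≤-trans (≤-respˡ (solve 0 (:- :0 := :0) refl) (neg-mono x≤0)) (-x≤∣x∣ x)

  0≤x⇒∣x∣≈x : ∀ {x} → 0# ≤ x → ∣ x ∣ ≈ x
  0≤x⇒∣x∣≈x {x} 0≤x = ≤-antisym (∣∣-lub ≤-refl (≤-from (0≤x ⊕ 0≤x)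
    (solve 1 (λ x → x := :- x :+ (x :+ x)) refl x))) (x≤∣x∣ x)

  ∣∣-mono-≈ : ∀ {x y} → x ≈ y → ∣ x ∣ ≤ ∣ y ∣
  ∣∣-mono-≈ {x} {y} x≈y = ∣∣-lub (≤-respˡ (sym x≈y) (x≤∣x∣ y)) (≤-respˡ (-‿cong (sym x≈y)) (-x≤∣x∣ y))

  ∣∣-cong : ∀ {x y} → x ≈ y → ∣ x ∣ ≈ ∣ y ∣
  ∣∣-cong x≈y = ≤-antisym (∣∣-mono-≈ x≈y) (∣∣-mono-≈ (sym x≈y))

  ∣-x∣≤∣x∣ : ∀ x → ∣ - x ∣ ≤ ∣ x ∣
  ∣-x∣≤∣x∣ x = ∣∣-lub (-x≤∣x∣ x) (≤-respˡ (solve 1 (λ x → x := :- (:- x)) refl x) (x≤∣x∣ x))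

  ∣x∣*∣x∣≈x*x : ∀ x → ∣ x ∣ * ∣ x ∣ ≈ x * x
  ∣x∣*∣x∣≈x*x x with ≤-total 0# x
  ... | inj₁ 0≤x = *-cong (0≤x⇒∣x∣≈x 0≤x) (0≤x⇒∣x∣≈x 0≤x)
  ... | inj₂ x≤0 = trans (*-cong ∣x∣≈-x ∣x∣≈-x) (solve 1 (λ x → :- x :* :- x := x :* x) refl x)
    where
    0≤-x : 0# ≤ - x
    0≤-x = ≤-respʳ (+-identityˡ (- x)) (x≤y⇒0≤y-x x≤0)
    ∣x∣≈-x : ∣ x ∣ ≈ - x
    ∣x∣≈-x = ≤-antisym (∣∣-lub (≤-trans x≤0 0≤-x) ≤-refl) (-x≤∣x∣ x)

  ∣x-y∣≤∣y-x∣ : ∀ x y → ∣ x - y ∣ ≤ ∣ y - x ∣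
  ∣x-y∣≤∣y-x∣ x y = ≤-respˡ (∣∣-cong (solve 2 (λ x y → :- (y :- x) := x :- y) refl x y)) (∣-x∣≤∣x∣ (y - x))

  ∣x+y∣≤ : ∀ {x y a b} → ∣ x ∣ ≤ a → ∣ y ∣ ≤ b → ∣ x + y ∣ ≤ a + b
  ∣x+y∣≤ {x} {y} p q = ∣∣-lub (+-mono-≤ (≤-trans (x≤∣x∣ x) p) (≤-trans (x≤∣x∣ y) q))
    (≤-respˡ (solve 2 (λ x y → :- x :- y := :- (x :+ y)) refl x y)
      (+-mono-≤ (≤-trans (-x≤∣x∣ x) p) (≤-trans (-x≤∣x∣ y) q)))

  ∣x-y∣≤ : ∀ {x y a b} → ∣ x ∣ ≤ a → ∣ y ∣ ≤ b → ∣ x - y ∣ ≤ a + b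
  ∣x-y∣≤ {y = y} p q = ∣x+y∣≤ p (≤-trans (∣-x∣≤∣x∣ y) q)

  triangle : ∀ x y z → ∣ x - z ∣ ≤ ∣ x - y ∣ + ∣ y - z ∣
  triangle x y z = ≤-respˡ (∣∣-cong (solve 3 (λ x y z → (x :- y) :+ (y :- z) := x :- z) refl x y z))
    (∣x+y∣≤ {x - y} {y - z} ≤-refl ≤-refl)

  -- Certificates for ± x y ≤ a b: 2 (a b ∓ x y) = (a - x) (b ± y) + (a + x) (b ∓ y).
  ∣x*y∣≤ : ∀ {x y a b} → ∣ x ∣ ≤ a → ∣ y ∣ ≤ b → ∣ x * y ∣ ≤ a * b
  ∣x*y∣≤ {x} {y} {a} {b} p q = ∣∣-lub
    (*-cancelˡ-≤ (fromℕ-pos 1) (≤-from ((a-x ⊗ b+y) ⊕ (a+x ⊗ b-y))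
      (solve 4 (λ x y a b → :2 :* (a :* b) := :2 :* (x :* y) :+
        ((a :- x) :* (b :- (:- y)) :+ (a :- (:- x)) :* (b :- y))) refl x y a b)))
    (*-cancelˡ-≤ (fromℕ-pos 1) (≤-from ((a-x ⊗ b-y) ⊕ (a+x ⊗ b+y))
      (solve 4 (λ x y a b → :2 :* (a :* b) := :2 :* (:- (x :* y)) :+
        ((a :- x) :* (b :- y) :+ (a :- (:- x)) :* (b :- (:- y)))) refl x y a b)))
    where
    a-x = x≤y⇒0≤y-x (≤-trans (x≤∣x∣ x) p)
    a+x = x≤y⇒0≤y-x (≤-trans (-x≤∣x∣ x) p)
    b-y = x≤y⇒0≤y-x (≤-trans (x≤∣x∣ y) q)
    b+y = x≤y⇒0≤y-x (≤-trans (-x≤∣x∣ y) q)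

-- Suprema, the Archimedean property and limits of sequences

module Limits (em : ExcludedMiddle 0ℓ) (ℝ : CompleteOrderedField) where
  open Reals em ℝ hiding (zero)
  open OrderedField em ℝ

  the-satisfies : ∀ {A : Set} {a : A} (P : Pred A 0ℓ) → ∃ P → P (the a P)
  the-satisfies P ∃P with em {∃ P}
  ... | yes (_ , p) = p
  ... | no  ∄P      = ⊥-elim (∄P ∃P)

  least : ∀ {P : ℕ → Set} n → P n → ∃[ m ] P m ∧ (∀ k → P k → m ℕ.≤ k)
  least {P} n p with em {P 0}
  least         n       p | yes p₀ = 0 , p₀ , λ _ _ → ℕ.z≤n
  least         zero    p | no ¬p₀ = ⊥-elim (¬p₀ p)
  least {P = P} (suc n) p | no ¬p₀ with least {P ∘ suc} n p
  ... | m , pₘ , m≤ = suc m , pₘ , λ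
    { zero p₀ → ⊥-elim (¬p₀ p₀) ; (suc k) pₖ → ℕ.s≤s (m≤ k pₖ) }

  -- If no natural number reached `x`, the natural numbers would have a supremum `s`; from n + 1 ≤ s
  -- for all n, the smaller s - 1 would be an upper bound as well.
  archimedean : ∀ x → ∃[ n ] x ≤ fromℕ n
  archimedean x with em {∃[ n ] x ≤ fromℕ n}
  ... | yes bound = bound
  ... | no  none  = ⊥-elim (<⇒≱ s-1<s (s-least (s - 1#) λ _ (n , y≈n) → ≤-respˡ (sym y≈n) (n≤s-1 n)))
    where
    IsNatural : Pred Carrier 0ℓ
    IsNatural y = ∃[ n ] y ≈ fromℕ n

    supremum = complete IsNatural (0# , 0 , refl)
      (x , λ y (n , y≈n) → ≤-respˡ (sym y≈n) (<⇒≤ (≰⇒> λ x≤n → none (n , x≤n))))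
    s = proj₁ supremum
    s-upper = proj₁ (proj₂ supremum)
    s-least = proj₂ (proj₂ supremum)

    n≤s-1 : ∀ n → fromℕ n ≤ s - 1#
    n≤s-1 n = ≤-from (x≤y⇒0≤y-x (s-upper _ (suc n , refl)))
      (solve 2 (λ s n → s :- :1 := n :+ (s :- (:1 :+ n))) refl s (fromℕ n))

    s-1<s : s - 1# < s
    s-1<s = 0<y-x⇒x<y (<-respʳ (solve 1 (λ s → :1 := s :- (s :- :1)) refl s) 0<1)

  x≤⌈x⌉ : ∀ x → x ≤ fromℕ ⌈ x ⌉
  x≤⌈x⌉ x = proj₁ (the-satisfies {a = 0} (λ n → x ≤ fromℕ n ∧ (∀ k → x ≤ fromℕ k → n ℕ.≤ k))
    (least (proj₁ (archimedean x)) (proj₂ (archimedean x))))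

  half : ∀ {x} → 0# < x → ∃[ y ] 0# < y ∧ y + y ≈ x
  half {x} 0<x = x / fromℕ 2 , /-pos 0<x (fromℕ-pos 1) ,
    trans (solve 1 (λ y → y :+ y := y :* :2) refl (x / fromℕ 2)) (x/y*y≈x x (fromℕ-pos 1))

  ≤-by-ε : ∀ {x y} → (∀ ε → 0# < ε → x ≤ y + ε) → x ≤ y
  ≤-by-ε {x} {y} p with <-≤-connex y x
  ... | inj₂ x≤y = x≤y
  ... | inj₁ y<x = let ε , 0<ε , 2ε≈x-y = half (x<y⇒0<y-x y<x) in ⊥-elim (<⇒≱ 0<ε (≤-from (x≤y⇒0≤y-x (p ε 0<ε) ⊕ ≈⇒0≤*[-] (- 1#) 2ε≈x-y)
    (solve 3 (λ x y ε → :0 := ε :+ ((y :+ ε :- x) :+ (:- :1) :* (ε :+ ε :- (x :- y)))) refl x y ε)))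

  limit-bound : ∀ {a l b K} N → a ⟶ l → (∀ n → N ℕ.≤ n → ∣ b - a n ∣ ≤ K) → ∣ b - l ∣ ≤ K
  limit-bound {a} {l} {b} {K} N a⟶l p = ≤-by-ε λ ε 0<ε →
    let N′ , close = a⟶l ε 0<ε
        n = N ℕ.⊔ N′
    in ≤-trans (triangle b (a n) l) (+-mono-≤ (p n (ℕ.m≤m⊔n N N′)) (<⇒≤ (close n (ℕ.m≤n⊔m N N′))))

  ∣x-y∣≤0⇒x≈y : ∀ {x y} → ∣ x - y ∣ ≤ 0# → x ≈ y
  ∣x-y∣≤0⇒x≈y {x} {y} p = ≤-antisym
    (≤-from (x≤y⇒0≤y-x (≤-trans (x≤∣x∣ _) p)) (solve 2 (λ x y → y := x :+ (:0 :- (x :- y))) refl x y))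
    (≤-from (x≤y⇒0≤y-x (≤-trans (-x≤∣x∣ _) p)) (solve 2 (λ x y → x := y :+ (:0 :- (:- (x :- y)))) refl x y))

  limit-unique : ∀ {a b l k} → (∀ n → a n ≈ b n) → a ⟶ l → b ⟶ k → l ≈ k
  limit-unique {a} {b} {l} {k} a≈b a⟶l b⟶k = ∣x-y∣≤0⇒x≈y (≤-by-ε λ ε 0<ε →
    let N , close = a⟶l ε 0<ε
    in limit-bound N b⟶k λ n N≤n → begin
      ∣ l - b n ∣  ≈⟨ ∣∣-cong (+-congˡ (-‿cong (a≈b n))) ⟨
      ∣ l - a n ∣  ≤⟨ ∣x-y∣≤∣y-x∣ l (a n) ⟩
      ∣ a n - l ∣  <⟨ close n N≤n ⟩
      ε            ≈⟨ +-identityˡ ε ⟨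
      0# + ε       ∎)
    where open ≤R

  Null : (ℕ → Carrier) → Set
  Null δ = ∀ ε → 0# < ε → ∃[ N ] (∀ n → N ℕ.≤ n → δ n < ε)

  -- The limit is the supremum of the lower bounds a n - δ n.
  cauchy : ∀ (a δ : ℕ → Carrier) N → Null δ →
           (∀ m n → N ℕ.≤ m → m ℕ.≤ n → ∣ a m - a n ∣ ≤ δ m) → ∃ (a ⟶_)
  cauchy a δ N δ-null p = s , λ ε 0<ε →
    let N′ , small = δ-null ε 0<ε
    in N ℕ.⊔ N′ , λ n N⊔N′≤n →
      ≤-<-trans (∣a-s∣≤δ n (ℕ.≤-trans (ℕ.m≤m⊔n N N′) N⊔N′≤n)) (small n (ℕ.≤-trans (ℕ.m≤n⊔m N N′) N⊔N′≤n))
    where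
    lower≤upper : ∀ m n → N ℕ.≤ m → N ℕ.≤ n → a m - δ m ≤ a n + δ n
    lower≤upper m n N≤m N≤n with ℕ.≤-total m n
    -- The case of equal indices in `p` shows that `δ` is nonnegative, which disposes of the error
    -- term left over in the estimate.
    ... | inj₁ m≤n = ≤-from (x≤y⇒0≤y-x (≤-trans (x≤∣x∣ _) (p m n N≤m m≤n)) ⊕ ≤-trans (0≤∣x∣ _)
      (p n n N≤n ℕ.≤-refl))
      (solve 4 (λ a b c d → b :+ d := (a :- c) :+ ((c :- (a :- b)) :+ d)) refl (a m) (a n) (δ m) (δ n))
    ... | inj₂ n≤m = ≤-from (x≤y⇒0≤y-x (≤-trans (-x≤∣x∣ _) (p n m N≤n n≤m)) ⊕ ≤-trans (0≤∣x∣ _)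
      (p m m N≤m ℕ.≤-refl))
      (solve 4 (λ a b c d → b :+ d := (a :- c) :+ ((d :- (:- (b :- a))) :+ c)) refl (a m) (a n) (δ m) (δ n))

    IsLower : Pred Carrier 0ℓ
    IsLower y = ∃[ m ] N ℕ.≤ m ∧ y ≈ a m - δ m

    supremum = complete IsLower (a N - δ N , N , ℕ.≤-refl , refl)
      (a N + δ N , λ y (m , N≤m , y≈) → ≤-respˡ (sym y≈) (lower≤upper m N N≤m ℕ.≤-refl))
    s = proj₁ supremum

    ∣a-s∣≤δ : ∀ n → N ℕ.≤ n → ∣ a n - s ∣ ≤ δ n
    ∣a-s∣≤δ n N≤n = ∣∣-lub
      (≤-from (x≤y⇒0≤y-x (proj₁ (proj₂ supremum) _ (n , N≤n , refl)))
        (solve 3 (λ a s d → d := (a :- s) :+ (s :- (a :- d))) refl (a n) s (δ n)))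
      (≤-from (x≤y⇒0≤y-x (proj₂ (proj₂ supremum) (a n + δ n)
                 λ y (m , N≤m , y≈) → ≤-respˡ (sym y≈) (lower≤upper m n N≤m N≤n)))
        (solve 3 (λ a s d → d := (:- (a :- s)) :+ ((a :+ d) :- s)) refl (a n) s (δ n)))

-- Cauchy products and the exponential series

module Series (em : ExcludedMiddle 0ℓ) (ℝ : CompleteOrderedField) where
  open Reals em ℝ hiding (zero)
  open OrderedField em ℝ
  open Limits em ℝ

  Seq : Set
  Seq = ℕ → Carrier

  Σ< : ℕ → Seq → Carrier
  Σ< n f = sum {n} λ k → f (toℕ k)

  Σ<-snoc : ∀ n f → Σ< (suc n) f ≈ Σ< n f + f n
  Σ<-snoc zero    f = +-comm _ _
  Σ<-snoc (suc n) f = trans (+-congˡ (Σ<-snoc n (f ∘ suc))) (sym (+-assoc _ _ _))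

  Σ<-cong : ∀ n {f g} → (∀ i → f i ≈ g i) → Σ< n f ≈ Σ< n g
  Σ<-cong zero    p = refl
  Σ<-cong (suc n) p = +-cong (p 0) (Σ<-cong n (p ∘ suc))

  Σ<-nonNeg : ∀ n {f} → (∀ i → 0# ≤ f i) → 0# ≤ Σ< n f
  Σ<-nonNeg zero    p = ≤-refl
  Σ<-nonNeg (suc n) p = p 0 ⊕ Σ<-nonNeg n (p ∘ suc)

  Σ<-mono : ∀ {m n f} → (∀ i → 0# ≤ f i) → m ℕ.≤ n → Σ< m f ≤ Σ< n f
  Σ<-mono {n = n} p ℕ.z≤n       = Σ<-nonNeg n p
  Σ<-mono         p (ℕ.s≤s m≤n) = +-mono-≤ ≤-refl (Σ<-mono (p ∘ suc) m≤n)

  infix 4 _≼_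
  _≼_ : Seq → Seq → Set
  f ≼ F = ∀ i → ∣ f i ∣ ≤ F i

  ≼⇒nonNeg : ∀ {f F} → f ≼ F → ∀ i → 0# ≤ F i
  ≼⇒nonNeg p i = ≤-trans (0≤∣x∣ _) (p i)

  Σ<-bound : ∀ n {f F} → f ≼ F → ∣ Σ< n f ∣ ≤ Σ< n F
  Σ<-bound zero    p = ≤-reflexive (0≤x⇒∣x∣≈x ≤-refl)
  Σ<-bound (suc n) p = ∣x+y∣≤ (p 0) (Σ<-bound n (p ∘ suc))

  Σ<-tail-bound : ∀ {m n f F} → f ≼ F → m ℕ.≤ n → ∣ Σ< n f - Σ< m f ∣ ≤ Σ< n F - Σ< m F
  Σ<-tail-bound {n = n} {f} {F} p ℕ.z≤n = ≤-trans (≤-reflexive (∣∣-cong (x-0≈x (Σ< n f))))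
    (≤-trans (Σ<-bound n p) (≤-reflexive (sym (x-0≈x (Σ< n F)))))
    where
    x-0≈x : ∀ x → x - 0# ≈ x
    x-0≈x x = solve 1 (λ x → x :- :0 := x) refl x
  Σ<-tail-bound {suc m} {suc n} {f} {F} p (ℕ.s≤s m≤n) =
    ≤-trans (≤-reflexive (∣∣-cong (shift (f 0) _ _)))
      (≤-trans (Σ<-tail-bound (p ∘ suc) m≤n) (≤-reflexive (sym (shift (F 0) _ _))))
    where
    shift : ∀ z x y → (z + x) - (z + y) ≈ x - y
    shift z x y = solve 3 (λ z x y → (z :+ x) :- (z :+ y) := x :- y) refl z x y

  conv : Seq → Seq → Seq
  conv f g zero    = f 0 * g 0
  conv f g (suc n) = f 0 * g (suc n) + conv (f ∘ suc) g n

  -- The sum of the products `f i * g j` over the triangle i + j < n, arranged by rows; `conv f g n`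
  -- is the antidiagonal i + j = n, which `tri-snoc` adds to it.
  tri : Seq → Seq → ℕ → Carrier
  tri f g zero    = 0#
  tri f g (suc n) = f 0 * Σ< (suc n) g + tri (f ∘ suc) g n

  tri-snoc : ∀ n f g → tri f g (suc n) ≈ tri f g n + conv f g n
  tri-snoc zero    f g = solve 2 (λ a b → a :* (b :+ :0) :+ :0 := :0 :+ a :* b) refl (f 0) (g 0)
  tri-snoc (suc n) f g = begin
    f 0 * Σ< (2 ℕ.+ n) g + tri (f ∘ suc) g (suc n)
      ≈⟨ +-cong (*-congˡ (Σ<-snoc (suc n) g)) (tri-snoc n (f ∘ suc) g) ⟩
    f 0 * (Σ< (suc n) g + g (suc n)) + (tri (f ∘ suc) g n + conv (f ∘ suc) g n)
      ≈⟨ solve 5 (λ a s b t c → a :* (s :+ b) :+ (t :+ c) := a :* s :+ t :+ (a :* b :+ c)) refl _ _ _ _ _ ⟩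
    f 0 * Σ< (suc n) g + tri (f ∘ suc) g n + (f 0 * g (suc n) + conv (f ∘ suc) g n) ∎
    where open ≈R

  Σ<-conv : ∀ n f g → Σ< n (conv f g) ≈ tri f g n
  Σ<-conv zero    f g = refl
  Σ<-conv (suc n) f g =
    trans (Σ<-snoc n (conv f g)) (trans (+-congʳ (Σ<-conv n f g)) (sym (tri-snoc n f g)))

  -- The part of the rectangle i < n, j < m outside the triangle i + j < n consists of products,
  -- each majorized by the corresponding product for `F` and `G`. The condition n ≤ m keeps the
  -- triangle inside the rectangle.
  product-bound : ∀ n m {f g F G} → n ℕ.≤ m → f ≼ F → g ≼ G →
                  ∣ Σ< n f * Σ< m g - tri f g n ∣ ≤ Σ< n F * Σ< m G - tri F G n
  product-bound zero m {g = g} {G = G} _ p q =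
    ≤-trans (≤-reflexive (∣∣-cong (0x-0 (Σ< m g))))
      (≤-trans (≤-reflexive (0≤x⇒∣x∣≈x ≤-refl)) (≤-reflexive (sym (0x-0 (Σ< m G)))))
    where
    0x-0 : ∀ x → 0# * x - 0# ≈ 0#
    0x-0 x = solve 1 (λ x → :0 :* x :- :0 := :0) refl x
  product-bound (suc n) m {f} {g} {F} {G} n<m p q =
    ≤-trans (≤-reflexive (∣∣-cong (split (f 0) _ _ _ _)))
      (≤-trans (∣x+y∣≤ (∣x*y∣≤ (p 0) (Σ<-tail-bound q n<m)) (product-bound n m (ℕ.<⇒≤ n<m) (p ∘ suc) q))
        (≤-reflexive (sym (split (F 0) _ _ _ _))))
    where
    split : ∀ a s t u v → (a + s) * t - (a * u + v) ≈ a * (t - u) + (s * t - v)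
    split a s t u v = solve 5 (λ a s t u v →
      (a :+ s) :* t :- (a :* u :+ v) := a :* (t :- u) :+ (s :* t :- v)) refl a s t u v

  tri-nonNeg : ∀ n {F G} → (∀ i → 0# ≤ F i) → (∀ i → 0# ≤ G i) → 0# ≤ tri F G n
  tri-nonNeg zero    p q = ≤-refl
  tri-nonNeg (suc n) p q = (p 0 ⊗ Σ<-nonNeg (suc n) q) ⊕ tri-nonNeg n (p ∘ suc) q

  -- The rectangle i < n, j < m lies inside the triangle i + j < n + m. With `product-bound`, the
  -- truncation error becomes a difference of partial sums of the product series.
  product≤tri : ∀ n m {F G} → (∀ i → 0# ≤ F i) → (∀ i → 0# ≤ G i) →
                Σ< n F * Σ< m G ≤ tri F G (n ℕ.+ m)
  product≤tri zero    m p q = ≤-trans (≤-reflexive (zeroˡ _)) (tri-nonNeg m p q)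
  product≤tri (suc n) m {F} {G} p q = begin
    (F 0 + Σ< n (F ∘ suc)) * Σ< m G            ≈⟨ distribʳ _ _ _ ⟩
    F 0 * Σ< m G + Σ< n (F ∘ suc) * Σ< m G     ≤⟨ +-mono-≤
      (*-monoˡ (p 0) (Σ<-mono q (ℕ.m≤n+m m (suc n)))) (product≤tri n m (p ∘ suc) q) ⟩
    tri F G (suc n ℕ.+ m)                      ∎
    where open ≤R

  conv-cong : ∀ n {f g u v} → (∀ i → f i ≈ u i) → (∀ i → g i ≈ v i) → conv f g n ≈ conv u v n
  conv-cong zero    p q = *-cong (p 0) (q 0)
  conv-cong (suc n) p q = +-cong (*-cong (p 0) (q (suc n))) (conv-cong n (p ∘ suc) q)

  conv-+ˡ : ∀ n f u g → conv (λ i → f i + u i) g n ≈ conv f g n + conv u g n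
  conv-+ˡ zero    f u g = distribʳ _ _ _
  conv-+ˡ (suc n) f u g = trans (+-cong (distribʳ _ _ _) (conv-+ˡ n (f ∘ suc) (u ∘ suc) g))
    (solve 4 (λ a b c d → (a :+ b) :+ (c :+ d) := (a :+ c) :+ (b :+ d)) refl _ _ _ _)

  conv-scaleˡ : ∀ n k f g → conv (λ i → k * f i) g n ≈ k * conv f g n
  conv-scaleˡ zero    k f g = *-assoc _ _ _
  conv-scaleˡ (suc n) k f g = trans (+-cong (*-assoc _ _ _) (conv-scaleˡ n k (f ∘ suc) g))
    (sym (distribˡ _ _ _))

  weighted : Seq → Seq
  weighted f i = fromℕ i * f i

  -- Weighting by the index acts on generating functions as t d/dt, so this is the product rule.
  conv-leibniz : ∀ n f g → fromℕ n * conv f g n ≈ conv (weighted f) g n + conv f (weighted g) n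
  conv-leibniz zero f g = solve 2 (λ a b → :0 :* (a :* b) := :0 :* a :* b :+ a :* (:0 :* b)) refl _ _
  conv-leibniz (suc n) f g = begin
    (1# + fromℕ n) * (f 0 * g (suc n) + c)
      ≈⟨ solve 4 (λ n a b c → (:1 :+ n) :* (a :* b :+ c) := (:1 :+ n) :* (a :* b) :+ c :+ n :* c) refl _ _ _ _ ⟩
    (1# + fromℕ n) * (f 0 * g (suc n)) + c + fromℕ n * c
      ≈⟨ +-congˡ (conv-leibniz n (f ∘ suc) g) ⟩
    (1# + fromℕ n) * (f 0 * g (suc n)) + c + (wc + cw)
      ≈⟨ solve 6 (λ n a b c w v → (:1 :+ n) :* (a :* b) :+ c :+ (w :+ v)
           := :0 :* a :* b :+ (c :+ w) :+ (a :* ((:1 :+ n) :* b) :+ v)) refl _ _ _ _ _ _ ⟩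
    0# * f 0 * g (suc n) + (c + wc) + (f 0 * ((1# + fromℕ n) * g (suc n)) + cw)
      ≈⟨ +-congʳ (+-congˡ (conv-+ˡ n _ _ g)) ⟨
    0# * f 0 * g (suc n) + conv (λ i → f (suc i) + weighted (f ∘ suc) i) g n +
      (f 0 * ((1# + fromℕ n) * g (suc n)) + cw)
      ≈⟨ +-congʳ (+-congˡ (conv-cong n
           (λ i → solve 2 (λ k a → a :+ k :* a := (:1 :+ k) :* a) refl (fromℕ i) (f (suc i))) (λ _ → refl))) ⟩
    conv (weighted f) g (suc n) + conv f (weighted g) (suc n) ∎
    where
    open ≈R
    c  = conv (f ∘ suc) g n
    wc = conv (weighted (f ∘ suc)) g n
    cw = conv (f ∘ suc) (weighted g) n

  expTerm : Carrier → Seq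
  expTerm x zero    = 1#
  expTerm x (suc n) = expTerm x n * x / fromℕ (suc n)

  expTerm-suc : ∀ x n → fromℕ (suc n) * expTerm x (suc n) ≈ x * expTerm x n
  expTerm-suc x n = trans (*-comm _ _) (trans (x/y*y≈x _ (fromℕ-pos n)) (*-comm _ _))

  expTerm-cong : ∀ {x y} → x ≈ y → ∀ n → expTerm x n ≈ expTerm y n
  expTerm-cong x≈y zero    = refl
  expTerm-cong x≈y (suc n) = *-congʳ (*-cong (expTerm-cong x≈y n) x≈y)

  !*expTerm : ∀ x n → fromℕ (n !) * expTerm x n ≈ x ^ n
  !*expTerm x zero    = solve 0 ((:1 :+ :0) :* :1 := :1) refl
  !*expTerm x (suc n) = begin
    fromℕ (suc n ℕ.* n !) * expTerm x (suc n)
      ≈⟨ *-congʳ (fromℕ-* (suc n) (n !)) ⟩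
    fromℕ (suc n) * fromℕ (n !) * expTerm x (suc n)
      ≈⟨ solve 3 (λ s f e → s :* f :* e := f :* (s :* e)) refl _ _ _ ⟩
    fromℕ (n !) * (fromℕ (suc n) * expTerm x (suc n))
      ≈⟨ *-congˡ (expTerm-suc x n) ⟩
    fromℕ (n !) * (x * expTerm x n)
      ≈⟨ solve 3 (λ f x e → f :* (x :* e) := x :* (f :* e)) refl _ _ _ ⟩
    x * (fromℕ (n !) * expTerm x n)
      ≈⟨ *-congˡ (!*expTerm x n) ⟩
    x * x ^ n ∎
    where open ≈R

  k*u≈v⇒v/k≈u : ∀ {k u v} → 0# < k → k * u ≈ v → v / k ≈ u
  k*u≈v⇒v/k≈u {k} {u} {v} 0<k ku≈v = begin
    v * k ⁻¹        ≈⟨ *-congʳ ku≈v ⟨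
    k * u * k ⁻¹    ≈⟨ solve 3 (λ k u i → k :* u :* i := k :* i :* u) refl _ _ _ ⟩
    k * k ⁻¹ * u    ≈⟨ *-congʳ (⁻¹-inv 0<k) ⟩
    1# * u          ≈⟨ *-identityˡ u ⟩
    u               ∎
    where open ≈R

  x^n/n!≈expTerm : ∀ x n → x ^ n / fromℕ (n !) ≈ expTerm x n
  x^n/n!≈expTerm x n = k*u≈v⇒v/k≈u (<-≤-trans (fromℕ-pos 0) (fromℕ-mono (ℕ.1≤n! n))) (!*expTerm x n)

  -- The binomial theorem divided by n!. Weighting `expTerm x` by the index gives x times its shift,
  -- so the product rule yields for the convolution the recursion that defines the terms of the
  -- exponential series at x + y.
  expTerm-+ : ∀ n x y → conv (expTerm x) (expTerm y) n ≈ expTerm (x + y) n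
  expTerm-+ zero    x y = *-identityʳ 1#
  expTerm-+ (suc n) x y = *-cancelˡ-≈ (begin
    fromℕ (suc n) * conv e e′ (suc n)
      ≈⟨ conv-leibniz (suc n) e e′ ⟩
    conv (weighted e) e′ (suc n) + conv e (weighted e′) (suc n)
      ≈⟨ +-cong (weighted-expˡ n) (weighted-expʳ n e) ⟩
    x * conv e e′ n + y * conv e e′ n
      ≈⟨ distribʳ _ x y ⟨
    (x + y) * conv e e′ n
      ≈⟨ *-congˡ (expTerm-+ n x y) ⟩
    (x + y) * expTerm (x + y) n
      ≈⟨ expTerm-suc (x + y) n ⟨
    fromℕ (suc n) * expTerm (x + y) (suc n) ∎)
    where
    open ≈R
    e e′ : Seq
    e  = expTerm x
    e′ = expTerm y

    *-cancelˡ-≈ : ∀ {u v} → fromℕ (suc n) * u ≈ fromℕ (suc n) * v → u ≈ v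
    *-cancelˡ-≈ p = trans (sym (k*u≈v⇒v/k≈u (fromℕ-pos n) p)) (k*u≈v⇒v/k≈u (fromℕ-pos n) refl)

    weighted-expˡ : ∀ n → conv (weighted e) e′ (suc n) ≈ x * conv e e′ n
    weighted-expˡ n = begin
      0# * 1# * e′ (suc n) + conv (weighted e ∘ suc) e′ n
        ≈⟨ solve 2 (λ a b → :0 :* :1 :* a :+ b := b) refl _ _ ⟩
      conv (weighted e ∘ suc) e′ n
        ≈⟨ conv-cong n (expTerm-suc x) (λ _ → refl) ⟩
      conv (λ i → x * e i) e′ n
        ≈⟨ conv-scaleˡ n x e e′ ⟩
      x * conv e e′ n ∎

    weighted-expʳ : ∀ n f → conv f (weighted e′) (suc n) ≈ y * conv f e′ n
    weighted-expʳ zero f = trans (+-congˡ (trans (*-congˡ (zeroˡ 1#)) (zeroʳ _)))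
      (trans (+-identityʳ _) (trans (*-congˡ (expTerm-suc y 0))
        (solve 2 (λ a y → a :* (y :* :1) := y :* (a :* :1)) refl _ _)))
    weighted-expʳ (suc n) f = begin
      f 0 * weighted e′ (2 ℕ.+ n) + conv (f ∘ suc) (weighted e′) (suc n)
        ≈⟨ +-cong (*-congˡ (expTerm-suc y (suc n))) (weighted-expʳ n (f ∘ suc)) ⟩
      f 0 * (y * e′ (suc n)) + y * conv (f ∘ suc) e′ n
        ≈⟨ solve 4 (λ a y b c → a :* (y :* b) :+ y :* c := y :* (a :* b :+ c)) refl _ _ _ _ ⟩
      y * conv f e′ (suc n) ∎

  expTerm-≼ : ∀ {x X} → ∣ x ∣ ≤ X → expTerm x ≼ expTerm X
  expTerm-≼ p zero    = ≤-reflexive (0≤x⇒∣x∣≈x 0≤1)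
  expTerm-≼ p (suc n) = ∣x*y∣≤ (∣x*y∣≤ (expTerm-≼ p n) p) (≤-reflexive (0≤x⇒∣x∣≈x (<⇒≤ (⁻¹-pos (fromℕ-pos n)))))

  module Tail {X : Carrier} (0≤X : 0# ≤ X) where

    e : Seq
    e = expTerm X

    e-nonNeg : ∀ n → 0# ≤ e n
    e-nonNeg = ≼⇒nonNeg (expTerm-≼ (≤-reflexive (0≤x⇒∣x∣≈x 0≤X)))

    -- From such an index on, each term of the series is at most half of the preceding one.
    Past : ℕ → Set
    Past n = fromℕ 2 * X ≤ fromℕ n

    past-mono : ∀ {m n} → m ℕ.≤ n → Past m → Past n
    past-mono m≤n p = ≤-trans p (fromℕ-mono m≤n)

    halving : ∀ n → Past n → fromℕ 2 * e (suc n) ≤ e n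
    halving n p = *-cancelˡ-≤ (fromℕ-pos n) (begin
      fromℕ (suc n) * (fromℕ 2 * e (suc n))  ≈⟨ solve 3 (λ s t e → s :* (t :* e) := t :* (s :* e)) refl _ _ _ ⟩
      fromℕ 2 * (fromℕ (suc n) * e (suc n))  ≈⟨ *-congˡ (expTerm-suc X n) ⟩
      fromℕ 2 * (X * e n)                    ≈⟨ *-assoc _ _ _ ⟨
      fromℕ 2 * X * e n                      ≤⟨ *-monoʳ (e-nonNeg n) (past-mono (ℕ.n≤1+n n) p) ⟩
      fromℕ (suc n) * e n                    ∎)
      where open ≤R

    -- By `halving`, adding twice the next term to a partial sum gives a nonincreasing quantity;
    -- this is the geometric tail estimate without a geometric series.
    tail : ∀ {m n} → Past m → m ℕ.≤′ n → Σ< n e + fromℕ 2 * e n ≤ Σ< m e + fromℕ 2 * e m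
    tail p ℕ.≤′-refl = ≤-refl
    tail {m} {suc n} p (ℕ.≤′-step m≤n) = begin
      Σ< (suc n) e + fromℕ 2 * e (suc n)  ≤⟨ +-mono-≤ (≤-reflexive (Σ<-snoc n e))
        (halving n (past-mono (ℕ.≤′⇒≤ m≤n) p)) ⟩
      Σ< n e + e n + e n                  ≈⟨ solve 2 (λ s e → s :+ e :+ e := s :+ :2 :* e) refl _ _ ⟩
      Σ< n e + fromℕ 2 * e n              ≤⟨ tail {m} {n} p m≤n ⟩
      Σ< m e + fromℕ 2 * e m              ∎
      where open ≤R

    Σ<-tail : ∀ {m n} → Past m → m ℕ.≤ n → Σ< n e - Σ< m e ≤ fromℕ 2 * e m
    Σ<-tail {m} {n} p m≤n = ≤-from (x≤y⇒0≤y-x (tail {m} {n} p (ℕ.≤⇒≤′ m≤n)) ⊕ (fromℕ-nonNeg 2 ⊗ e-nonNeg n))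
      (solve 4 (λ s t a b → a := (s :- t) :+ ((t :+ a :- (s :+ b)) :+ b)) refl _ _ _ _)

    decreasing : ∀ {m n} → Past m → m ℕ.≤′ n → e n ≤ e m
    decreasing p ℕ.≤′-refl = ≤-refl
    decreasing {m} {suc n} p (ℕ.≤′-step m≤n) = ≤-trans
      (≤-from {e (suc n)} {e n} (x≤y⇒0≤y-x (halving n (past-mono (ℕ.≤′⇒≤ m≤n) p)) ⊕ e-nonNeg (suc n))
        (solve 2 (λ a b → a := b :+ ((a :- :2 :* b) :+ b)) refl _ _))
      (decreasing {m} {n} p m≤n)

    N₀ : ℕ
    N₀ = proj₁ (archimedean (fromℕ 2 * X))

    past-N₀ : Past N₀
    past-N₀ = proj₂ (archimedean (fromℕ 2 * X))

    -- Since (n + 1) e (n + 1) = X e n stays bounded by X e N₀, the terms decay at least like 1 / n.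
    -- A term of at least ε beyond N + N₀ would give n + 1 ≤ N ≤ n.
    e-null : Null e
    e-null ε 0<ε with archimedean (X * e N₀ / ε)
    ... | N , bound = suc (N ℕ.+ N₀) , λ
      { (suc n) (ℕ.s≤s N+N₀≤n) → ≰⇒> λ ε≤e → ℕ.<-irrefl ≡.refl (fromℕ-cancel-< {n} {n}
          (<-≤-trans (<-≤-trans (0<y-x⇒x<y (<-respʳ (solve 1 (λ n → :1 := :1 :+ n :- n) refl (fromℕ n)) 0<1))
            (*-cancelˡ-≤ 0<ε (n*ε≤N*ε n N+N₀≤n ε≤e))) (fromℕ-mono {N} {n} (ℕ.≤-trans (ℕ.m≤m+n N N₀) N+N₀≤n)))) }
      where
      open ≤R
      n*ε≤N*ε : ∀ n → N ℕ.+ N₀ ℕ.≤ n → ε ≤ e (suc n) → ε * fromℕ (suc n) ≤ ε * fromℕ N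
      n*ε≤N*ε n N+N₀≤n ε≤e = begin
        ε * fromℕ (suc n)          ≈⟨ *-comm _ _ ⟩
        fromℕ (suc n) * ε          ≤⟨ *-monoˡ (fromℕ-nonNeg (suc n)) ε≤e ⟩
        fromℕ (suc n) * e (suc n)  ≈⟨ expTerm-suc X n ⟩
        X * e n                    ≤⟨ *-monoˡ 0≤X (decreasing {N₀} {n} past-N₀
          (ℕ.≤⇒≤′ (ℕ.≤-trans (ℕ.m≤n+m N₀ N) N+N₀≤n))) ⟩
        X * e N₀                   ≤⟨ x/y≤z⇒x≤z*y 0<ε bound ⟩
        fromℕ N * ε                ≈⟨ *-comm _ _ ⟩
        ε * fromℕ N                ∎

    -- The n-th partial sum of cosine uses the exponential terms of index below 2n, so its error is
    -- a tail starting at 2n, at most twice the first term.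
    δ : Seq
    δ n = fromℕ 2 * e (2 ℕ.* n)

    δ-null : Null δ
    δ-null ε 0<ε = let ε′ , 0<ε′ , 2ε′≈ε = half 0<ε ; N , small = e-null ε′ 0<ε′ in
      N , λ n N≤n → 0<y-x⇒x<y (<-respʳ
      (≈-from {k = 1#} 2ε′≈ε (solve 3 (λ a b c → :2 :* (a :- b) := (c :- :2 :* b) :+ :1 :* (a :+ a :- c))
        refl ε′ (e (2 ℕ.* n)) ε))
      (*-pos (fromℕ-pos 1) (x<y⇒0<y-x (small (2 ℕ.* n) (ℕ.≤-trans N≤n (ℕ.m≤m+n n _))))))

    ≈-by-δ : ∀ {x y} K → 0# ≤ K → (∀ n → Past (2 ℕ.* n) → ∣ x - y ∣ ≤ K * δ n) → x ≈ y
    ≈-by-δ {x} {y} K 0≤K p = ∣x-y∣≤0⇒x≈y (≤-by-ε bound)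
      where
      open ≤R
      -- The tolerance is divided by 1 + K, because `K` itself may be zero.
      0<1+K : 0# < 1# + K
      0<1+K = +-pos-nonNeg 0<1 0≤K
      bound : ∀ ε → 0# < ε → ∣ x - y ∣ ≤ 0# + ε
      bound ε 0<ε = begin
        ∣ x - y ∣                   ≤⟨ p n (past-mono (ℕ.≤-trans (ℕ.m≤n+m N₀ N) (ℕ.m≤m+n n _)) past-N₀) ⟩
        K * δ n                     ≤⟨ *-monoˡ 0≤K (<⇒≤ (small n (ℕ.m≤m+n N N₀))) ⟩
        K * (ε / (1# + K))          ≤⟨ ≤-from (/-nonNeg (<⇒≤ 0<ε) 0<1+K)
          (solve 2 (λ k q → q :* (:1 :+ k) := k :* q :+ q) refl K (ε / (1# + K))) ⟩
        ε / (1# + K) * (1# + K)     ≈⟨ x/y*y≈x ε 0<1+K ⟩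
        ε                           ≈⟨ +-identityˡ ε ⟨
        0# + ε                      ∎
        where
        N,small = δ-null (ε / (1# + K)) (/-pos 0<ε 0<1+K)
        N = proj₁ N,small
        small = proj₂ N,small
        n = N ℕ.+ N₀

-- The cosine series, its product formula and its behaviour near zero

module CosineSeries (em : ExcludedMiddle 0ℓ) (ℝ : CompleteOrderedField) where
  open Reals em ℝ hiding (zero)
  open OrderedField em ℝ
  open Limits em ℝ
  open Series em ℝ

  -- κ n and σ n play the roles of cos (n π / 2) and cos (n π).
  κ : Seq
  κ 0             = 1#
  κ 1             = 0#
  κ (suc (suc n)) = - κ n

  σ : Seq
  σ zero    = 1#
  σ (suc n) = - σ n

  -- This is 2 cos A cos B = cos (A + B) + cos (A - B) at A = i π/2 and B = j π/2, where cos (A - B)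
  -- = cos (A + B) cos 2B because sin 2B vanishes. The factor 1 + σ j later splits into the terms
  -- for y and for -y.
  κ-product : ∀ i j → fromℕ 2 * (κ i * κ j) ≈ κ (i ℕ.+ j) * (1# + σ j)
  κ-product 0 0             = solve 0 (:2 :* (:1 :* :1) := :1 :* (:1 :+ :1)) refl
  κ-product 0 1             = solve 0 (:2 :* (:1 :* :0) := :0 :* (:1 :+ :- :1)) refl
  κ-product 0 (suc (suc j)) = begin
    fromℕ 2 * (1# * - κ j)       ≈⟨ solve 1 (λ a → :2 :* (:1 :* :- a) := :- (:2 :* (:1 :* a))) refl (κ j) ⟩
    - (fromℕ 2 * (1# * κ j))     ≈⟨ -‿cong (κ-product 0 j) ⟩
    - (κ j * (1# + σ j))         ≈⟨ solve 2 (λ a s → :- (a :* (:1 :+ s)) := :- a :* (:1 :+ :- (:- s))) refl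
      (κ j) (σ j) ⟩
    - κ j * (1# + - - σ j)       ∎
    where open ≈R
  κ-product 1 0             = solve 0 (:2 :* (:0 :* :1) := :0 :* (:1 :+ :1)) refl
  κ-product 1 1             = solve 0 (:2 :* (:0 :* :0) := :- :1 :* (:1 :+ :- :1)) refl
  κ-product 1 (suc (suc j)) = begin
    fromℕ 2 * (0# * - κ j)         ≈⟨ solve 1 (λ a → :2 :* (:0 :* :- a) := :- (:2 :* (:0 :* a))) refl (κ j) ⟩
    - (fromℕ 2 * (0# * κ j))       ≈⟨ -‿cong (κ-product 1 j) ⟩
    - (κ (suc j) * (1# + σ j))     ≈⟨ solve 2 (λ a s → :- (a :* (:1 :+ s)) := :- a :* (:1 :+ :- (:- s))) refl
      (κ (suc j)) (σ j) ⟩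
    - κ (suc j) * (1# + - - σ j)   ∎
    where open ≈R
  κ-product (suc (suc i)) j = begin
    fromℕ 2 * (- κ i * κ j)          ≈⟨ solve 2 (λ a b → :2 :* (:- a :* b) := :- (:2 :* (a :* b))) refl (κ i)
      (κ j) ⟩
    - (fromℕ 2 * (κ i * κ j))        ≈⟨ -‿cong (κ-product i j) ⟩
    - (κ (i ℕ.+ j) * (1# + σ j))     ≈⟨ solve 2 (λ a b → :- (a :* b) := :- a :* b) refl (κ (i ℕ.+ j))
      (1# + σ j) ⟩
    - κ (i ℕ.+ j) * (1# + σ j)       ∎
    where open ≈R

  κ-even : ∀ k → κ (2 ℕ.* k) ≈ (- 1#) ^ k
  κ-even zero    = refl
  κ-even (suc k) = trans (reflexive (≡.cong κ (ℕ.*-suc 2 k))) (trans (-‿cong (κ-even k)) 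
    (solve 1 (λ a → :- a := :- :1 :* a) refl ((- 1#) ^ k)))

  κ-odd : ∀ k → κ (suc (2 ℕ.* k)) ≈ 0#
  κ-odd zero    = refl
  κ-odd (suc k) = trans (reflexive (≡.cong (κ ∘ suc) (ℕ.*-suc 2 k))) (trans (-‿cong (κ-odd k))
    (solve 0 (:- :0 := :0) refl))

  ∣κ∣≤1 : ∀ n → ∣ κ n ∣ ≤ 1#
  ∣κ∣≤1 0             = ≤-reflexive (0≤x⇒∣x∣≈x 0≤1)
  ∣κ∣≤1 1             = ≤-trans (≤-reflexive (0≤x⇒∣x∣≈x ≤-refl)) 0≤1
  ∣κ∣≤1 (suc (suc n)) = ≤-trans (∣-x∣≤∣x∣ (κ n)) (∣κ∣≤1 n)

  cosTerm : Carrier → Seq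
  cosTerm x i = κ i * expTerm x i

  cosTerm-≼ : ∀ {x X} → ∣ x ∣ ≤ X → cosTerm x ≼ expTerm X
  cosTerm-≼ {x} {X} p i = ≤-trans (∣x*y∣≤ (∣κ∣≤1 i) (expTerm-≼ p i)) (≤-reflexive (*-identityˡ (expTerm X i)))

  partial : ℕ → Carrier → Carrier
  partial n x = sum {n} λ k →
    (- 1#) ^ toℕ k * x ^ (2 ℕ.* toℕ k) / fromℕ ((2 ℕ.* toℕ k) !)

  -- Filling in the vanishing odd terms makes the cosine series a series over all indices, termwise
  -- dominated by the exponential series.
  partial≈Σ< : ∀ n x → partial n x ≈ Σ< (2 ℕ.* n) (cosTerm x)
  partial≈Σ< n x = trans (Σ<-cong n even) (evens n)
    where
    open ≈R
    even : ∀ k → (- 1#) ^ k * x ^ (2 ℕ.* k) / fromℕ ((2 ℕ.* k) !) ≈ cosTerm x (2 ℕ.* k)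
    even k = trans (*-assoc ((- 1#) ^ k) (x ^ (2 ℕ.* k)) _)
      (*-cong (sym (κ-even k)) (x^n/n!≈expTerm x (2 ℕ.* k)))

    evens : ∀ n → Σ< n (λ k → cosTerm x (2 ℕ.* k)) ≈ Σ< (2 ℕ.* n) (cosTerm x)
    evens zero = refl
    evens (suc n) = begin
      Σ< (suc n) (λ k → cosTerm x (2 ℕ.* k))
        ≈⟨ Σ<-snoc n (λ k → cosTerm x (2 ℕ.* k)) ⟩
      Σ< n (λ k → cosTerm x (2 ℕ.* k)) + cosTerm x (2 ℕ.* n)
        ≈⟨ +-congʳ (evens n) ⟩
      Σ< (2 ℕ.* n) (cosTerm x) + cosTerm x (2 ℕ.* n)
        ≈⟨ Σ<-snoc (2 ℕ.* n) (cosTerm x) ⟨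
      Σ< (suc (2 ℕ.* n)) (cosTerm x)
        ≈⟨ +-identityʳ _ ⟨
      Σ< (suc (2 ℕ.* n)) (cosTerm x) + 0#
        ≈⟨ +-congˡ (trans (*-congʳ (κ-odd n)) (zeroˡ _)) ⟨
      Σ< (suc (2 ℕ.* n)) (cosTerm x) + cosTerm x (suc (2 ℕ.* n))
        ≈⟨ Σ<-snoc (suc (2 ℕ.* n)) (cosTerm x) ⟨
      Σ< (2 ℕ.+ 2 ℕ.* n) (cosTerm x)
        ≡⟨ ≡.cong (λ m → Σ< m (cosTerm x)) (ℕ.*-suc 2 n) ⟨
      Σ< (2 ℕ.* suc n) (cosTerm x) ∎

  module _ {X : Carrier} (0≤X : 0# ≤ X) where
    open Tail 0≤X

    partial-cauchy : ∀ {x} → ∣ x ∣ ≤ X → ∀ m n → Past (2 ℕ.* m) → m ℕ.≤ n →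
                     ∣ partial m x - partial n x ∣ ≤ δ m
    partial-cauchy {x} p m n past m≤n = begin
      ∣ partial m x - partial n x ∣
        ≈⟨ ∣∣-cong (+-cong (partial≈Σ< m x) (-‿cong (partial≈Σ< n x))) ⟩
      ∣ Σ< (2 ℕ.* m) (cosTerm x) - Σ< (2 ℕ.* n) (cosTerm x) ∣
        ≤⟨ ∣x-y∣≤∣y-x∣ _ _ ⟩
      ∣ Σ< (2 ℕ.* n) (cosTerm x) - Σ< (2 ℕ.* m) (cosTerm x) ∣
        ≤⟨ Σ<-tail-bound (cosTerm-≼ p) 2m≤2n ⟩
      Σ< (2 ℕ.* n) e - Σ< (2 ℕ.* m) e
        ≤⟨ Σ<-tail past 2m≤2n ⟩
      δ m ∎
      where
      open ≤R
      2m≤2n = ℕ.*-monoʳ-≤ 2 m≤n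

  partial⟶cos : ∀ x → (λ n → partial n x) ⟶ cos x
  partial⟶cos x = the-satisfies _ (cauchy (λ n → partial n x) δ N₀ δ-null
    λ m n N₀≤m → partial-cauchy (0≤∣x∣ x) ≤-refl m n (past-mono (ℕ.≤-trans N₀≤m (ℕ.m≤m+n m _)) past-N₀))
    where open Tail (0≤∣x∣ x)

  cos-cong : ∀ {x y} → x ≈ y → cos x ≈ cos y
  cos-cong {x} {y} x≈y = limit-unique
    (λ n → trans (partial≈Σ< n x) (trans (Σ<-cong (2 ℕ.* n) {cosTerm x} {cosTerm y}
      (λ i → *-congˡ (expTerm-cong x≈y i)))
      (sym (partial≈Σ< n y))))
    (partial⟶cos x) (partial⟶cos y)

  module _ {X : Carrier} (0≤X : 0# ≤ X) where
    open Tail 0≤X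

    -- The error depends on `x` only through the majorant `X`, so one `δ` serves x, y, x + y and x -
    -- y at once in the product formula.
    partial-rate : ∀ {x} → ∣ x ∣ ≤ X → ∀ n → Past (2 ℕ.* n) → ∣ partial n x - cos x ∣ ≤ δ n
    partial-rate {x} p n past = limit-bound n (partial⟶cos x) λ m → partial-cauchy 0≤X p n m past

    Σ<-bounded : ∀ n → Σ< n e ≤ Σ< N₀ e + fromℕ 2 * e N₀
    Σ<-bounded n with ℕ.≤-total n N₀
    ... | inj₁ n≤N₀ = ≤-trans (Σ<-mono e-nonNeg n≤N₀) (≤-from (fromℕ-nonNeg 2 ⊗ e-nonNeg N₀) refl)
    ... | inj₂ N₀≤n = ≤-trans (≤-from (fromℕ-nonNeg 2 ⊗ e-nonNeg n) refl) (tail past-N₀ (ℕ.≤⇒≤′ N₀≤n))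

  expTerm-neg : ∀ y j → expTerm (- y) j ≈ σ j * expTerm y j
  expTerm-neg y zero    = sym (*-identityˡ 1#)
  expTerm-neg y (suc j) = trans (*-congʳ (*-congʳ (expTerm-neg y j)))
    (solve 4 (λ s e y i → s :* e :* :- y :* i := :- s :* (e :* y :* i)) refl (σ j) (expTerm y j) y
      (fromℕ (suc j) ⁻¹))

  conv-double : ∀ n k {f g u v w} →
    (∀ i j → i ℕ.+ j ≡ n → fromℕ 2 * (f i * g j) ≈ k * (u i * v j + u i * w j)) →
    fromℕ 2 * conv f g n ≈ k * (conv u v n + conv u w n)
  conv-double zero    k p = p 0 0 ≡.refl
  conv-double (suc n) k {f} {g} {u} {v} {w} p = begin
    fromℕ 2 * (f 0 * g (suc n) + conv (f ∘ suc) g n)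
      ≈⟨ distribˡ _ _ _ ⟩
    fromℕ 2 * (f 0 * g (suc n)) + fromℕ 2 * conv (f ∘ suc) g n
      ≈⟨ +-cong (p 0 (suc n) ≡.refl) (conv-double n k λ i j i+j≡n → p (suc i) j (≡.cong suc i+j≡n)) ⟩
    k * (u 0 * v (suc n) + u 0 * w (suc n)) + k * (conv (u ∘ suc) v n + conv (u ∘ suc) w n)
      ≈⟨ solve 5 (λ k a b c d → k :* (a :+ b) :+ k :* (c :+ d) := k :* (a :+ c :+ (b :+ d))) refl
           k (u 0 * v (suc n)) (u 0 * w (suc n)) (conv (u ∘ suc) v n) (conv (u ∘ suc) w n) ⟩
    k * (conv u v (suc n) + conv u w (suc n)) ∎
    where open ≈R

  cosTerm-conv : ∀ x y n → fromℕ 2 * conv (cosTerm x) (cosTerm y) n ≈ cosTerm (x + y) n + cosTerm (x - y) n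
  cosTerm-conv x y n = begin
    fromℕ 2 * conv (cosTerm x) (cosTerm y) n
      ≈⟨ conv-double n (κ n) product ⟩
    κ n * (conv (expTerm x) (expTerm y) n + conv (expTerm x) (expTerm (- y)) n)
      ≈⟨ *-congˡ (+-cong (expTerm-+ n x y) (expTerm-+ n x (- y))) ⟩
    κ n * (expTerm (x + y) n + expTerm (x - y) n)
      ≈⟨ distribˡ _ _ _ ⟩
    cosTerm (x + y) n + cosTerm (x - y) n ∎
    where
    open ≈R
    product : ∀ i j → i ℕ.+ j ≡ n → fromℕ 2 * (cosTerm x i * cosTerm y j) ≈
              κ n * (expTerm x i * expTerm y j + expTerm x i * expTerm (- y) j)
    product i j ≡.refl = begin
      fromℕ 2 * (cosTerm x i * cosTerm y j)
        ≈⟨ solve 4 (λ a b c d → :2 :* (a :* b :* (c :* d)) := :2 :* (a :* c) :* (b :* d)) refl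
             (κ i) (expTerm x i) (κ j) (expTerm y j) ⟩
      fromℕ 2 * (κ i * κ j) * (expTerm x i * expTerm y j)
        ≈⟨ *-congʳ (κ-product i j) ⟩
      κ (i ℕ.+ j) * (1# + σ j) * (expTerm x i * expTerm y j)
        ≈⟨ solve 4 (λ k s a b → k :* (:1 :+ s) :* (a :* b) := k :* (a :* b :+ a :* (s :* b))) refl
             (κ (i ℕ.+ j)) (σ j) (expTerm x i) (expTerm y j) ⟩
      κ (i ℕ.+ j) * (expTerm x i * expTerm y j + expTerm x i * (σ j * expTerm y j))
        ≈⟨ *-congˡ (+-congˡ (*-congˡ (expTerm-neg y j))) ⟨
      κ (i ℕ.+ j) * (expTerm x i * expTerm y j + expTerm x i * expTerm (- y) j) ∎

  Σ<-scale : ∀ n k f → Σ< n (λ i → k * f i) ≈ k * Σ< n f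
  Σ<-scale zero    k f = sym (zeroʳ k)
  Σ<-scale (suc n) k f = trans (+-congˡ (Σ<-scale n k (f ∘ suc))) (sym (distribˡ _ _ _))

  Σ<-+ : ∀ n f g → Σ< n (λ i → f i + g i) ≈ Σ< n f + Σ< n g
  Σ<-+ zero    f g = sym (+-identityʳ 0#)
  Σ<-+ (suc n) f g = trans (+-congˡ (Σ<-+ n (f ∘ suc) (g ∘ suc)))
    (solve 4 (λ a b c d → a :+ b :+ (c :+ d) := a :+ c :+ (b :+ d)) refl (f 0) (g 0) (Σ< n (f ∘ suc))
      (Σ< n (g ∘ suc)))

  module Addition (x y : Carrier) where
    X : Carrier
    X = ∣ x ∣ + ∣ y ∣

    open Tail (0≤∣x∣ x ⊕ 0≤∣x∣ y)

    -- The truncation error of the product is at most that of the majorants exp ∣ x ∣ and exp ∣ y ∣,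
    -- which is bounded by a tail of the series of exp (∣ x ∣ + ∣ y ∣).
    partial-product : ∀ n → Past (2 ℕ.* n) →
      ∣ fromℕ 2 * (partial n x * partial n y) - (partial n (x + y) + partial n (x - y)) ∣ ≤ fromℕ 2 * δ n
    partial-product n past = begin
      ∣ fromℕ 2 * (partial n x * partial n y) - (partial n (x + y) + partial n (x - y)) ∣
        ≈⟨ ∣∣-cong (+-cong (*-congˡ (*-cong (partial≈Σ< n x) (partial≈Σ< n y))) (-‿cong sum≈)) ⟩
      ∣ fromℕ 2 * (Σ< N f * Σ< N g) - fromℕ 2 * tri f g N ∣
        ≈⟨ ∣∣-cong (solve 3 (λ t a b → t :* a :- t :* b := t :* (a :- b)) refl (fromℕ 2) (Σ< N f * Σ< N g)
          (tri f g N)) ⟩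
      ∣ fromℕ 2 * (Σ< N f * Σ< N g - tri f g N) ∣
        ≤⟨ ∣x*y∣≤ (≤-reflexive (0≤x⇒∣x∣≈x (fromℕ-nonNeg 2)))
             (product-bound N N ℕ.≤-refl (cosTerm-≼ ≤-refl) (cosTerm-≼ ≤-refl)) ⟩
      fromℕ 2 * (Σ< N F * Σ< N G - tri F G N)
        ≤⟨ *-monoˡ (fromℕ-nonNeg 2) (+-monoˡ-≤ _ (product≤tri N N F-nonNeg G-nonNeg)) ⟩
      fromℕ 2 * (tri F G (N ℕ.+ N) - tri F G N)
        ≈⟨ *-congˡ (+-cong (tri≈Σ<e (N ℕ.+ N)) (-‿cong (tri≈Σ<e N))) ⟩
      fromℕ 2 * (Σ< (N ℕ.+ N) e - Σ< N e)
        ≤⟨ *-monoˡ (fromℕ-nonNeg 2) (Σ<-tail past (ℕ.m≤m+n N N)) ⟩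
      fromℕ 2 * δ n ∎
      where
      open ≤R
      N = 2 ℕ.* n
      f = cosTerm x
      g = cosTerm y
      F = expTerm ∣ x ∣
      G = expTerm ∣ y ∣
      F-nonNeg = ≼⇒nonNeg (cosTerm-≼ {x} ≤-refl)
      G-nonNeg = ≼⇒nonNeg (cosTerm-≼ {y} ≤-refl)

      tri≈Σ<e : ∀ m → tri F G m ≈ Σ< m e
      tri≈Σ<e m = trans (sym (Σ<-conv m F G)) (Σ<-cong m λ i → expTerm-+ i ∣ x ∣ ∣ y ∣)

      sum≈ : partial n (x + y) + partial n (x - y) ≈ fromℕ 2 * tri f g N
      sum≈ = trans (+-cong (partial≈Σ< n (x + y)) (partial≈Σ< n (x - y)))
        (trans (sym (Σ<-+ N (cosTerm (x + y)) (cosTerm (x - y))))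
        (trans (sym (Σ<-cong N (cosTerm-conv x y)))
        (trans (Σ<-scale N (fromℕ 2) (conv f g)) (*-congˡ (Σ<-conv N f g)))))

    -- A bound, by `Σ<-bounded`, for all partial sums of the majorizing series, and thereby for the
    -- partial sums of cos x.
    E : Carrier
    E = Σ< N₀ e + fromℕ 2 * e N₀

    K : Carrier
    K = fromℕ 2 * ∣ cos y ∣ + fromℕ 2 * E + fromℕ 2 + 1# + 1#

    2cos*cos : cos (x + y) + cos (x - y) ≈ fromℕ 2 * (cos x * cos y)
    2cos*cos = sym (≈-by-δ K 0≤K bound)
      where
      0≤X = 0≤∣x∣ x ⊕ 0≤∣x∣ y
      0≤K : 0# ≤ K
      0≤K = fromℕ-nonNeg 2 ⊗ 0≤∣x∣ (cos y)
        ⊕ fromℕ-nonNeg 2 ⊗ (Σ<-nonNeg N₀ e-nonNeg ⊕ fromℕ-nonNeg 2 ⊗ e-nonNeg N₀) ⊕ fromℕ-nonNeg 2 ⊕ 0≤1 ⊕ 0≤1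

      ∣x∣≤X : ∣ x ∣ ≤ X
      ∣x∣≤X = ≤-from (0≤∣x∣ y) refl
      ∣y∣≤X : ∣ y ∣ ≤ X
      ∣y∣≤X = ≤-from (0≤∣x∣ x) (+-comm _ _)

      bound : ∀ n → Past (2 ℕ.* n) → ∣ fromℕ 2 * (cos x * cos y) - (cos (x + y) + cos (x - y)) ∣ ≤ K * δ n
      -- Each of the four cosines is exchanged for its partial sum. The five summands of `K` belong
      -- to the five resulting errors, the third being the truncation error of the product.
      bound n past = begin
        ∣ fromℕ 2 * (cos x * cos y) - (cos (x + y) + cos (x - y)) ∣
          ≈⟨ ∣∣-cong (solve 8 (λ A a B b P p Q q →
               :2 :* (A :* B) :- (P :+ Q) :=
               :2 :* ((A :- a) :* B) :+ :2 :* (a :* (B :- b)) :+ (:2 :* (a :* b) :- (p :+ q)) :+ (p :- P) :+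
                 (q :- Q)) refl
               (cos x) a (cos y) b (cos (x + y)) p (cos (x - y)) q) ⟩
        ∣ fromℕ 2 * ((cos x - a) * cos y) + fromℕ 2 * (a * (cos y - b))
          + (fromℕ 2 * (a * b) - (p + q)) + (p - cos (x + y)) + (q - cos (x - y)) ∣
          ≤⟨ ∣x+y∣≤ (∣x+y∣≤ (∣x+y∣≤ (∣x+y∣≤
               (∣x*y∣≤ 2≤2 (∣x*y∣≤ (flip≤ (partial-rate 0≤X ∣x∣≤X n past)) ≤-refl))
               (∣x*y∣≤ 2≤2 (∣x*y∣≤ ∣a∣≤E (flip≤ (partial-rate 0≤X ∣y∣≤X n past)))))
               (partial-product n past))
               (partial-rate 0≤X (∣x+y∣≤ ≤-refl ≤-refl) n past))
               (partial-rate 0≤X (∣x-y∣≤ ≤-refl ≤-refl) n past) ⟩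
        fromℕ 2 * (δ n * ∣ cos y ∣) + fromℕ 2 * (E * δ n) + fromℕ 2 * δ n + δ n + δ n
          ≈⟨ solve 3 (λ d c E → :2 :* (d :* c) :+ :2 :* (E :* d) :+ :2 :* d :+ d :+ d
               := (:2 :* c :+ :2 :* E :+ :2 :+ :1 :+ :1) :* d) refl (δ n) ∣ cos y ∣ E ⟩
        K * δ n ∎
        where
        open ≤R
        a = partial n x
        b = partial n y
        p = partial n (x + y)
        q = partial n (x - y)
        2≤2 = ≤-reflexive (0≤x⇒∣x∣≈x (fromℕ-nonNeg 2))
        flip≤ : ∀ {u v w} → ∣ u - v ∣ ≤ w → ∣ v - u ∣ ≤ w
        flip≤ = ≤-trans (∣x-y∣≤∣y-x∣ _ _)
        ∣a∣≤E : ∣ a ∣ ≤ E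
        ∣a∣≤E = ≤-trans (≤-reflexive (∣∣-cong (partial≈Σ< n x)))
          (≤-trans (Σ<-bound (2 ℕ.* n) (cosTerm-≼ ∣x∣≤X)) (Σ<-bounded 0≤X (2 ℕ.* n)))

  open Addition public using (2cos*cos)

  module _ {x : Carrier} (∣x∣≤2 : ∣ x ∣ ≤ fromℕ 2) where
    open Tail (0≤∣x∣ x)

    private
      x⁴ = x * x * (x * x)

      past-4 : Past 4
      past-4 = ≤-trans (*-monoˡ (fromℕ-nonNeg 2) ∣x∣≤2) (≤-reflexive (solve 0 (:2 :* :2 := con (+ 4)) refl))

      24e₄≈x⁴ : fromℕ 24 * e 4 ≈ x⁴
      24e₄≈x⁴ = trans (!*expTerm ∣ x ∣ 4) (trans
        (solve 1 (λ a → a :* (a :* (a :* (a :* :1))) := a :* a :* (a :* a)) refl ∣ x ∣)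
        (*-cong (∣x∣*∣x∣≈x*x x) (∣x∣*∣x∣≈x*x x)))

      2e₂≈x² : fromℕ 2 * expTerm x 2 ≈ x * x
      2e₂≈x² = trans (!*expTerm x 2) (*-congˡ (*-identityʳ x))

      partial₂ : partial 2 x ≈ 1# - expTerm x 2
      partial₂ = trans (partial≈Σ< 2 x)
        (solve 3 (λ a b c → :1 :* :1 :+ (:0 :* a :+ (:- :1 :* b :+ (:- :0 :* c :+ :0))) := :1 :- b) refl
          (expTerm x 1) (expTerm x 2) (expTerm x 3))

      close : ∣ partial 2 x - cos x ∣ ≤ fromℕ 2 * e 4
      close = partial-rate (0≤∣x∣ x) ≤-refl 2 past-4

    -- The first two terms 1 - x²/2 are off by at most 2 x⁴ / 24, since ∣x∣ ≤ 2 puts index 4 in the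
    -- range of the tail estimate. The factor 12 clears denominators, here and in `cos-lower`.
    cos-upper : fromℕ 12 * cos x ≤ fromℕ 12 - fromℕ 6 * (x * x) + x⁴
    cos-upper = ≤-from
      (fromℕ-nonNeg 12 ⊗ x≤y⇒0≤y-x (≤-trans (-x≤∣x∣ _) close)
        ⊕ ≈⇒0≤*[-] (- fromℕ 12) partial₂ ⊕ ≈⇒0≤*[-] (fromℕ 6) 2e₂≈x² ⊕ ≈⇒0≤*[-] (- 1#) 24e₄≈x⁴)
      (solve 5 (λ x D s E e → let x⁴ = x :* x :* (x :* x) in
        con (+ 12) :- con (+ 6) :* (x :* x) :+ x⁴ := con (+ 12) :* D :+
        (con (+ 12) :* (:2 :* e :- (:- (s :- D))) :+ :- con (+ 12) :* (s :- (:1 :- E))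
          :+ con (+ 6) :* (:2 :* E :- x :* x) :+ :- :1 :* (con (+ 24) :* e :- x⁴))) refl
        x (cos x) (partial 2 x) (expTerm x 2) (e 4))

    cos-lower : fromℕ 12 - fromℕ 6 * (x * x) - x⁴ ≤ fromℕ 12 * cos x
    cos-lower = ≤-from
      (fromℕ-nonNeg 12 ⊗ x≤y⇒0≤y-x (≤-trans (x≤∣x∣ _) close)
        ⊕ ≈⇒0≤*[-] (fromℕ 12) partial₂ ⊕ ≈⇒0≤*[-] (- fromℕ 6) 2e₂≈x² ⊕ ≈⇒0≤*[-] (- 1#) 24e₄≈x⁴)
      (solve 5 (λ x D s E e → let x⁴ = x :* x :* (x :* x) in
        con (+ 12) :* D := con (+ 12) :- con (+ 6) :* (x :* x) :- x⁴ :+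
        (con (+ 12) :* (:2 :* e :- (s :- D)) :+ con (+ 12) :* (s :- (:1 :- E))
          :+ :- con (+ 6) :* (:2 :* E :- x :* x) :+ :- :1 :* (con (+ 24) :* e :- x⁴))) refl
        x (cos x) (partial 2 x) (expTerm x 2) (e 4))

-- Trigonometry from the product formula, and the number π

module Trigonometry (em : ExcludedMiddle 0ℓ) (ℝ : CompleteOrderedField) where
  open Reals em ℝ hiding (zero)
  open OrderedField em ℝ
  open Limits em ℝ
  open CosineSeries em ℝ using (cos-cong; 2cos*cos; cos-upper; cos-lower)

  private
    ∣x∣≤1⇒∣x∣≤2 : ∀ {x} → ∣ x ∣ ≤ 1# → ∣ x ∣ ≤ fromℕ 2
    ∣x∣≤1⇒∣x∣≤2 p = ≤-trans p (≤-from (fromℕ-nonNeg 1) refl)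

    ∣0∣≤1 : ∣ 0# ∣ ≤ 1#
    ∣0∣≤1 = ≤-trans (≤-reflexive (0≤x⇒∣x∣≈x ≤-refl)) 0≤1

    ∣1∣≤1 : ∣ 1# ∣ ≤ 1#
    ∣1∣≤1 = ≤-reflexive (0≤x⇒∣x∣≈x 0≤1)

  cos0≈1 : cos 0# ≈ 1#
  cos0≈1 = ≤-antisym
    (*-cancelˡ-≤ (fromℕ-pos 11) (≤-trans (cos-upper (∣x∣≤1⇒∣x∣≤2 ∣0∣≤1))
      (≤-reflexive (solve 0 (con (+ 12) :- con (+ 6) :* (:0 :* :0) :+ :0 :* :0 :* (:0 :* :0) := con
        (+ 12) :* :1) refl))))
    (*-cancelˡ-≤ (fromℕ-pos 11) (≤-trans
      (≤-reflexive (solve 0 (con (+ 12) :* :1 := con (+ 12) :- con (+ 6) :* (:0 :* :0) :- :0 :* :0 :*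
        (:0 :* :0)) refl))
      (cos-lower (∣x∣≤1⇒∣x∣≤2 ∣0∣≤1))))

  1-cosx≤x² : ∀ {x} → ∣ x ∣ ≤ 1# → 1# - cos x ≤ x * x
  1-cosx≤x² {x} ∣x∣≤1 = *-cancelˡ-≤ (fromℕ-pos 11) (≤-from
    (x≤y⇒0≤y-x (cos-lower (∣x∣≤1⇒∣x∣≤2 ∣x∣≤1)) ⊕ 0≤x² x ⊗ 0≤1-x² ⊕ fromℕ-nonNeg 5 ⊗ 0≤x² x)
    (solve 2 (λ x c → con (+ 12) :* (x :* x) := con (+ 12) :* (:1 :- c) :+
      (con (+ 12) :* c :- (con (+ 12) :- con (+ 6) :* (x :* x) :- x :* x :* (x :* x))
        :+ x :* x :* (:1 :* :1 :- x :* x) :+ con (+ 5) :* (x :* x))) refl x (cos x)))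
    where
    0≤1-x² : 0# ≤ 1# * 1# - x * x
    0≤1-x² = x≤y⇒0≤y-x (≤-respˡ (∣x∣*∣x∣≈x*x x) (*-mono (0≤∣x∣ x) (0≤∣x∣ x) ∣x∣≤1 ∣x∣≤1))

  -- At 1 the two estimates read 5 ≤ 12 cos 1 ≤ 7, and the certificate is (7 - 12 c)(7 + 12 c). It
  -- serves twice: cos² 1 < 1 leads to ∣cos∣ ≤ 1, and 2 cos² 1 < 1 makes cos 2 negative.
  cos²1≤49/144 : fromℕ 144 * (cos 1# * cos 1#) ≤ fromℕ 49
  cos²1≤49/144 = ≤-from
    (x≤y⇒0≤y-x (cos-upper (∣x∣≤1⇒∣x∣≤2 ∣1∣≤1))
      ⊗ (x≤y⇒0≤y-x (cos-lower (∣x∣≤1⇒∣x∣≤2 ∣1∣≤1)) ⊕ fromℕ-nonNeg 12))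
    (solve 1 (λ c → con (+ 49) := con (+ 144) :* (c :* c) :+
      ((con (+ 12) :- con (+ 6) :* (:1 :* :1) :+ :1 :* :1 :* (:1 :* :1) :- con (+ 12) :* c)
        :* (con (+ 12) :* c :- (con (+ 12) :- con (+ 6) :* (:1 :* :1) :- :1 :* :1 :* (:1 :* :1)) :+ con
          (+ 12)))) refl (cos 1#))

  cos-neg : ∀ x → cos (- x) ≈ cos x
  cos-neg x = begin
    cos (- x)                          ≈⟨ cos-cong (solve 1 (λ x → :- x := :0 :- x) refl x) ⟩
    cos (0# - x)                       ≈⟨ solve 2 (λ a b → a := b :+ a :- b) refl (cos (0# - x))
      (cos (0# + x)) ⟩
    cos (0# + x) + cos (0# - x) - cos (0# + x)
      ≈⟨ +-cong (2cos*cos 0# x) (-‿cong (cos-cong (+-identityˡ x))) ⟩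
    fromℕ 2 * (cos 0# * cos x) - cos x ≈⟨ +-congʳ (*-congˡ (*-congʳ cos0≈1)) ⟩
    fromℕ 2 * (1# * cos x) - cos x     ≈⟨ solve 1 (λ c → :2 :* (:1 :* c) :- c := c) refl (cos x) ⟩
    cos x                              ∎
    where open ≈R

  cos-double : ∀ x → cos (x + x) ≈ fromℕ 2 * (cos x * cos x) - 1#
  cos-double x = begin
    cos (x + x)
      ≈⟨ solve 2 (λ a b → a := a :+ b :- b) refl (cos (x + x)) (cos (x - x)) ⟩
    cos (x + x) + cos (x - x) - cos (x - x)
      ≈⟨ +-cong (2cos*cos x x) (-‿cong (trans (cos-cong (-‿inverseʳ x)) cos0≈1)) ⟩
    fromℕ 2 * (cos x * cos x) - 1# ∎
    where open ≈R

  -- The two cosines are the roots of t² - 2 (cos u)(cos h) t + (cos² u + cos² h - 1).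
  cos-difference² : ∀ u h → let D = cos (u + h) - cos (u - h) in
    D * D ≈ fromℕ 4 * ((1# - cos u * cos u) * (1# - cos h * cos h))
  cos-difference² u h = begin
    (a - b) * (a - b)
      ≈⟨ solve 2 (λ a b → (a :- b) :* (a :- b) := (a :+ b) :* (a :+ b) :- :2 :* (:2 :* (a :* b))) refl a b ⟩
    (a + b) * (a + b) - fromℕ 2 * (fromℕ 2 * (a * b))
      ≈⟨ +-cong (*-cong (2cos*cos u h) (2cos*cos u h)) (-‿cong (*-congˡ (trans (sym (2cos*cos (u + h) (u - h)))
           (+-cong (trans (cos-cong (solve 2 (λ u h → u :+ h :+ (u :- h) := u :+ u) refl u h)) (cos-double u))
                   (trans (cos-cong (solve 2 (λ u h → u :+ h :- (u :- h) := h :+ h) refl u h))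
                     (cos-double h)))))) ⟩
    fromℕ 2 * (cos u * cos h) * (fromℕ 2 * (cos u * cos h))
      - fromℕ 2 * (fromℕ 2 * (cos u * cos u) - 1# + (fromℕ 2 * (cos h * cos h) - 1#))
      ≈⟨ solve 2 (λ c d → :2 :* (c :* d) :* (:2 :* (c :* d)) :- :2 :*
        (:2 :* (c :* c) :- :1 :+ (:2 :* (d :* d) :- :1))
           := con (+ 4) :* ((:1 :- c :* c) :* (:1 :- d :* d))) refl (cos u) (cos h) ⟩
    fromℕ 4 * ((1# - cos u * cos u) * (1# - cos h * cos h)) ∎
    where
    open ≈R
    a = cos (u + h)
    b = cos (u - h)

  x²≤y²⇒∣x∣≤y : ∀ {x y} → 0# ≤ y → x * x ≤ y * y → ∣ x ∣ ≤ y
  x²≤y²⇒∣x∣≤y {x} {y} 0≤y p = case (<-≤-connex y ∣ x ∣)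
    where
    case : y < ∣ x ∣ ⊎ ∣ x ∣ ≤ y → ∣ x ∣ ≤ y
    case (inj₂ ∣x∣≤y) = ∣x∣≤y
    case (inj₁ y<∣x∣) = ⊥-elim (<⇒≱ (*-pos (x<y⇒0<y-x y<∣x∣) (≤-<-trans 0≤y y<∣x∣)) (≤-from
      (x≤y⇒0≤y-x p ⊕ ≈⇒0≤*[-] (- 1#) (∣x∣*∣x∣≈x*x x) ⊕ 0≤y ⊗ <⇒≤ (x<y⇒0<y-x y<∣x∣))
      (solve 3 (λ a x y → :0 := (a :- y) :* a :+ (y :* y :- x :* x :+ :- :1 :* (a :* a :- x :* x) :+ y :*
        (a :- y))) refl ∣ x ∣ x y)))

  -- A square is nonnegative, so `cos-difference²` with h = 1 gives (1 - cos² u)(1 - cos² 1) ≥ 0,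
  -- whose second factor is positive.
  cos²≤1 : ∀ u → 0# ≤ 1# - cos u * cos u
  cos²≤1 u = *-cancel-nonNeg 0<1-cos²1 (*-cancel-nonNeg (fromℕ-pos 3)
    (≤-respʳ (trans (cos-difference² u 1#) (*-congˡ (*-comm _ _))) (0≤x² _)))
    where
    0<1-cos²1 : 0# < 1# - cos 1# * cos 1#
    0<1-cos²1 = ≰⇒> λ p → <⇒≱ (fromℕ-pos 94) (≤-from
      (x≤y⇒0≤y-x cos²1≤49/144 ⊕ fromℕ-nonNeg 144 ⊗ x≤y⇒0≤y-x p)
      (solve 1 (λ c → :0 := con (+ 95) :+ (con (+ 49) :- con (+ 144) :* c :+ con (+ 144) :* (:0 :- (:1 :- c))))
        refl (cos 1# * cos 1#)))

  ∣cos∣≤1 : ∀ u → ∣ cos u ∣ ≤ 1#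
  ∣cos∣≤1 u = x²≤y²⇒∣x∣≤y 0≤1 (≤-respʳ (sym (*-identityˡ 1#)) (0≤y-x⇒x≤y (cos²≤1 u)))

  1-cos²x≤2x² : ∀ {x} → ∣ x ∣ ≤ 1# → 1# - cos x * cos x ≤ fromℕ 2 * (x * x)
  1-cos²x≤2x² {x} ∣x∣≤1 = ≤-from
    (fromℕ-nonNeg 2 ⊗ x≤y⇒0≤y-x (1-cosx≤x² ∣x∣≤1) ⊕ 0≤x² (1# - cos x))
    (solve 2 (λ x c → :2 :* (x :* x) := :1 :- c :* c :+
      (:2 :* (x :* x :- (:1 :- c)) :+ (:1 :- c) :* (:1 :- c))) refl x (cos x))

  -- With `u` the midpoint and `h` half the difference, `cos-difference²` bounds the squared
  -- difference by 4 (1 - cos² h), hence by 8 h². This is all the continuity used below.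
  cos-lipschitz : ∀ a b → ∣ a - b ∣ ≤ fromℕ 2 → ∣ cos a - cos b ∣ ≤ fromℕ 2 * ∣ a - b ∣
  cos-lipschitz a b ∣a-b∣≤2 = ≤-trans
    (≤-reflexive (∣∣-cong (+-cong (cos-cong a≈) (-‿cong (cos-cong b≈)))))
    (x²≤y²⇒∣x∣≤y (fromℕ-nonNeg 2 ⊗ 0≤∣x∣ _) (begin
      _ ≈⟨ cos-difference² u h ⟩
      fromℕ 4 * ((1# - cos u * cos u) * (1# - cos h * cos h))
        ≤⟨ *-monoˡ (fromℕ-nonNeg 4) (≤-from
             ((0≤x² (cos u)) ⊗ cos²≤1 h ⊕ x≤y⇒0≤y-x (1-cos²x≤2x² ∣h∣≤1))
             (solve 3 (λ c d h → :2 :* (h :* h) := (:1 :- c) :* (:1 :- d) :+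
               (c :* (:1 :- d) :+ (:2 :* (h :* h) :- (:1 :- d)))) refl
               (cos u * cos u) (cos h * cos h) h)) ⟩
      fromℕ 4 * (fromℕ 2 * (h * h))
        ≤⟨ ≤-from (fromℕ-nonNeg 8 ⊗ 0≤x² h)
             (solve 1 (λ h → (:2 :* :2) :* ((:2 :* h) :* (:2 :* h)) := con (+ 4) :* (:2 :* (h :* h)) :+ con
               (+ 8) :* (h :* h)) refl h) ⟩
      fromℕ 2 * fromℕ 2 * ((fromℕ 2 * h) * (fromℕ 2 * h))
        ≈⟨ *-congˡ (trans (*-cong 2h≈ 2h≈) (sym (∣x∣*∣x∣≈x*x (a - b)))) ⟩
      fromℕ 2 * fromℕ 2 * (∣ a - b ∣ * ∣ a - b ∣)
        ≈⟨ solve 1 (λ d → :2 :* :2 :* (d :* d) := :2 :* d :* (:2 :* d)) refl ∣ a - b ∣ ⟩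
      fromℕ 2 * ∣ a - b ∣ * (fromℕ 2 * ∣ a - b ∣) ∎))
    where
    open ≤R
    u = (b + a) / fromℕ 2
    h = (a - b) / fromℕ 2
    2h≈ : fromℕ 2 * h ≈ a - b
    2h≈ = trans (*-comm _ _) (x/y*y≈x (a - b) (fromℕ-pos 1))
    a≈ : a ≈ u + h
    a≈ = sym (midpoint-+ b a)
    b≈ : b ≈ u - h
    b≈ = sym (midpoint-- b a)
    ∣h∣≤1 : ∣ h ∣ ≤ 1#
    ∣h∣≤1 = ∣∣-lub
      (*-cancelˡ-≤ (fromℕ-pos 1) (≤-respˡ (sym 2h≈) (≤-respʳ (sym (*-identityʳ _))
        (≤-trans (x≤∣x∣ _) ∣a-b∣≤2))))
      (*-cancelˡ-≤ (fromℕ-pos 1) (≤-respˡ (trans (-‿cong (sym 2h≈))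
        (solve 1 (λ h → :- (:2 :* h) := :2 :* :- h) refl h))
        (≤-respʳ (sym (*-identityʳ _)) (≤-trans (-x≤∣x∣ _) ∣a-b∣≤2))))

  Between : Carrier → Carrier → Pred Carrier 0ℓ
  Between a b x = a ≤ x ∧ x ≤ b

  FirstHit : (a b v c : Carrier) → Set
  FirstHit a b v c = Between a b c ∧ cos c ≈ v ∧ (∀ t → a ≤ t → t < c → v < cos t)

  -- The point is the supremum of those x for which cosine exceeds `v` on all of [a, x]; continuity
  -- rules out both strict inequalities there. An arbitrary crossing would not do, because `π` is
  -- defined from the least positive zero.
  cos-first-hit : ∀ {a b v} → a ≤ b → v < cos a → cos b ≤ v → ∃ (FirstHit a b v)
  cos-first-hit {a} {b} {v} a≤b v<fa fb≤v = c , (a≤c , c≤b) , ≤-antisym fc≤v v≤fc , above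
    where
    Above : Pred Carrier 0ℓ
    Above x = Between a b x ∧ (∀ t → Between a x t → v < cos t)

    above-a : Above a
    above-a = (≤-refl , a≤b) , λ t (a≤t , t≤a) → <-respʳ (cos-cong (≤-antisym a≤t t≤a)) v<fa

    supremum = complete Above (a , above-a) (b , λ x ((_ , x≤b) , _) → x≤b)
    c = proj₁ supremum
    upper = proj₁ (proj₂ supremum)
    least-upper = proj₂ (proj₂ supremum)

    a≤c : a ≤ c
    a≤c = upper a above-a
    c≤b : c ≤ b
    c≤b = least-upper b λ x ((_ , x≤b) , _) → x≤b

    above : ∀ t → a ≤ t → t < c → v < cos t
    above t a≤t t<c = ≰⇒> λ ft≤v → <⇒≱ t<c (least-upper t λ x (_ , p) → case x p (≤-total x t) ft≤v)
      where
      case : ∀ x → (∀ t → Between a x t → v < cos t) → x ≤ t ⊎ t ≤ x → cos t ≤ v → x ≤ t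
      case x p (inj₁ x≤t) ft≤v = x≤t
      case x p (inj₂ t≤x) ft≤v = ⊥-elim (<⇒≱ (p t (a≤t , t≤x)) ft≤v)

    radius : ∀ {η} → 0# < η → ∃[ r ] 0# < r ∧ (∀ t → ∣ t - c ∣ ≤ r → ∣ cos t - cos c ∣ < η)
    -- The radius is the smaller of 1 and η/4: the former keeps the Lipschitz estimate applicable,
    -- and its constant 2 turns the latter into η/2 < η.
    radius {η} 0<η = case (≤-total 1# (η / fromℕ 4))
      where
      open ≤R
      near : ∀ r → r ≤ 1# → r ≤ η / fromℕ 4 → ∀ t → ∣ t - c ∣ ≤ r → ∣ cos t - cos c ∣ < η
      near r r≤1 r≤η/4 t p = begin-strict
        ∣ cos t - cos c ∣       ≤⟨ cos-lipschitz t c (≤-trans p (≤-trans r≤1 (≤-from (fromℕ-nonNeg 1) refl))) ⟩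
        fromℕ 2 * ∣ t - c ∣     ≤⟨ *-monoˡ (fromℕ-nonNeg 2) (≤-trans p r≤η/4) ⟩
        fromℕ 2 * q             <⟨ 0<y-x⇒x<y (<-respʳ
          (solve 1 (λ q → :2 :* q := q :* con (+ 4) :- :2 :* q) refl q)
                                     (*-pos (fromℕ-pos 1) (/-pos 0<η (fromℕ-pos 3)))) ⟩
        q * fromℕ 4             ≈⟨ x/y*y≈x η (fromℕ-pos 3) ⟩
        η                       ∎
        where q = η / fromℕ 4
      case : 1# ≤ η / fromℕ 4 ⊎ η / fromℕ 4 ≤ 1# → _
      case (inj₁ p) = 1# , 0<1 , near 1# ≤-refl p
      case (inj₂ p) = η / fromℕ 4 , /-pos 0<η (fromℕ-pos 3) , near _ p ≤-refl

    fc≤v : cos c ≤ v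
    fc≤v = case (<-≤-connex v (cos c))
      where
      case : v < cos c ⊎ cos c ≤ v → cos c ≤ v
      case (inj₂ fc≤v) = fc≤v
      case (inj₁ v<fc) = ⊥-elim (case′ (≤-total b (c + r)))
        where
        r,near = radius (x<y⇒0<y-x v<fc)
        r = proj₁ r,near
        0<r = proj₁ (proj₂ r,near)
        near = proj₂ (proj₂ r,near)

        above-near : ∀ t → a ≤ t → t ≤ c + r → v < cos t
        above-near t a≤t t≤c+r = case″ (<-≤-connex t c)
          where
          case″ : t < c ⊎ c ≤ t → v < cos t
          case″ (inj₁ t<c) = above t a≤t t<c
          case″ (inj₂ c≤t) = 0<y-x⇒x<y (<-≤-trans
            (x<y⇒0<y-x (≤-<-trans (-x≤∣x∣ _) (near t (≤-trans (≤-reflexive (0≤x⇒∣x∣≈x (x≤y⇒0≤y-x c≤t)))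
              (≤-from (x≤y⇒0≤y-x t≤c+r) (solve 3 (λ c r t → r := t :- c :+ (c :+ r :- t)) refl c r t))))))
            (≤-reflexive (solve 3 (λ v x y → (y :- v) :- (:- (x :- y)) := x :- v) refl v (cos t) (cos c))))

        c<c+r : c < c + r
        c<c+r = 0<y-x⇒x<y (<-respʳ (solve 2 (λ c r → r := c :+ r :- c) refl c r) 0<r)

        case′ : b ≤ c + r ⊎ c + r ≤ b → ⊥
        case′ (inj₁ b≤c+r) = <⇒≱ (above-near b a≤b b≤c+r) fb≤v
        case′ (inj₂ c+r≤b) = <⇒≱ c<c+r (upper (c + r)
          ((≤-trans a≤c (<⇒≤ c<c+r) , c+r≤b) , λ t (a≤t , t≤c+r) → above-near t a≤t t≤c+r))

    v≤fc : v ≤ cos c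
    v≤fc = case (<-≤-connex (cos c) v)
      where
      case : cos c < v ⊎ v ≤ cos c → v ≤ cos c
      case (inj₂ v≤fc) = v≤fc
      case (inj₁ fc<v) = ⊥-elim (case′ (≤-total a (c - r)))
        where
        r,near = radius (x<y⇒0<y-x fc<v)
        r = proj₁ r,near
        0<r = proj₁ (proj₂ r,near)
        near = proj₂ (proj₂ r,near)

        a<c : a < c
        a<c = ≰⇒> λ c≤a → <⇒≱ fc<v (<⇒≤ (<-respʳ (cos-cong (≤-antisym a≤c c≤a)) v<fa))

        absurd : ∀ t → a ≤ t → t < c → c - r ≤ t → ⊥
        absurd t a≤t t<c c-r≤t = <⇒≱ (above t a≤t t<c) (≤-from
          (x≤y⇒0≤y-x (≤-trans (x≤∣x∣ _) (<⇒≤ (near t (≤-trans (∣x-y∣≤∣y-x∣ t c)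
            (≤-trans (≤-reflexive (0≤x⇒∣x∣≈x (x≤y⇒0≤y-x (<⇒≤ t<c))))
              (≤-from (x≤y⇒0≤y-x c-r≤t) (solve 3 (λ c r t → r := c :- t :+ (t :- (c :- r))) refl c r t))))))))
          (solve 3 (λ v x y → v := x :+ ((v :- y) :- (x :- y))) refl v (cos t) (cos c)))

        case′ : a ≤ c - r ⊎ c - r ≤ a → ⊥
        case′ (inj₁ a≤c-r) = absurd (c - r) a≤c-r
          (0<y-x⇒x<y (<-respʳ (solve 2 (λ c r → r := c :- (c :- r)) refl c r) 0<r)) ≤-refl
        case′ (inj₂ c-r≤a) = absurd a ≤-refl a<c c-r≤a

  cos-intermediate : ∀ {a b v} → a ≤ b → v ≤ cos a → cos b ≤ v → ∃[ c ] Between a b c ∧ cos c ≈ v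
  cos-intermediate {a} {b} {v} a≤b v≤fa fb≤v = case (<-≤-connex v (cos a))
    where
    case : v < cos a ⊎ cos a ≤ v → _
    case (inj₁ v<fa) = let c , between , eq , _ = cos-first-hit a≤b v<fa fb≤v in c , between , eq
    case (inj₂ fa≤v) = a , (≤-refl , a≤b) , ≤-antisym fa≤v v≤fa

  -- The same term as in the definition of `π`, which therefore unfolds to twice this number.
  π/2 : Carrier
  π/2 = the 0# IsLeastPositiveZeroOfCos

  0<cos0 : 0# < cos 0#
  0<cos0 = <-respʳ (sym cos0≈1) 0<1

  cos2≤0 : cos (1# + 1#) ≤ 0#
  cos2≤0 = ≤-respˡ (sym (cos-double 1#)) (*-cancelˡ-≤ (fromℕ-pos 71) (≤-from
    (x≤y⇒0≤y-x cos²1≤49/144 ⊕ fromℕ-nonNeg 23)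
    (solve 1 (λ c → con (+ 72) :* :0 := con (+ 72) :* (:2 :* c :- :1) :+
      (con (+ 49) :- con (+ 144) :* c :+ con (+ 23))) refl (cos 1# * cos 1#))))

  π/2-spec : IsLeastPositiveZeroOfCos π/2
  π/2-spec = the-satisfies IsLeastPositiveZeroOfCos
    (let z , (0≤z , _) , cosz≈0 , pos = cos-first-hit (0≤1 ⊕ 0≤1) 0<cos0 cos2≤0 in
     z , (0≤z , λ 0≈z → 0≉1 (trans (sym cosz≈0) (trans (cos-cong (sym 0≈z)) cos0≈1)))
       , cosz≈0
       , λ y 0<y cosy≈0 → minimal z pos y 0<y cosy≈0 (<-≤-connex y z))
    where
    minimal : ∀ z → (∀ t → 0# ≤ t → t < z → 0# < cos t) →
              ∀ y → 0# < y → cos y ≈ 0# → y < z ⊎ z ≤ y → z ≤ y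
    minimal z pos y 0<y cosy≈0 (inj₂ z≤y) = z≤y
    minimal z pos y 0<y cosy≈0 (inj₁ y<z) = ⊥-elim (>⇒≉ (pos y (<⇒≤ 0<y) y<z) cosy≈0)

  0<π/2 : 0# < π/2
  0<π/2 = proj₁ π/2-spec

  cos[π/2]≈0 : cos π/2 ≈ 0#
  cos[π/2]≈0 = proj₁ (proj₂ π/2-spec)

  cos-pos : ∀ {t} → 0# ≤ t → t < π/2 → 0# < cos t
  cos-pos {t} 0≤t t<π/2 = ≰⇒> λ cost≤0 →
    let z , (0≤z , z≤t) , cosz≈0 , _ = cos-first-hit 0≤t 0<cos0 cost≤0 in
    <⇒≱ t<π/2 (≤-trans (proj₂ (proj₂ π/2-spec) z
      (0≤z , λ 0≈z → >⇒≉ 0<cos0 (trans (cos-cong 0≈z) cosz≈0)) cosz≈0) z≤t)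

  sin : Carrier → Carrier
  sin x = cos (π/2 - x)

  sin-cong : ∀ {x y} → x ≈ y → sin x ≈ sin y
  sin-cong x≈y = cos-cong (+-congˡ (-‿cong x≈y))

  cos[x+π/2] : ∀ x → cos (x + π/2) ≈ - sin x
  cos[x+π/2] x = begin
    cos (x + π/2)                                   ≈⟨ solve 2 (λ a b → a := a :+ b :- b) refl _
      (cos (x - π/2)) ⟩
    cos (x + π/2) + cos (x - π/2) - cos (x - π/2)   ≈⟨ +-cong (2cos*cos x π/2) (-‿cong (trans (sym (cos-neg _))
                                                        (cos-cong (solve 2 (λ x h → :- (x :- h) := h :- x)
                                                          refl x π/2)))) ⟩
    fromℕ 2 * (cos x * cos π/2) - sin x             ≈⟨ +-congʳ (*-congˡ (*-congˡ cos[π/2]≈0)) ⟩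
    fromℕ 2 * (cos x * 0#) - sin x                  ≈⟨ solve 2 (λ c s → :2 :* (c :* :0) :- s := :- s) refl
      (cos x) (sin x) ⟩
    - sin x                                         ∎
    where open ≈R

  2sin*sin : ∀ x y → cos (x - y) - cos (x + y) ≈ fromℕ 2 * (sin x * sin y)
  2sin*sin x y = begin
    cos (x - y) - cos (x + y)
      ≈⟨ +-cong (trans (sym (cos-neg _)) (cos-cong (solve 3 (λ x y h → :- (x :- y) := h :- x :- (h :- y))
        refl x y π/2)))
           (-‿cong (cos-cong (solve 3 (λ x y h → x :+ y := h :- (h :- (x :+ y))) refl x y π/2))) ⟩
    cos (π/2 - x - (π/2 - y)) - sin (π/2 - (x + y))
      ≈⟨ +-congˡ (cos[x+π/2] _) ⟨
    cos (π/2 - x - (π/2 - y)) + cos (π/2 - (x + y) + π/2)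
      ≈⟨ trans (+-comm _ _) (+-congʳ (cos-cong (solve 3 (λ x y h → h :- (x :+ y) :+ h := h :- x :+ (h :- y))
        refl x y π/2))) ⟩
    cos (π/2 - x + (π/2 - y)) + cos (π/2 - x - (π/2 - y))
      ≈⟨ 2cos*cos _ _ ⟩
    fromℕ 2 * (sin x * sin y) ∎
    where open ≈R

  private
    halve : ∀ {u v} → fromℕ 2 * u ≈ fromℕ 2 * v → u ≈ v
    halve p = ≤-antisym (*-cancelˡ-≤ (fromℕ-pos 1) (≤-reflexive p))
      (*-cancelˡ-≤ (fromℕ-pos 1) (≤-reflexive (sym p)))

  cos-+ : ∀ x y → cos (x + y) ≈ cos x * cos y - sin x * sin y
  cos-+ x y = halve (begin
    fromℕ 2 * cos (x + y)
      ≈⟨ solve 2 (λ p m → :2 :* p := (p :+ m) :- (m :- p)) refl (cos (x + y)) (cos (x - y)) ⟩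
    (cos (x + y) + cos (x - y)) - (cos (x - y) - cos (x + y))
      ≈⟨ +-cong (2cos*cos x y) (-‿cong (2sin*sin x y)) ⟩
    fromℕ 2 * (cos x * cos y) - fromℕ 2 * (sin x * sin y)
      ≈⟨ solve 3 (λ t a b → t :* a :- t :* b := t :* (a :- b)) refl (fromℕ 2) _ _ ⟩
    fromℕ 2 * (cos x * cos y - sin x * sin y) ∎)
    where open ≈R

  cos-- : ∀ x y → cos (x - y) ≈ cos x * cos y + sin x * sin y
  cos-- x y = halve (begin
    fromℕ 2 * cos (x - y)
      ≈⟨ solve 2 (λ p m → :2 :* m := (p :+ m) :+ (m :- p)) refl (cos (x + y)) (cos (x - y)) ⟩
    (cos (x + y) + cos (x - y)) + (cos (x - y) - cos (x + y))
      ≈⟨ +-cong (2cos*cos x y) (2sin*sin x y) ⟩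
    fromℕ 2 * (cos x * cos y) + fromℕ 2 * (sin x * sin y)
      ≈⟨ distribˡ _ _ _ ⟨
    fromℕ 2 * (cos x * cos y + sin x * sin y) ∎)
    where open ≈R

  sin[π/2-x] : ∀ x → sin (π/2 - x) ≈ cos x
  sin[π/2-x] x = cos-cong (solve 2 (λ x h → h :- (h :- x) := x) refl x π/2)

  sin-+ : ∀ x y → sin (x + y) ≈ sin x * cos y + cos x * sin y
  sin-+ x y = begin
    sin (x + y)                                ≈⟨ cos-cong
      (solve 3 (λ x y h → h :- (x :+ y) := h :- x :- y) refl x y π/2) ⟩
    cos (π/2 - x - y)                          ≈⟨ cos-- (π/2 - x) y ⟩
    sin x * cos y + sin (π/2 - x) * sin y      ≈⟨ +-congˡ (*-congʳ (sin[π/2-x] x)) ⟩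
    sin x * cos y + cos x * sin y              ∎
    where open ≈R

  cos²+sin²≈1 : ∀ x → cos x * cos x + sin x * sin x ≈ 1#
  cos²+sin²≈1 x = trans (sym (cos-- x x)) (trans (cos-cong (-‿inverseʳ x)) cos0≈1)

  sin-neg : ∀ x → sin (- x) ≈ - sin x
  sin-neg x = trans (cos-cong (solve 2 (λ x h → h :- (:- x) := x :+ h) refl x π/2)) (cos[x+π/2] x)

  sin0≈0 : sin 0# ≈ 0#
  sin0≈0 = trans (cos-cong (solve 1 (λ h → h :- :0 := h) refl π/2)) cos[π/2]≈0

  sin[π/2]≈1 : sin π/2 ≈ 1#
  sin[π/2]≈1 = trans (cos-cong (-‿inverseʳ π/2)) cos0≈1

  sin-pos : ∀ {x} → 0# < x → x < π → 0# < sin x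
  sin-pos {x} 0<x x<π = case (≤-total 0# (π/2 - x))
    where
    case : 0# ≤ π/2 - x ⊎ π/2 - x ≤ 0# → 0# < sin x
    case (inj₁ 0≤π/2-x) = cos-pos 0≤π/2-x (0<y-x⇒x<y (<-respʳ
      (solve 2 (λ x h → x := h :- (h :- x)) refl x π/2) 0<x))
    case (inj₂ π/2-x≤0) = <-respʳ (cos-neg _) (cos-pos
      (≤-respʳ (+-identityˡ _) (x≤y⇒0≤y-x π/2-x≤0))
      (0<y-x⇒x<y (<-respʳ (solve 2 (λ x h → :2 :* h :- x := h :- (:- (h :- x))) refl x π/2) (x<y⇒0<y-x x<π))))

  -- The difference of the cosines is 2 sin u sin h with `u` the midpoint and `h` half the distance,
  -- and both lie strictly between 0 and π.
  cos-strictly-decreasing : ∀ {x y} → 0# ≤ x → x < y → y ≤ π → cos y < cos x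
  cos-strictly-decreasing {x} {y} 0≤x x<y y≤π = 0<y-x⇒x<y (<-respʳ difference
    (*-pos (fromℕ-pos 1) (*-pos (sin-pos 0<u u<π) (sin-pos 0<h h<π))))
    where
    u = (x + y) / fromℕ 2
    h = (y - x) / fromℕ 2
    0<h : 0# < h
    0<h = /-pos (x<y⇒0<y-x x<y) (fromℕ-pos 1)
    u-h≈x : u - h ≈ x
    u-h≈x = midpoint-- x y
    u+h≈y : u + h ≈ y
    u+h≈y = midpoint-+ x y
    0<u : 0# < u
    0<u = <-respʳ (solve 2 (λ u h → h :+ (u :- h) := u) refl u h) (+-pos-nonNeg 0<h (≤-respʳ (sym u-h≈x) 0≤x))
    u<π : u < π
    u<π = <-≤-trans (0<y-x⇒x<y (<-respʳ (solve 2 (λ u h → h := u :+ h :- u) refl u h) 0<h))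
      (≤-respˡ (sym u+h≈y) y≤π)
    h<π : h < π
    h<π = ≤-<-trans (≤-from (≤-respʳ (sym u-h≈x) 0≤x) (solve 2 (λ u h → u := h :+ (u :- h)) refl u h)) u<π
    difference : fromℕ 2 * (sin u * sin h) ≈ cos x - cos y
    difference = trans (sym (2sin*sin u h)) (+-cong (cos-cong u-h≈x) (-‿cong (cos-cong u+h≈y)))

  cos-decreasing : ∀ {x y} → 0# ≤ x → x ≤ y → y ≤ π → cos y ≤ cos x
  cos-decreasing {x} {y} 0≤x x≤y y≤π = case (<-≤-connex x y)
    where
    case : x < y ⊎ y ≤ x → cos y ≤ cos x
    case (inj₁ x<y) = <⇒≤ (cos-strictly-decreasing 0≤x x<y y≤π)
    case (inj₂ y≤x) = ≤-reflexive (cos-cong (≤-antisym y≤x x≤y))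

  -- From sin² x = 1 - cos² x ≤ 2 x². The loss against sin x ≤ x only enlarges the constant `C`.
  sin≤2x : ∀ {x} → 0# ≤ x → x ≤ 1# → sin x ≤ fromℕ 2 * x
  sin≤2x {x} 0≤x x≤1 = ≤-trans (x≤∣x∣ _) (x²≤y²⇒∣x∣≤y (fromℕ-nonNeg 2 ⊗ 0≤x) (≤-from
    (x≤y⇒0≤y-x (1-cos²x≤2x² (≤-respˡ (sym (0≤x⇒∣x∣≈x 0≤x)) x≤1))
      ⊕ ≈⇒0≤*[-] (- 1#) (cos²+sin²≈1 x) ⊕ fromℕ-nonNeg 2 ⊗ 0≤x² x)
    (solve 3 (λ x c s → :2 :* x :* (:2 :* x) := s :* s :+
      (:2 :* (x :* x) :- (:1 :- c :* c) :+ :- :1 :* (c :* c :+ s :* s :- :1) :+ :2 :* (x :* x))) refl x (cos x)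
        (sin x))))

  cosπ≈-1 : cos π ≈ - 1#
  cosπ≈-1 = begin
    cos π            ≈⟨ cos-cong (solve 1 (λ h → :2 :* h := h :+ h) refl π/2) ⟩
    cos (π/2 + π/2)  ≈⟨ cos[x+π/2] π/2 ⟩
    - sin π/2        ≈⟨ -‿cong sin[π/2]≈1 ⟩
    - 1#             ∎
    where open ≈R

  0<π : 0# < π
  0<π = *-pos (fromℕ-pos 1) 0<π/2

-- Polynomial functions and sign alternation

module Polynomials (em : ExcludedMiddle 0ℓ) (ℝ : CompleteOrderedField) where
  open Reals em ℝ hiding (zero)
  open OrderedField em ℝ
  open CosineSeries em ℝ using (σ)

  -- Polynomial functions of degree less than n, characterised by divisibility of f - f a by x - a.
  IsPoly : ℕ → (Carrier → Carrier) → Set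
  IsPoly zero    f = ∀ x → f x ≈ 0#
  IsPoly (suc n) f = ∀ a → ∃[ g ] IsPoly n g ∧ (∀ x → f x ≈ f a + (x - a) * g x)

  poly-cong : ∀ n {f g} → (∀ x → f x ≈ g x) → IsPoly n f → IsPoly n g
  poly-cong zero    f≈g p x = trans (sym (f≈g x)) (p x)
  poly-cong (suc n) f≈g p a = let q , q-poly , eq = p a in
    q , q-poly , λ x → trans (sym (f≈g x)) (trans (eq x) (+-congʳ (f≈g a)))

  poly-resp : ∀ n {f} → IsPoly n f → ∀ {x y} → x ≈ y → f x ≈ f y
  poly-resp zero    p {x} {y} x≈y = trans (p x) (sym (p y))
  poly-resp (suc n) p {x} {y} x≈y = let g , _ , eq = p y in
    trans (eq x) (≈-from {k = g x} x≈y (solve 4 (λ f x y g → f :+ (x :- y) :* g := f :+ g :* (x :- y))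
      refl _ x y (g x)))

  poly-zero : ∀ n → IsPoly n (λ _ → 0#)
  poly-zero zero    _ = refl
  poly-zero (suc n) a = (λ _ → 0#) , poly-zero n , λ x → solve 2 (λ x a → :0 := :0 :+ (x :- a) :* :0) refl x a

  poly-const : ∀ n k → IsPoly (suc n) (λ _ → k)
  poly-const n k a = (λ _ → 0#) , poly-zero n , λ x → solve 3 (λ k x a → k := k :+ (x :- a) :* :0) refl k x a

  poly-weaken : ∀ n {f} → IsPoly n f → IsPoly (suc n) f
  poly-weaken zero    p = poly-cong 1 (λ x → sym (p x)) (poly-zero 1)
  poly-weaken (suc n) p a = let g , g-poly , eq = p a in g , poly-weaken n g-poly , eq

  poly-+ : ∀ n {f g} → IsPoly n f → IsPoly n g → IsPoly n (λ x → f x + g x)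
  poly-+ zero    p q x = trans (+-cong (p x) (q x)) (+-identityˡ 0#)
  poly-+ (suc n) {f} {g} p q a = let u , u-poly , f≈ = p a ; v , v-poly , g≈ = q a in
    (λ x → u x + v x) , poly-+ n u-poly v-poly , λ x → trans (+-cong (f≈ x) (g≈ x))
      (solve 6 (λ f g x a u v → (f :+ (x :- a) :* u) :+ (g :+ (x :- a) :* v) := (f :+ g) :+ (x :- a) :*
        (u :+ v)) refl
        (f a) (g a) x a (u x) (v x))

  poly-scale : ∀ n k {f} → IsPoly n f → IsPoly n (λ x → k * f x)
  poly-scale zero    k p x = trans (*-congˡ (p x)) (zeroʳ k)
  poly-scale (suc n) k {f} p a = let u , u-poly , f≈ = p a in
    (λ x → k * u x) , poly-scale n k u-poly , λ x → trans (*-congˡ (f≈ x))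
      (solve 5 (λ k f x a u → k :* (f :+ (x :- a) :* u) := k :* f :+ (x :- a) :* (k :* u)) refl k (f a) x a
        (u x))

  poly-*linear : ∀ n b {f} → IsPoly n f → IsPoly (suc n) (λ x → (x - b) * f x)
  poly-*linear zero    b p = poly-cong 1 (λ x → sym (trans (*-congˡ (p x)) (zeroʳ _))) (poly-zero 1)
  poly-*linear (suc n) b {f} p a = let u , u-poly , f≈ = p a in
    (λ x → f a + (x - b) * u x) , poly-+ (suc n) (poly-const n (f a)) (poly-*linear n b u-poly) ,
    λ x → trans (*-congˡ (f≈ x))
      (solve 5 (λ b f x a u → (x :- b) :* (f :+ (x :- a) :* u) := (a :- b) :* f :+ (x :- a) :*
        (f :+ (x :- b) :* u)) refl
        b (f a) x a (u x))

  poly-minus : ∀ n {f g} → IsPoly n f → IsPoly n g → IsPoly n (λ x → f x - g x)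
  poly-minus n {f} {g} p q = poly-cong n (λ x → solve 2 (λ f g → f :+ :- :1 :* g := f :- g) refl (f x) (g x))
    (poly-+ n p (poly-scale n (- 1#) q))

  sum-factor : ∀ {n} (f g : Fin n → Carrier) k → (∀ i → f i ≈ k * g i) → sum f ≈ k * sum g
  sum-factor {zero}  f g k p = sym (zeroʳ k)
  sum-factor {suc n} f g k p = trans (+-cong (p Fin.zero)
    (sum-factor (f ∘ Fin.suc) (g ∘ Fin.suc) k (p ∘ Fin.suc)))
    (sym (distribˡ k _ _))

  coefficients-poly : ∀ n (q : Vector Carrier n) → IsPoly n (λ x → sum λ i → q i * x ^ toℕ i)
  coefficients-poly zero    q _ = refl
  coefficients-poly (suc n) q = poly-cong (suc n)
    (λ x → +-cong (sym (*-identityʳ (q Fin.zero)))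
      (sym (sum-factor (λ i → q (Fin.suc i) * (x * x ^ toℕ i)) (λ i → q (Fin.suc i) * x ^ toℕ i) (x - 0#)
        λ i → solve 3 (λ q x p → q :* (x :* p) := (x :- :0) :* (q :* p)) refl (q (Fin.suc i)) x (x ^ toℕ i))))
    (poly-+ (suc n) (poly-const n (q Fin.zero)) (poly-*linear n 0# (coefficients-poly n (q ∘ Fin.suc))))

  module _ (node : ℕ → Carrier) where

    nodal : ℕ → Carrier → Carrier
    nodal zero    t = 1#
    nodal (suc n) t = (t - node n) * nodal n t

    nodal-poly : ∀ n → IsPoly (suc n) (nodal n)
    nodal-poly zero    = poly-const 0 1#
    nodal-poly (suc n) = poly-*linear (suc n) (node n) (nodal-poly n)

    nodal-root : ∀ n k → k ℕ.< n → nodal n (node k) ≈ 0#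
    nodal-root (suc n) k k<1+n with k ℕ.≟ n
    ... | yes ≡.refl = trans (*-congʳ (-‿inverseʳ _)) (zeroˡ _)
    ... | no  k≢n    = trans (*-congˡ (nodal-root n k (ℕ.≤∧≢⇒< (ℕ.s≤s⁻¹ k<1+n) k≢n))) (zeroʳ _)

    nodal-sign : ∀ n y → (∀ k → k ℕ.< n → y < node k) → 0# < σ n * nodal n y
    nodal-sign zero    y y< = <-respʳ (sym (*-identityˡ 1#)) 0<1
    nodal-sign (suc n) y y< = <-respʳ
      (solve 4 (λ x y s w → (x :- y) :* (s :* w) := :- s :* ((y :- x) :* w)) refl (node n) y (σ n) (nodal n y))
      (*-pos (x<y⇒0<y-x (y< n ℕ.≤-refl)) (nodal-sign n y λ k k<n → y< k (ℕ.m≤n⇒m≤1+n k<n)))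

    nodal-nonNeg : ∀ n y → (∀ k → k ℕ.< n → node k ≤ y) → 0# ≤ nodal n y
    nodal-nonNeg zero    y y≥ = 0≤1
    nodal-nonNeg (suc n) y y≥ =
      x≤y⇒0≤y-x (y≥ n ℕ.≤-refl) ⊗ nodal-nonNeg n y λ k k<n → y≥ k (ℕ.m≤n⇒m≤1+n k<n)

    -- Peel off the last node: subtracting a nonnegative multiple of the nodal polynomial of the
    -- other nodes makes f vanish there, and dividing by the linear factor keeps the signs.
    alternation : ∀ n {f} → IsPoly n f →
      (∀ i j → i ℕ.< j → j ℕ.< n → node j < node i) →
      (∀ k → k ℕ.< n → 0# ≤ σ k * f (node k)) →
      ∀ t → node 0 ≤ t → 0# ≤ f t
    alternation zero    f-poly dec signs t x₀≤t = ≤-reflexive (sym (f-poly t))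
    alternation (suc n) {f} f-poly dec signs t x₀≤t = ≤-respʳ f-t
      (x≤y⇒0≤y-x (node≤t n ℕ.≤-refl) ⊗ q-nonNeg ⊕ c-nonNeg ⊗ nodal-nonNeg n t λ k k<n → node≤t k
        (ℕ.m≤n⇒m≤1+n k<n))
      where
      node≤t : ∀ k → k ℕ.< suc n → node k ≤ t
      node≤t zero    _   = x₀≤t
      node≤t (suc k) k<n = ≤-trans (<⇒≤ (dec 0 (suc k) (ℕ.s≤s ℕ.z≤n) k<n)) x₀≤t

      w = σ n * nodal n (node n)
      0<w : 0# < w
      0<w = nodal-sign n (node n) λ k k<n → dec k n k<n ℕ.≤-refl
      -- This is f / nodal at the last node; the common factor `σ n` displays it as a nonnegative
      -- number over a positive one.
      c = σ n * f (node n) / w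
      c-nonNeg : 0# ≤ c
      c-nonNeg = /-nonNeg (signs n ℕ.≤-refl) 0<w

      g : Carrier → Carrier
      g x = f x - c * nodal n x
      division = poly-minus (suc n) f-poly (poly-scale (suc n) c (nodal-poly n)) (node n)
      q = proj₁ division
      q-poly = proj₁ (proj₂ division)

      g-last : g (node n) ≈ 0#
      g-last = ≈-from {k = - f (node n)} (⁻¹-inv 0<w)
        (solve 4 (λ s f v i → f :- s :* f :* i :* v := :0 :+ :- f :* (s :* v :* i :- :1)) refl
          (σ n) (f (node n)) (nodal n (node n)) (w ⁻¹))

      g≈ : ∀ x → g x ≈ (x - node n) * q x
      g≈ x = trans (proj₂ (proj₂ division) x) (trans (+-congʳ g-last) (+-identityˡ _))

      f-t : (t - node n) * q t + c * nodal n t ≈ f t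
      f-t = trans (+-congʳ (sym (g≈ t))) (solve 2 (λ f w → f :- w :+ w := f) refl (f t) (c * nodal n t))

      f-node : ∀ k → k ℕ.< n → f (node k) ≈ (node k - node n) * q (node k)
      f-node k k<n = trans (trans (solve 2 (λ f c → f := f :- c :* :0) refl (f (node k)) c)
        (+-congˡ (-‿cong (*-congˡ (sym (nodal-root n k k<n)))))) (g≈ (node k))

      q-sign : ∀ k → k ℕ.< n → 0# ≤ σ k * q (node k)
      q-sign k k<n = *-cancel-nonNeg (x<y⇒0<y-x (dec k n k<n ℕ.≤-refl))
        (≤-respʳ (trans (*-congˡ (f-node k k<n))
          (solve 3 (λ s d q → s :* (d :* q) := d :* (s :* q)) refl (σ k) (node k - node n) (q (node k))))
          (signs k (ℕ.m≤n⇒m≤1+n k<n)))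

      q-nonNeg : 0# ≤ q t
      q-nonNeg = alternation n q-poly
        (λ i j i<j j<n → dec i j i<j (ℕ.m≤n⇒m≤1+n j<n)) q-sign t x₀≤t

-- Bernstein's inequality for finite increments

module Bernstein (em : ExcludedMiddle 0ℓ) (ℝ : CompleteOrderedField) where
  open Reals em ℝ hiding (zero)
  open OrderedField em ℝ
  open CosineSeries em ℝ using (σ; cos-cong)
  open Trigonometry em ℝ
  open Polynomials em ℝ

  -- Induction on f = f 0 + x g: multiplying the decomposition of g by c C - s S produces one term
  -- with S², which the circle equation turns into a polynomial in C. The part odd in S keeps one
  -- degree less.
  parity-split : ∀ n c s {f} → IsPoly (suc n) f →
    ∃[ e ] ∃[ r ] IsPoly (suc n) e ∧ IsPoly n r ∧
      (∀ C S → C * C + S * S ≈ 1# → f (c * C - s * S) ≈ e C + S * r C)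
  parity-split zero c s {f} f-poly = let g , g-poly , f≈ = f-poly 0# in
    (λ _ → f 0#) , (λ _ → 0#) , poly-const 0 (f 0#) , poly-zero 0 ,
    λ C S _ → trans (f≈ _) (trans (+-congˡ (*-congˡ (g-poly _)))
      (solve 3 (λ f x S → f :+ x :* :0 := f :+ S :* :0) refl (f 0#) (c * C - s * S - 0#) S))
  parity-split (suc n) c s {f} f-poly =
    let g , g-poly , f≈ = f-poly 0#
        e , r , e-poly , r-poly , g≈ = parity-split n c s g-poly
    in
    -- The factor (C - 1)(C + 1) stands for -S²; it is kept as two linear factors for
    -- `poly-*linear`.
    (λ C → f 0# + (c * ((C - 0#) * e C) + s * ((C - 1#) * ((C - - 1#) * r C)))) ,
    (λ C → c * ((C - 0#) * r C) - s * e C) ,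
    poly-+ (2 ℕ.+ n) (poly-const (suc n) (f 0#)) (poly-+ (2 ℕ.+ n)
      (poly-scale (2 ℕ.+ n) c (poly-*linear (suc n) 0# e-poly))
      (poly-scale (2 ℕ.+ n) s (poly-*linear (suc n) 1# (poly-*linear n (- 1#) r-poly)))) ,
    poly-minus (suc n) (poly-scale (suc n) c (poly-*linear n 0# r-poly)) (poly-scale (suc n) s e-poly) ,
    λ C S C²+S²≈1 → trans (f≈ _) (trans (+-congˡ (*-congˡ (g≈ C S C²+S²≈1)))
      (≈-from {k = - (s * r C)} C²+S²≈1
        (solve 7 (λ f c s C S e r →
          f :+ (c :* C :- s :* S :- :0) :* (e :+ S :* r) :=
          f :+ (c :* ((C :- :0) :* e) :+ s :* ((C :- :1) :* ((C :- :- :1) :* r)))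
            :+ S :* (c :* ((C :- :0) :* r) :- s :* e)
            :+ :- (s :* r) :* (C :* C :+ S :* S :- :1)) refl (f 0#) c s C S (e C) (r C))))

  -- Chebyshev polynomials of the second kind, with index shifted so that U n has degree n - 1.
  U : ℕ → Carrier → Carrier
  U 0             x = 0#
  U 1             x = 1#
  U (suc (suc n)) x = fromℕ 2 * ((x - 0#) * U (suc n) x) - U n x

  U-poly : ∀ n → IsPoly n (U n)
  U-poly 0             = poly-zero 0
  U-poly 1             = poly-const 0 1#
  U-poly (suc (suc n)) = poly-minus (2 ℕ.+ n)
    (poly-scale (2 ℕ.+ n) (fromℕ 2) (poly-*linear (suc n) 0# (U-poly (suc n))))
    (poly-weaken (suc n) (poly-weaken n (U-poly n)))

  sin-multiple : ∀ n t → sin (fromℕ n * t) ≈ sin t * U n (cos t)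
  sin-multiple 0 t = trans (sin-cong (zeroˡ t)) (trans sin0≈0 (sym (zeroʳ _)))
  sin-multiple 1 t = trans (sin-cong (solve 1 (λ t → (:1 :+ :0) :* t := t) refl t)) (sym (*-identityʳ _))
  sin-multiple (suc (suc n)) t = begin
    sin (fromℕ (2 ℕ.+ n) * t)
      ≈⟨ sin-cong (solve 2 (λ n t → (:1 :+ (:1 :+ n)) :* t := (:1 :+ n) :* t :+ t) refl (fromℕ n) t) ⟩
    sin (a + t)
      ≈⟨ sin-+ a t ⟩
    sin a * cos t + cos a * sin t
      ≈⟨ solve 4 (λ S c C s → S :* c :+ C :* s := :2 :* (S :* c) :- (S :* c :+ C :* (:- s))) refl
           (sin a) (cos t) (cos a) (sin t) ⟩
    fromℕ 2 * (sin a * cos t) - (sin a * cos t + cos a * - sin t)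
      ≈⟨ +-congˡ (-‿cong (+-cong (*-congˡ (sym (cos-neg t))) (*-congˡ (sym (sin-neg t))))) ⟩
    fromℕ 2 * (sin a * cos t) - (sin a * cos (- t) + cos a * sin (- t))
      ≈⟨ +-congˡ (-‿cong (sin-+ a (- t))) ⟨
    fromℕ 2 * (sin a * cos t) - sin (a - t)
      ≈⟨ +-cong (*-congˡ (*-congʳ (sin-multiple (suc n) t)))
           (-‿cong (trans (sin-cong (solve 2 (λ n t → (:1 :+ n) :* t :- t := n :* t) refl (fromℕ n) t))
             (sin-multiple n t))) ⟩
    fromℕ 2 * (sin t * U (suc n) (cos t) * cos t) - sin t * U n (cos t)
      ≈⟨ solve 4 (λ s u c v → :2 :* (s :* u :* c) :- s :* v := s :* (:2 :* ((c :- :0) :* u) :- v)) refl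
           (sin t) (U (suc n) (cos t)) (cos t) (U n (cos t)) ⟩
    sin t * U (suc (suc n)) (cos t) ∎
    where
    open ≈R
    a = fromℕ (suc n) * t

  sin[x+π] : ∀ x → sin (x + π) ≈ - sin x
  sin[x+π] x = trans (cos-cong (solve 2 (λ x h → h :- (x :+ :2 :* h) := :- (x :+ h)) refl x π/2))
    (trans (cos-neg _) (cos[x+π/2] x))

  odd : ℕ → ℕ
  odd k = suc (2 ℕ.* k)

  fromℕ-odd-suc : ∀ k → fromℕ (odd (suc k)) ≈ fromℕ (odd k) + fromℕ 2
  fromℕ-odd-suc k = trans (reflexive (≡.cong (fromℕ ∘ suc) (ℕ.*-suc 2 k)))
    (solve 1 (λ m → :1 :+ (:1 :+ (:1 :+ m)) := :1 :+ m :+ :2) refl (fromℕ (2 ℕ.* k)))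

  sin-odd : ∀ k → sin (fromℕ (odd k) * π/2) ≈ σ k
  sin-odd zero    = trans (sin-cong (solve 1 (λ h → (:1 :+ :0) :* h := h) refl π/2)) sin[π/2]≈1
  sin-odd (suc k) = trans (sin-cong (trans (*-congʳ (fromℕ-odd-suc k)) (distribʳ _ _ _)))
    (trans (sin[x+π] _) (-‿cong (sin-odd k)))

  σ²≈1 : ∀ k → σ k * σ k ≈ 1#
  σ²≈1 zero    = *-identityˡ 1#
  σ²≈1 (suc k) = trans (solve 1 (λ s → :- s :* :- s := s :* s) refl (σ k)) (σ²≈1 k)

  sin-nonNeg : ∀ {x} → 0# ≤ x → x < π → 0# ≤ sin x
  sin-nonNeg {x} 0≤x x<π = case (<-≤-connex 0# x)
    where
    case : 0# < x ⊎ x ≤ 0# → 0# ≤ sin x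
    case (inj₁ 0<x) = <⇒≤ (sin-pos 0<x x<π)
    case (inj₂ x≤0) = ≤-reflexive (sym (trans (sin-cong (≤-antisym x≤0 0≤x)) sin0≈0))

  module Schur (n-1 : ℕ) where
    n : ℕ
    n = suc n-1

    η : Carrier
    η = π/2 / fromℕ n

    angle node : ℕ → Carrier
    angle k = fromℕ (odd k) * η
    node  k = cos (angle k)

    η*n≈π/2 : η * fromℕ n ≈ π/2
    η*n≈π/2 = x/y*y≈x π/2 (fromℕ-pos n-1)

    0<η : 0# < η
    0<η = /-pos 0<π/2 (fromℕ-pos n-1)

    2n*η≈π : fromℕ (2 ℕ.* n) * η ≈ π
    2n*η≈π = trans (*-congʳ (fromℕ-* 2 n)) (trans (*-assoc _ _ _) (*-congˡ (trans (*-comm _ _) η*n≈π/2)))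

    angle-pos : ∀ k → 0# < angle k
    angle-pos k = *-pos (fromℕ-pos (2 ℕ.* k)) 0<η

    fromℕ-mono-< : ∀ {i j} → i ℕ.< j → fromℕ i < fromℕ j
    fromℕ-mono-< {i} i<j = <-≤-trans
      (0<y-x⇒x<y (<-respʳ (solve 1 (λ i → :1 := :1 :+ i :- i) refl (fromℕ i)) 0<1)) (fromℕ-mono i<j)

    *η-mono-< : ∀ {x y} → x < y → x * η < y * η
    *η-mono-< {x} {y} x<y = 0<y-x⇒x<y (<-respʳ
      (solve 3 (λ x y h → (y :- x) :* h := y :* h :- x :* h) refl x y η) (*-pos (x<y⇒0<y-x x<y) 0<η))

    angle<π : ∀ k → k ℕ.< n → angle k < π
    angle<π k k<n = <-respʳ 2n*η≈π (*η-mono-< (fromℕ-mono-<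
      (ℕ.≤-trans (ℕ.≤-reflexive (≡.sym (ℕ.*-suc 2 k))) (ℕ.*-monoʳ-≤ 2 k<n))))

    node-decreasing : ∀ i j → i ℕ.< j → j ℕ.< n → node j < node i
    node-decreasing i j i<j j<n = cos-strictly-decreasing (<⇒≤ (angle-pos i))
      (*η-mono-< (fromℕ-mono-< (ℕ.s≤s (ℕ.*-monoʳ-< 2 i<j)))) (<⇒≤ (angle<π j j<n))

    sin[n*angle] : ∀ k → sin (fromℕ n * angle k) ≈ σ k
    sin[n*angle] k = trans (sin-cong (trans
      (solve 3 (λ n o h → n :* (o :* h) := o :* (h :* n)) refl (fromℕ n) (fromℕ (odd k)) η) (*-congˡ η*n≈π/2)))
        (sin-odd k)

    module _ {r M} (r-poly : IsPoly n r) (bound : ∀ t → ∣ sin t * r (cos t) ∣ ≤ M) where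

      -- Multiplication by the positive sine of the angle turns M U into M sin (n · angle k) = M σ
      -- k. The expression becomes M plus or minus something of absolute value at most M.
      comparison-sign : ∀ k → k ℕ.< n → 0# ≤ σ k * (M * U n (node k) + r (node k))
      comparison-sign k k<n = *-cancel-nonNeg (sin-pos (angle-pos k) (angle<π k k<n))
        (≤-respʳ (sym identity) (≤-respʳ (solve 2 (λ m x → m :- (:- x) := m :+ x) refl M (σ k * g))
          (x≤y⇒0≤y-x (≤-trans (-x≤∣x∣ _) ∣σg∣≤M))))
        where
        open ≈R
        s = sin (angle k)
        g = s * r (node k)
        ∣σ∣≤1 : ∣ σ k ∣ ≤ 1#
        ∣σ∣≤1 = x²≤y²⇒∣x∣≤y 0≤1 (≤-reflexive (trans (σ²≈1 k) (sym (*-identityˡ 1#))))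
        ∣σg∣≤M : ∣ σ k * g ∣ ≤ M
        ∣σg∣≤M = ≤-trans (∣x*y∣≤ ∣σ∣≤1 (bound (angle k))) (≤-reflexive (*-identityˡ M))
        identity : s * (σ k * (M * U n (node k) + r (node k))) ≈ M + σ k * g
        identity = begin
          s * (σ k * (M * U n (node k) + r (node k)))
            ≈⟨ solve 5 (λ s σ m u r → s :* (σ :* (m :* u :+ r)) := m :* (σ :* (s :* u)) :+ σ :* (s :* r)) refl
                 s (σ k) M (U n (node k)) (r (node k)) ⟩
          M * (σ k * (s * U n (node k))) + σ k * g
            ≈⟨ +-congʳ (*-congˡ (trans (*-congˡ (trans (sym (sin-multiple n (angle k))) (sin[n*angle] k)))
              (σ²≈1 k))) ⟩
          M * 1# + σ k * g
            ≈⟨ +-congʳ (*-identityʳ M) ⟩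
          M + σ k * g ∎

      -- For h ≤ η, the point cos h lies to the right of the largest node, where `alternation`
      -- applies to M U + r; multiplying by sin h restores the sines. Replacing r by -r gives the
      -- other half of `schur`.
      schur-lower : ∀ {h} → 0# ≤ h → h ≤ η → - (sin h * r (cos h)) ≤ M * sin (fromℕ n * h)
      schur-lower {h} 0≤h h≤η = ≤-from
        (sin-nonNeg 0≤h (≤-<-trans h≤η η<π) ⊗ alternation node n
          (poly-+ n (poly-scale n M (U-poly n)) r-poly) node-decreasing comparison-sign (cos h) node₀≤cosh)
        (trans (*-congˡ (sin-multiple n h))
          (solve 4 (λ m s u r → m :* (s :* u) := :- (s :* r) :+ s :* (m :* u :+ r)) refl M (sin h) (U n (cos h))
            (r (cos h))))
        where
        angle₀≈η : angle 0 ≈ η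
        angle₀≈η = solve 1 (λ h → (:1 :+ :0) :* h := h) refl η
        η<π : η < π
        η<π = <-respˡ angle₀≈η (angle<π 0 (ℕ.s≤s ℕ.z≤n))
        node₀≤cosh : node 0 ≤ cos h
        node₀≤cosh = ≤-respˡ (cos-cong (sym angle₀≈η)) (cos-decreasing 0≤h h≤η (<⇒≤ η<π))

    schur : ∀ {r M} → IsPoly n r → (∀ t → ∣ sin t * r (cos t) ∣ ≤ M) →
            ∀ {h} → 0# ≤ h → h ≤ η → ∣ sin h * r (cos h) ∣ ≤ M * sin (fromℕ n * h)
    schur {r} {M} r-poly bound {h} 0≤h h≤η = ∣∣-lub
      (≤-respˡ (solve 2 (λ s r → :- (s :* (:- :1 :* r)) := s :* r) refl (sin h) (r (cos h)))
        (schur-lower {λ x → - 1# * r x} {M} (poly-scale n (- 1#) r-poly)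
          (λ t → ≤-trans (≤-reflexive (∣∣-cong (solve 2 (λ s r → s :* (:- :1 :* r) := :- (s :* r)) refl (sin t)
            (r (cos t)))))
            (≤-trans (∣-x∣≤∣x∣ _) (bound t))) 0≤h h≤η))
      (schur-lower r-poly bound 0≤h h≤η)

  cos∈[-1,1] : ∀ t → [-1,1] (cos t)
  cos∈[-1,1] t = ∣∣≤⇒-≤ (∣cos∣≤1 t) , ≤-trans (x≤∣x∣ _) (∣cos∣≤1 t)

  -- The two smallness conditions serve different ends: with h half of b - a, the first gives n h ≤
  -- 1 for `sin≤2x`, the second h ≤ η for `schur`.
  bernstein : ∀ n-1 → let n = suc n-1 in ∀ {f M} → IsPoly (suc n) f → (∀ x → [-1,1] x → ∣ f x ∣ ≤ M) →
    ∀ {a b} → a ≤ b → fromℕ n * (b - a) ≤ fromℕ 2 → fromℕ n * (b - a) ≤ π →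
    ∣ f (cos b) - f (cos a) ∣ ≤ fromℕ 2 * M * (fromℕ n * (b - a))
  bernstein n-1 {f} {M} f-poly bound {a} {b} a≤b small small′ = begin
    ∣ f (cos b) - f (cos a) ∣
      ≈⟨ ∣∣-cong (+-cong (resp (cos-cong (sym θ+h≈b))) (-‿cong (resp (cos-cong (sym θ-h≈a))))) ⟩
    ∣ f (cos (θ + h)) - f (cos (θ - h)) ∣
      ≈⟨ ∣∣-cong (odd-part h) ⟩
    ∣ fromℕ 2 * (sin h * r (cos h)) ∣
      ≤⟨ ∣x*y∣≤ (≤-reflexive (0≤x⇒∣x∣≈x (fromℕ-nonNeg 2))) (Schur.schur n-1 r-poly half-bound 0≤h h≤η) ⟩
    fromℕ 2 * (M * sin (fromℕ n * h))
      ≤⟨ *-monoˡ (fromℕ-nonNeg 2) (*-monoˡ 0≤M (sin≤2x (fromℕ-nonNeg n ⊗ 0≤h) nh≤1)) ⟩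
    fromℕ 2 * (M * (fromℕ 2 * (fromℕ n * h)))
      ≈⟨ solve 3 (λ m n h → :2 :* (m :* (:2 :* (n :* h))) := :2 :* m :* (n :* (h :* :2))) refl M (fromℕ n) h ⟩
    fromℕ 2 * M * (fromℕ n * (h * fromℕ 2))
      ≈⟨ *-congˡ (*-congˡ (x/y*y≈x (b - a) (fromℕ-pos 1))) ⟩
    fromℕ 2 * M * (fromℕ n * (b - a)) ∎
    where
    open ≤R
    n = suc n-1
    θ = (a + b) / fromℕ 2
    h = (b - a) / fromℕ 2
    θ-h≈a : θ - h ≈ a
    θ-h≈a = midpoint-- a b
    θ+h≈b : θ + h ≈ b
    θ+h≈b = midpoint-+ a b
    resp : ∀ {x y} → x ≈ y → f x ≈ f y
    resp = poly-resp (suc n) f-poly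
    0≤h : 0# ≤ h
    0≤h = /-nonNeg (x≤y⇒0≤y-x a≤b) (fromℕ-pos 1)
    2nh≈ : fromℕ 2 * (fromℕ n * h) ≈ fromℕ n * (b - a)
    2nh≈ = trans (solve 2 (λ n h → :2 :* (n :* h) := n :* (h :* :2)) refl (fromℕ n) h)
      (*-congˡ (x/y*y≈x (b - a) (fromℕ-pos 1)))
    nh≤1 : fromℕ n * h ≤ 1#
    nh≤1 = *-cancelˡ-≤ (fromℕ-pos 1) (≤-respˡ (sym 2nh≈) (≤-respʳ (sym (*-identityʳ _)) small))
    h≤η : h ≤ Schur.η n-1
    h≤η = z*y≤x⇒z≤x/y (fromℕ-pos n-1) (≤-respˡ (*-comm _ _)
      (*-cancelˡ-≤ (fromℕ-pos 1) (≤-respˡ (sym 2nh≈) small′)))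
    0≤M : 0# ≤ M
    0≤M = ≤-trans (0≤∣x∣ _) (bound (cos a) (cos∈[-1,1] a))

    split = parity-split n (cos θ) (sin θ) f-poly
    e = proj₁ split
    r = proj₁ (proj₂ split)
    r-poly = proj₁ (proj₂ (proj₂ (proj₂ split)))
    f≈ = proj₂ (proj₂ (proj₂ (proj₂ split)))

    odd-part : ∀ t → f (cos (θ + t)) - f (cos (θ - t)) ≈ fromℕ 2 * (sin t * r (cos t))
    odd-part t = trans (+-cong
      (trans (resp (cos-+ θ t)) (f≈ (cos t) (sin t) (cos²+sin²≈1 t)))
      (-‿cong (trans (resp (trans (cos-- θ t)
          (solve 4 (λ c C s S → c :* C :+ s :* S := c :* C :- s :* :- S) refl (cos θ) (cos t) (sin θ) (sin t))))
        (f≈ (cos t) (- sin t) (trans (solve 2 (λ c s → c :* c :+ :- s :* :- s := c :* c :+ s :* s) refl (cos t)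
          (sin t)) (cos²+sin²≈1 t))))))
      (solve 3 (λ e s r → e :+ s :* r :- (e :+ :- s :* r) := :2 :* (s :* r)) refl (e (cos t)) (sin t)
        (r (cos t)))

    -- Twice the quantity is a difference of two values of `f` on [-1,1].
    half-bound : ∀ t → ∣ sin t * r (cos t) ∣ ≤ M
    half-bound t = ∣∣-lub (*-cancelˡ-≤ (fromℕ-pos 1) (bound₂ (x≤∣x∣ _) refl))
      (*-cancelˡ-≤ (fromℕ-pos 1) (bound₂ (-x≤∣x∣ _) (solve 1 (λ x → :- (:2 :* x) := :2 :* :- x) refl _)))
      where
      bound₂ : ∀ {x y} → x ≤ ∣ fromℕ 2 * (sin t * r (cos t)) ∣ → x ≈ y → y ≤ fromℕ 2 * M
      bound₂ {x} {y} p x≈y = begin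
        y                                             ≈⟨ x≈y ⟨
        x                                             ≤⟨ p ⟩
        ∣ fromℕ 2 * (sin t * r (cos t)) ∣             ≈⟨ ∣∣-cong (odd-part t) ⟨
        ∣ f (cos (θ + t)) - f (cos (θ - t)) ∣         ≤⟨ ∣x-y∣≤ (bound _ (cos∈[-1,1] _))
          (bound _ (cos∈[-1,1] _)) ⟩
        M + M                                         ≈⟨ solve 1 (λ m → m :+ m := :2 :* m) refl M ⟩
        fromℕ 2 * M                                   ∎

-- Medians of lists with a controlled majority

module Median (em : ExcludedMiddle 0ℓ) (ℝ : CompleteOrderedField) where
  open Reals em ℝ hiding (zero)
  open OrderedField em ℝ
  open Sort decTotalOrder using (sort-↭; sort-↗)

  entry : ℕ → List Carrier → Carrier
  entry k l = fromMaybe 0# (head (drop k l))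

  count : Pred Carrier 0ℓ → List Carrier → ℕ
  count P l = length (filter (λ x → em {P x}) l)

  count-accept : ∀ (P : Pred Carrier 0ℓ) {x} l → P x → count P (x ∷ l) ≡ suc (count P l)
  count-accept P l Px = ≡.cong length (List.filter-accept (λ x → em {P x}) Px)

  count-∷ : ∀ (P : Pred Carrier 0ℓ) x l → count P l ℕ.≤ count P (x ∷ l)
  count-∷ P x l with em {P x}
  ... | yes _ = ℕ.n≤1+n _
  ... | no  _ = ℕ.≤-refl

  count-all : ∀ (P : Pred Carrier 0ℓ) {l} → All P l → count P l ≡ length l
  count-all P ps = ≡.cong length (List.filter-all (λ x → em {P x}) ps)

  entry-≥ : ∀ {x} l k → All (x ≤_) l → k ℕ.< length l → x ≤ entry k l
  entry-≥ (y ∷ l) zero    (x≤y ∷ _)  _          = x≤y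
  entry-≥ (y ∷ l) (suc k) (_ ∷ x≤l) (ℕ.s≤s k<) = entry-≥ l k x≤l k<

  -- In a sorted list an upward closed property of entry k passes to all later entries, so only the
  -- k entries before it can fail. In `count-lower`, dually, the first k + 1 entries satisfy the
  -- property.
  count-upper : ∀ (P : Pred Carrier 0ℓ) → (∀ {x y} → x ≤ y → P x → P y) →
    ∀ l k → AllPairs _≤_ l → k ℕ.< length l → P (entry k l) → length l ℕ.≤ count P l ℕ.+ k
  count-upper P up (x ∷ l) zero (x≤l ∷ _) _ Px = ℕ.≤-reflexive (≡.sym
    (≡.trans (ℕ.+-identityʳ _) (count-all P (Px ∷ All.map (λ x≤y → up x≤y Px) x≤l))))
  count-upper P up (x ∷ l) (suc k) (_ ∷ sorted) (ℕ.s≤s k<) Pe = ℕ.≤-trans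
    (ℕ.s≤s (count-upper P up l k sorted k< Pe))
    (ℕ.≤-trans (ℕ.≤-reflexive (≡.sym (ℕ.+-suc (count P l) k))) (ℕ.+-monoˡ-≤ (suc k) (count-∷ P x l)))

  count-lower : ∀ (P : Pred Carrier 0ℓ) → (∀ {x y} → x ≤ y → P y → P x) →
    ∀ l k → AllPairs _≤_ l → k ℕ.< length l → P (entry k l) → k ℕ.< count P l
  count-lower P down (x ∷ l) zero    _ _ Px = ℕ.≤-trans (ℕ.s≤s ℕ.z≤n)
    (ℕ.≤-reflexive (≡.sym (count-accept P l Px)))
  count-lower P down (x ∷ l) (suc k) (x≤l ∷ sorted) (ℕ.s≤s k<) Pe = ℕ.≤-trans
    (ℕ.s≤s (count-lower P down l k sorted k< Pe))
    (ℕ.≤-reflexive (≡.sym (count-accept P l (down (entry-≥ l k x≤l k<) Pe))))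

  halves : ∀ n → let k = ℕ.⌊ n /2⌋ in k ℕ.+ k ℕ.≤ n ∧ n ℕ.≤ suc (k ℕ.+ k)
  halves 0 = ℕ.z≤n , ℕ.z≤n
  halves 1 = ℕ.z≤n , ℕ.s≤s ℕ.z≤n
  halves (suc (suc n)) rewrite ℕ.+-suc ℕ.⌊ n /2⌋ ℕ.⌊ n /2⌋ =
    ℕ.s≤s (ℕ.s≤s (proj₁ (halves n))) , ℕ.s≤s (ℕ.s≤s (proj₂ (halves n)))

  middle< : ∀ k n → k ℕ.+ k ℕ.≤ n → 0 ℕ.< n → k ℕ.< n
  middle< zero    n _    0<n = 0<n
  middle< (suc k) n 2k≤n _   = ℕ.≤-trans (ℕ.s≤s (ℕ.m≤n+m (suc k) k)) 2k≤n

  -- The conditions on k and n say that k is ⌊(n-1)/2⌋ or ⌊n/2⌋.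
  entry-between : ∀ l {lo hi} → let n = length l in
    count (hi <_) l ℕ.+ count (hi <_) l ℕ.< n → count (_< lo) l ℕ.+ count (_< lo) l ℕ.< n →
    AllPairs _≤_ l → ∀ k → k ℕ.+ k ℕ.≤ n → n ℕ.≤ suc k ℕ.+ suc k → lo ≤ entry k l ∧ entry k l ≤ hi
  entry-between l {lo} {hi} few-high few-low sorted k 2k≤n n≤2k+2 = lower (<-≤-connex (entry k l) lo) , upper
    (<-≤-connex hi (entry k l))
    where
    n = length l
    k<n = middle< k n 2k≤n (ℕ.≤-trans (ℕ.s≤s ℕ.z≤n) few-high)
    -- Let c count the entries below `lo`. If entry k were among them, then 2k + 2 ≤ 2c < n, against
    -- n ≤ 2k + 2. Above `hi`, n ≤ c + k would give 2n ≤ 2c + 2k < 2n.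
    lower : entry k l < lo ⊎ lo ≤ entry k l → lo ≤ entry k l
    lower (inj₂ lo≤) = lo≤
    lower (inj₁ <lo) = ⊥-elim (ℕ.<-irrefl ≡.refl (ℕ.<-≤-trans few-low (ℕ.≤-trans n≤2k+2 (ℕ.+-mono-≤ k<c k<c))))
      where k<c = count-lower (_< lo) ≤-<-trans l k sorted k<n <lo
    upper : hi < entry k l ⊎ entry k l ≤ hi → entry k l ≤ hi
    upper (inj₂ ≤hi) = ≤hi
    upper (inj₁ hi<) = ⊥-elim (ℕ.<-irrefl ≡.refl (ℕ.<-≤-trans (ℕ.+-mono-<-≤ few-high 2k≤n)
      (ℕ.≤-trans (ℕ.+-mono-≤ n≤c+k n≤c+k) (ℕ.≤-reflexive (interchange (count (hi <_) l) k)))))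
      where
      n≤c+k = count-upper (hi <_) (λ x≤y hi<x → <-≤-trans hi<x x≤y) l k sorted k<n hi<
      interchange : ∀ c k → (c ℕ.+ k) ℕ.+ (c ℕ.+ k) ≡ (c ℕ.+ c) ℕ.+ (k ℕ.+ k)
      interchange c k = NatSolver.solve 2 (λ c k → (c NatSolver.:+ k) NatSolver.:+ (c NatSolver.:+ k)
        NatSolver.:= (c NatSolver.:+ c) NatSolver.:+ (k NatSolver.:+ k)) ≡.refl c k

  -- Both central entries of the sorted list lie in the interval, hence so does their average;
  -- sorting preserves the length and the counts.
  median-between : ∀ l {lo hi} → let n = length l in
    count (hi <_) l ℕ.+ count (hi <_) l ℕ.< n → count (_< lo) l ℕ.+ count (_< lo) l ℕ.< n →
    lo ≤ median l ∧ median l ≤ hi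
  median-between l {lo} {hi} few-high few-low =
    z*y≤x⇒z≤x/y (fromℕ-pos 1) (≤-respˡ (x+x≈x*2 lo) (+-mono-≤ (proj₁ entry₁) (proj₁ entry₂))) ,
    x≤z*y⇒x/y≤z (fromℕ-pos 1) (≤-respʳ (x+x≈x*2 hi) (+-mono-≤ (proj₂ entry₁) (proj₂ entry₂)))
    where
    x+x≈x*2 : ∀ x → x + x ≈ x * fromℕ 2
    x+x≈x*2 x = solve 1 (λ x → x :+ x := x :* :2) refl x

    length-sort : length (sort l) ≡ length l
    length-sort = ↭-length (sort-↭ l)

    few-sorted : ∀ P → count P l ℕ.+ count P l ℕ.< length l → count P (sort l) ℕ.+ count P (sort l) ℕ.< length
      (sort l)
    few-sorted P few rewrite length-sort | ↭-length (filter-↭ (λ x → em {P x}) (sort-↭ l)) = few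

    between : ∀ k → k ℕ.+ k ℕ.≤ length l → length l ℕ.≤ suc k ℕ.+ suc k → lo ≤ entry k (sort l) ∧ entry k
      (sort l) ≤ hi
    between k p q = entry-between (sort l) (few-sorted (hi <_) few-high) (few-sorted (_< lo) few-low)
      (Sorted⇒AllPairs totalOrder (sort-↗ l)) k (≡.subst (k ℕ.+ k ℕ.≤_) (≡.sym length-sort) p)
      (≡.subst (ℕ._≤ suc k ℕ.+ suc k) (≡.sym length-sort) q)

    n≤2+2k : ∀ {n} k → n ℕ.≤ suc (k ℕ.+ k) → suc n ℕ.≤ suc k ℕ.+ suc k
    n≤2+2k k p = ℕ.≤-trans (ℕ.s≤s p) (ℕ.≤-reflexive (≡.cong suc (≡.sym (ℕ.+-suc k k))))

    pred-suc : ∀ {m} n → m ℕ.< n → suc (n ℕ.∸ 1) ≡ n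
    pred-suc (suc n) _ = ≡.refl

    -- The truncated subtraction is a genuine predecessor, as `few-high` makes the length positive.
    k₁ = ℕ.⌊ length l ℕ.∸ 1 /2⌋
    entry₁ = between k₁
      (ℕ.≤-trans (proj₁ (halves (length l ℕ.∸ 1))) (ℕ.m∸n≤m _ 1))
      (≡.subst (ℕ._≤ suc k₁ ℕ.+ suc k₁) (pred-suc (length l) few-high)
        (n≤2+2k k₁ (proj₂ (halves (length l ℕ.∸ 1)))))
    entry₂ = between ℕ.⌊ length l /2⌋ (proj₁ (halves (length l)))
      (ℕ.≤-trans (ℕ.n≤1+n _) (n≤2+2k ℕ.⌊ length l /2⌋ (proj₂ (halves (length l)))))

-- The supremum norm of polynomials

module SupNorm (em : ExcludedMiddle 0ℓ) (ℝ : CompleteOrderedField) where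
  open Reals em ℝ hiding (zero)
  open OrderedField em ℝ
  open Limits em ℝ
  open Polynomials em ℝ

  ∣x∣≤1 : ∀ {x} → [-1,1] x → ∣ x ∣ ≤ 1#
  ∣x∣≤1 (-1≤x , x≤1) = ∣∣-lub x≤1 (≤-respʳ (solve 0 (:- (:- :1) := :1) refl) (neg-mono -1≤x))

  -- Guarantees that the supremum in `‖_‖∞` exists, so that the description operator does not return
  -- its default.
  poly-bounded : ∀ n {f} → IsPoly n f → ∃[ B ] (∀ x → [-1,1] x → ∣ f x ∣ ≤ B)
  poly-bounded zero    p = 0# , λ x _ → ≤-reflexive (trans (∣∣-cong (p x)) (0≤x⇒∣x∣≈x ≤-refl))
  poly-bounded (suc n) {f} p =
    let g , g-poly , f≈ = p 0#
        B , bound = poly-bounded n g-poly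
    in ∣ f 0# ∣ + 1# * B , λ x x∈ → ≤-trans (≤-reflexive (∣∣-cong (f≈ x)))
      (∣x+y∣≤ ≤-refl (∣x*y∣≤ (≤-trans (≤-reflexive (∣∣-cong
        (solve 1 (λ x → x :- :0 := x) refl x))) (∣x∣≤1 x∈)) (bound x x∈)))

  module _ n {f} (f-poly : IsPoly n f) where
    private
      values : Pred Carrier 0ℓ
      values y = ∃[ x ] [-1,1] x ∧ y ≈ ∣ f x ∣

      isSupremum : IsSupremum values ‖ f ‖∞
      isSupremum = the-satisfies (IsSupremum values) (complete values
        (_ , 0# , (≤-from 0≤1 (sym (-‿inverseˡ 1#)) , 0≤1) , refl)
        (let B , bound = poly-bounded n f-poly in B , λ y (x , x∈ , y≈) → ≤-respˡ (sym y≈) (bound x x∈)))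

    ∣f∣≤‖f‖ : ∀ x → [-1,1] x → ∣ f x ∣ ≤ ‖ f ‖∞
    ∣f∣≤‖f‖ x x∈ = proj₁ isSupremum _ (x , x∈ , refl)

    ‖f‖-least : ∀ {B} → (∀ x → [-1,1] x → ∣ f x ∣ ≤ B) → ‖ f ‖∞ ≤ B
    ‖f‖-least {B} bound = proj₂ isSupremum B λ y (x , x∈ , y≈) → ≤-respˡ (sym y≈) (bound x x∈)

    0≤‖f‖ : 0# ≤ ‖ f ‖∞
    0≤‖f‖ = ≤-trans (0≤∣x∣ _) (∣f∣≤‖f‖ 0# (≤-from 0≤1 (sym (-‿inverseˡ 1#)) , 0≤1))

-- Oscillation of polynomials on Chebyshev intervals

module ChebyshevPartition (em : ExcludedMiddle 0ℓ) (ℝ : CompleteOrderedField) where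
  open Reals em ℝ hiding (zero)
  open OrderedField em ℝ
  open Limits em ℝ
  open CosineSeries em ℝ using (cos-cong)
  open Trigonometry em ℝ
  open Polynomials em ℝ
  open Bernstein em ℝ

  module _ (m-1 : ℕ) where
    private
      m = suc m-1

    angle : ℕ → Carrier
    angle k = π * fromℕ k / fromℕ m

    angle*m : ∀ k → angle k * fromℕ m ≈ π * fromℕ k
    angle*m k = x/y*y≈x _ (fromℕ-pos m-1)

    angle-step : ∀ k → (angle (suc k) - angle k) * fromℕ m ≈ π
    angle-step k = trans (solve 3 (λ a b m → (a :- b) :* m := a :* m :- b :* m) refl (angle (suc k)) (angle k)
      (fromℕ m))
      (trans (+-cong (angle*m (suc k)) (-‿cong (angle*m k)))
        (solve 2 (λ p k → p :* (:1 :+ k) :- p :* k := p) refl π (fromℕ k)))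

    angle-mono : ∀ k → angle k ≤ angle (suc k)
    angle-mono k = 0≤y-x⇒x≤y (*-cancel-nonNeg (fromℕ-pos m-1)
      (≤-respʳ (trans (sym (angle-step k)) (*-comm _ _)) (<⇒≤ 0<π)))

    cos-angle-0 : cos (angle 0) ≈ 1#
    cos-angle-0 = trans (cos-cong (solve 2 (λ p i → p :* :0 :* i := :0) refl π (fromℕ m ⁻¹))) cos0≈1

    cos-angle-m : cos (angle m) ≈ - 1#
    cos-angle-m = trans (cos-cong (≈-from {k = π} (⁻¹-inv (fromℕ-pos m-1))
      (solve 3 (λ p m i → p :* m :* i := p :+ p :* (m :* i :- :1)) refl π (fromℕ m) (fromℕ m ⁻¹)))) cosπ≈-1

    -- The Chebyshev interval with a natural number as index: `ChebyshevInterval m j` unfolds to the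
    -- case `toℕ j`.
    InCell : ℕ → Pred Carrier 0ℓ
    InCell k x = cos (angle (suc k)) ≤ x ∧ x ≤ cos (angle k)

    -- The cell ends at the least k with cos (angle k) ≤ x, which exists because cos (angle m) = -1.
    covering : ∀ x → [-1,1] x → ∃[ j ] ChebyshevInterval m j x
    covering x (-1≤x , x≤1) = Fin.fromℕ< j<m , ≡.subst (λ k → InCell k x) (≡.sym (Fin.toℕ-fromℕ< j<m)) x∈
      where
      Below : ℕ → Set
      Below k = cos (angle k) ≤ x

      first = least {Below} m (≤-respˡ (sym cos-angle-m) -1≤x)

      cell : ∀ k → Below k → (∀ i → Below i → k ℕ.≤ i) → k ℕ.≤ m → ∃[ j ] j ℕ.< m ∧ InCell j x
      -- If the least index is 0, then x is the endpoint 1, which belongs to the first cell.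
      cell zero    below minimal _   = 0 , ℕ.s≤s ℕ.z≤n ,
        ≤-trans (proj₂ (cos∈[-1,1] _)) (≤-respˡ cos-angle-0 below) , ≤-respʳ (sym cos-angle-0) x≤1
      cell (suc k) below minimal k<m = k , k<m , below ,
        <⇒≤ (≰⇒> λ below-k → ℕ.<-irrefl ≡.refl (minimal k below-k))

      found = cell (proj₁ first) (proj₁ (proj₂ first)) (proj₂ (proj₂ first))
        (proj₂ (proj₂ first) m (≤-respˡ (sym cos-angle-m) -1≤x))
      j<m = proj₁ (proj₂ found)
      x∈ = proj₂ (proj₂ found)

    -- By the intermediate value theorem both points are cosines of angles in one arc of length π /
    -- m, where `bernstein` applies; `q` stands for an upper bound of d π / m.
    oscillation : ∀ d-1 {q} → let d = suc d-1 in
      fromℕ d * π ≤ q * fromℕ m → q ≤ fromℕ 2 → d ℕ.≤ m →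
      ∀ {f M} → IsPoly (suc d) f → (∀ x → [-1,1] x → ∣ f x ∣ ≤ M) →
      ∀ k {x y} → InCell k x → InCell k y → ∣ f x - f y ∣ ≤ fromℕ 2 * M * q
    oscillation d-1 {q} dπ≤qm q≤2 d≤m {f} {M} f-poly bound k {x} {y} (lx , xu) (ly , yu) =
      go (cos-intermediate (angle-mono k) xu lx) (cos-intermediate (angle-mono k) yu ly)
      where
      d = suc d-1
      0≤M : 0# ≤ M
      0≤M = ≤-trans (0≤∣x∣ _) (bound (cos 0#) (cos∈[-1,1] 0#))

      d*step*m : fromℕ m * (fromℕ d * (angle (suc k) - angle k)) ≈ fromℕ d * π
      d*step*m = trans (solve 3 (λ m d s → m :* (d :* s) := d :* (s :* m)) refl (fromℕ m) (fromℕ d) _)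
        (*-congˡ (angle-step k))

      d*step≤q : fromℕ d * (angle (suc k) - angle k) ≤ q
      d*step≤q = *-cancelˡ-≤ (fromℕ-pos m-1) (≤-respˡ (sym d*step*m) (≤-respʳ (*-comm _ _) dπ≤qm))

      d*step≤π : fromℕ d * (angle (suc k) - angle k) ≤ π
      d*step≤π = *-cancelˡ-≤ (fromℕ-pos m-1) (≤-respˡ (sym d*step*m) (*-monoʳ (<⇒≤ 0<π) (fromℕ-mono d≤m)))

      ordered : ∀ {a b} → Between (angle k) (angle (suc k)) a → Between (angle k) (angle (suc k)) b → a ≤ b →
                ∣ f (cos b) - f (cos a) ∣ ≤ fromℕ 2 * M * q
      ordered {a} {b} (ka , _) (_ , bk) a≤b = ≤-trans
        (bernstein d-1 f-poly bound a≤b (≤-trans gap (≤-trans d*step≤q q≤2)) (≤-trans gap d*step≤π))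
        (*-monoˡ (fromℕ-nonNeg 2 ⊗ 0≤M) (≤-trans gap d*step≤q))
        where
        gap : fromℕ d * (b - a) ≤ fromℕ d * (angle (suc k) - angle k)
        gap = *-monoˡ (fromℕ-nonNeg d) (+-mono-≤ bk (neg-mono ka))

      go : ∃[ a ] Between (angle k) (angle (suc k)) a ∧ cos a ≈ x →
           ∃[ b ] Between (angle k) (angle (suc k)) b ∧ cos b ≈ y → ∣ f x - f y ∣ ≤ fromℕ 2 * M * q
      go (a , a∈ , cosa≈x) (b , b∈ , cosb≈y) = ≤-respˡ
        (∣∣-cong (+-cong (poly-resp (suc d) f-poly cosa≈x) (-‿cong (poly-resp (suc d) f-poly cosb≈y))))
        (case (≤-total a b))
        where
        case : a ≤ b ⊎ b ≤ a → ∣ f (cos a) - f (cos b) ∣ ≤ fromℕ 2 * M * q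
        case (inj₁ a≤b) = ≤-trans (∣x-y∣≤∣y-x∣ _ _) (ordered a∈ b∈ a≤b)
        case (inj₂ b≤a) = ordered b∈ a∈ b≤a

-- The robust minimax fit

module RobustFit (em : ExcludedMiddle 0ℓ) (ℝ : CompleteOrderedField) where
  open Reals em ℝ hiding (zero)
  open OrderedField em ℝ
  open Limits em ℝ using (x≤⌈x⌉)
  open Trigonometry em ℝ using (0<π)
  open Polynomials em ℝ
  open SupNorm em ℝ
  open Median em ℝ
  open ChebyshevPartition em ℝ

  ≤foldr-⊔ : ∀ {n} (a : Fin n → Carrier) j → a j ≤ Vector.foldr _⊔_ 0# a
  ≤foldr-⊔ a Fin.zero    = x≤x⊔y _ _
  ≤foldr-⊔ a (Fin.suc j) = ≤-trans (≤foldr-⊔ (a ∘ Fin.suc) j) (x≤y⊔x _ _)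

  foldr-⊔-lub : ∀ {n K} (a : Fin n → Carrier) → 0# ≤ K → (∀ j → a j ≤ K) → Vector.foldr _⊔_ 0# a ≤ K
  foldr-⊔-lub {zero}  a 0≤K a≤K = 0≤K
  foldr-⊔-lub {suc n} a 0≤K a≤K = ⊔-lub (a≤K Fin.zero) (foldr-⊔-lub (a ∘ Fin.suc) 0≤K (a≤K ∘ Fin.suc))

  <½⇒*2≤1 : ∀ {x} → x < 1# / fromℕ 2 → x * fromℕ 2 ≤ 1#
  <½⇒*2≤1 x<½ = ≤-respʳ (x/y*y≈x 1# (fromℕ-pos 1)) (*-monoʳ (fromℕ-nonNeg 2) (<⇒≤ x<½))

  module _ {d : ℕ} {p : Poly d} {σ : Carrier} (S : Samples p σ) where
    open Samples S

    count≤outliers : ∀ (P : Pred Carrier 0ℓ) l → All (λ i → P (y i) → i ∈ outliers) l →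
      count P (map y l) ℕ.≤ length (filter (_∈? outliers) l)
    count≤outliers P []      []       = ℕ.z≤n
    count≤outliers P (i ∷ l) (h ∷ hs) with em {P (y i)} | i ∈? outliers
    ... | yes Py | yes _  = ℕ.s≤s (count≤outliers P l hs)
    ... | yes Py | no i∉  = ⊥-elim (i∉ (h Py))
    ... | no _   | yes _  = ℕ.m≤n⇒m≤1+n (count≤outliers P l hs)
    ... | no _   | no _   = count≤outliers P l hs

    -- A value above v + B or below v - B can only come from an outlier, and 2 α ≤ 1 makes the
    -- outliers fewer than half of the samples in `I`.
    median-close : ∀ (I : Pred Carrier 0ℓ) {α v B} → α * fromℕ 2 ≤ 1# →
      fromℕ (length (outliersIn I)) < α * fromℕ (length (samplesIn I)) →
      (∀ i → I (x i) → i ∉ outliers → ∣ y i - v ∣ ≤ B) → ∣ medianIn S I - v ∣ ≤ B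
    median-close I {α} {v} {B} 2α≤1 few inlier = ∣∣-lub
      (≤-from (x≤y⇒0≤y-x (proj₂ between)) (solve 3 (λ m v b → b := m :- v :+ (v :+ b :- m)) refl _ v B))
      (≤-from (x≤y⇒0≤y-x (proj₁ between)) (solve 3 (λ m v b → b := :- (m :- v) :+ (m :- (v :- b))) refl _ v B))
      where
      ys = map y (samplesIn I)
      b = length (outliersIn I)
      n = length (samplesIn I)

      b+b<n : b ℕ.+ b ℕ.< n
      b+b<n = fromℕ-cancel-< (<-≤-trans (0<y-x⇒x<y (<-respʳ
        (trans (solve 3 (λ a n b → :2 :* (a :* n :- b) := a :* :2 :* n :- (b :+ b)) refl α (fromℕ n) (fromℕ b))
          (+-congˡ (-‿cong (sym (fromℕ-+ b b)))))
        (*-pos (fromℕ-pos 1) (x<y⇒0<y-x few))))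
        (≤-respʳ (*-identityˡ _) (*-monoʳ (fromℕ-nonNeg n) 2α≤1)))

      far⇒outlier : ∀ (P : Pred Carrier 0ℓ) → (∀ {z} → P z → ¬ (∣ z - v ∣ ≤ B)) →
        count P ys ℕ.+ count P ys ℕ.< length ys
      far⇒outlier P far = ℕ.≤-trans (ℕ.s≤s (ℕ.+-mono-≤ c≤b c≤b))
        (ℕ.≤-trans b+b<n (ℕ.≤-reflexive (≡.sym (List.length-map y (samplesIn I)))))
        where
        outlier : ∀ {i} → I (x i) → P (y i) → i ∈ outliers
        outlier {i} i∈I Py with i ∈? outliers
        ... | yes i∈ = i∈
        ... | no  i∉ = ⊥-elim (far Py (inlier i i∈I i∉))
        c≤b = count≤outliers P (samplesIn I)
          (All.map outlier (All.all-filter (λ i → em {I (x i)}) (allFin size)))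

      between : v - B ≤ median ys ∧ median ys ≤ v + B
      between = median-between ys
        (far⇒outlier (v + B <_) λ {z} v+B<z close → <⇒≱ v+B<z (≤-from (x≤y⇒0≤y-x (≤-trans (x≤∣x∣ _) close))
          (solve 3 (λ v b z → v :+ b := z :+ (b :- (z :- v))) refl v B z)))
        (far⇒outlier (_< v - B) λ {z} z<v-B close → <⇒≱ z<v-B (≤-from (x≤y⇒0≤y-x (≤-trans (-x≤∣x∣ _) close))
          (solve 3 (λ v b z → z := v :- b :+ (b :- (:- (z :- v)))) refl v B z)))

  -- Chosen so that C d / ε ≤ m gives both d ≤ m and d π / m ≤ ε / 8, where π / m is the angular
  -- width of a cell.
  C : Carrier
  C = fromℕ 8 * (π + 1#)

  0<C : 0# < C
  0<C = *-pos (fromℕ-pos 7) (+-pos-nonNeg 0<π 0≤1)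

  module _ {ε : Carrier} (0<ε : 0# < ε) (2ε≤1 : ε * fromℕ 2 ≤ 1#) (d-1 m : ℕ) where
    private
      d = suc d-1
      q = ε / fromℕ 8

    module _ (Cd≤mε : C * fromℕ d ≤ fromℕ m * ε) where

      8q≈ε : q * fromℕ 8 ≈ ε
      8q≈ε = x/y*y≈x ε (fromℕ-pos 7)

      dπ≤qm : fromℕ d * π ≤ q * fromℕ m
      dπ≤qm = *-cancelˡ-≤ (fromℕ-pos 7) (≤-from
        (x≤y⇒0≤y-x Cd≤mε ⊕ fromℕ-nonNeg 8 ⊗ fromℕ-nonNeg d ⊕ ≈⇒0≤*[-] (fromℕ m) 8q≈ε)
        (solve 5 (λ d p q m e → con (+ 8) :* (q :* m) := con (+ 8) :* (d :* p) :+
          (m :* e :- con (+ 8) :* (p :+ :1) :* d :+ con (+ 8) :* d :+ m :* (q :* con (+ 8) :- e))) refl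
          (fromℕ d) π q (fromℕ m) ε))

      q≤2 : q ≤ fromℕ 2
      q≤2 = *-cancelˡ-≤ (fromℕ-pos 15) (≤-from
        (x≤y⇒0≤y-x 2ε≤1 ⊕ fromℕ-nonNeg 31 ⊕ ≈⇒0≤*[-] (- fromℕ 2) 8q≈ε)
        (solve 2 (λ q e → con (+ 16) :* :2 := con (+ 16) :* q :+
          (:1 :- e :* :2 :+ con (+ 31) :+ :- :2 :* (q :* con (+ 8) :- e))) refl q ε))

      -- Twice the hypothesis reads 16 (π + 1) d ≤ 2 m ε, and the right side is at most m. In
      -- `oscillation` this keeps d times the arc length below π.
      d≤m : d ℕ.≤ m
      d≤m = fromℕ-cancel-≤ (≤-from
        (fromℕ-nonNeg 2 ⊗ x≤y⇒0≤y-x Cd≤mε ⊕ fromℕ-nonNeg m ⊗ x≤y⇒0≤y-x 2ε≤1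
          ⊕ fromℕ-nonNeg 16 ⊗ <⇒≤ 0<π ⊗ fromℕ-nonNeg d ⊕ fromℕ-nonNeg 15 ⊗ fromℕ-nonNeg d)
        (solve 4 (λ d p m e → m := d :+ (:2 :* (m :* e :- con (+ 8) :* (p :+ :1) :* d) :+ m :* (:1 :- e :* :2)
          :+ con (+ 16) :* p :* d :+ con (+ 15) :* d)) refl (fromℕ d) π (fromℕ m) ε))

  module Fit {ε α : Carrier} (0<ε : 0# < ε) (2ε≤1 : ε * fromℕ 2 ≤ 1#) (2α≤1 : α * fromℕ 2 ≤ 1#)
    (d-1 m-1 : ℕ) (Cd≤mε : C * fromℕ (suc d-1) ≤ fromℕ (suc m-1) * ε)
    (p : Poly (suc d-1)) (σ : Carrier) (0≤σ : 0# ≤ σ) (S : Samples p σ) (good : Samples.IsGood S α (suc m-1))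
    (x̃ : Fin (suc m-1) → Carrier) (x̃∈ : ∀ j → ChebyshevInterval (suc m-1) j (x̃ j))
    (p̂ : Poly (suc d-1)) (minimax : IsMinimaxFit p̂ x̃ (λ j → medianIn S (ChebyshevInterval (suc m-1) j)))
    where

    d m : ℕ
    d = suc d-1
    m = suc m-1

    ỹ : Fin m → Carrier
    ỹ j = medianIn S (ChebyshevInterval m j)

    error : Carrier → Carrier
    error x = ⟦ p̂ ⟧ x - ⟦ p ⟧ x

    p-poly : IsPoly (suc d) ⟦ p ⟧
    p-poly = coefficients-poly (suc d) p

    error-poly : IsPoly (suc d) error
    error-poly = poly-minus (suc d) (coefficients-poly (suc d) p̂) p-poly

    -- With this `q`, the oscillation bound 2 ‖f‖ q is ε/4 ‖f‖, and `δ` is its value for `p`.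
    q δ : Carrier
    q = ε / fromℕ 8
    δ = fromℕ 2 * ‖ ⟦ p ⟧ ‖∞ * q

    cell-oscillation : ∀ {f} → IsPoly
      (suc d) f → ∀ j {x y} → ChebyshevInterval m j x → ChebyshevInterval m j y →
                       ∣ f x - f y ∣ ≤ fromℕ 2 * ‖ f ‖∞ * q
    cell-oscillation {f} f-poly j = oscillation m-1 d-1
      (dπ≤qm 0<ε 2ε≤1 d-1 m Cd≤mε) (q≤2 0<ε 2ε≤1 d-1 m Cd≤mε) (d≤m 0<ε 2ε≤1 d-1 m Cd≤mε)
      f-poly (∣f∣≤‖f‖ (suc d) f-poly) (toℕ j)

    median-error : ∀ j → ∣ ỹ j - ⟦ p ⟧ (x̃ j) ∣ ≤ σ + δ
    median-error j = median-close S (ChebyshevInterval m j) 2α≤1 (good j) λ i xᵢ∈ i∉ →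
      ≤-trans (triangle _ (⟦ p ⟧ (Samples.x S i)) _)
        (+-mono-≤ (Samples.close S i i∉) (cell-oscillation p-poly j xᵢ∈ (x̃∈ j)))

    0≤q : 0# ≤ q
    0≤q = /-nonNeg (<⇒≤ 0<ε) (fromℕ-pos 7)

    0≤δ : 0# ≤ δ
    0≤δ = fromℕ-nonNeg 2 ⊗ 0≤‖f‖ (suc d) p-poly ⊗ 0≤q

    -- The polynomial `p` is itself a competitor in the minimization, so this also bounds the
    -- deviation of the optimal `p̂`.
    deviation-p : maxDeviation p x̃ ỹ ≤ σ + δ
    deviation-p = foldr-⊔-lub _ (0≤σ ⊕ 0≤δ) λ j → ≤-trans (∣x-y∣≤∣y-x∣ _ _) (median-error j)

    error-at-nodes : ∀ j → ∣ error (x̃ j) ∣ ≤ (σ + δ) + (σ + δ)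
    error-at-nodes j = ≤-trans (triangle _ (ỹ j) _)
      (+-mono-≤ (≤-trans (≤foldr-⊔ (λ j → ∣ ⟦ p̂ ⟧ (x̃ j) - ỹ j ∣) j) (≤-trans (minimax p) deviation-p))
        (median-error j))

    E : Carrier
    E = ‖ error ‖∞

    E≤ : E ≤ fromℕ 2 * E * q + ((σ + δ) + (σ + δ))
    E≤ = ‖f‖-least (suc d) error-poly λ x x∈ → let j , x∈I = covering m-1 x x∈ in
      ≤-trans (≤-reflexive (∣∣-cong (solve 2 (λ a b → a := a :- b :+ b) refl (error x) (error (x̃ j)))))
        (∣x+y∣≤ (cell-oscillation error-poly j x∈I (x̃∈ j)) (error-at-nodes j))

    -- Absorption, freed of division: `E≤` amounts to (4 - ε) E ≤ 8 σ + 2 ε P, and (4 - ε) times the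
    -- claimed bound exceeds the right side by ε (2 - ε)(σ + P).
    error-bound : E ≤ (fromℕ 2 + ε) * σ + ε * ‖ ⟦ p ⟧ ‖∞
    error-bound = *-cancelˡ-≤ 0<4-ε (≤-from
      (fromℕ-nonNeg 4 ⊗ x≤y⇒0≤y-x E≤
        ⊕ ≈⇒0≤*[-] (- (E + fromℕ 2 * P)) (8q≈ε 0<ε 2ε≤1 d-1 m Cd≤mε)
        ⊕ <⇒≤ 0<ε ⊗ 0≤2-ε ⊗ 0≤σ ⊕ <⇒≤ 0<ε ⊗ 0≤2-ε ⊗ 0≤‖f‖ (suc d) p-poly)
      (solve 5 (λ e E P s q →
        (con (+ 4) :- e) :* ((:2 :+ e) :* s :+ e :* P) :=
        (con (+ 4) :- e) :* E :+
        (con (+ 4) :* (:2 :* E :* q :+ ((s :+ :2 :* P :* q) :+ (s :+ :2 :* P :* q)) :- E)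
          :+ :- (E :+ :2 :* P) :* (q :* con (+ 8) :- e)
          :+ e :* (:2 :- e) :* s :+ e :* (:2 :- e) :* P)) refl ε E P σ q))
      where
      P = ‖ ⟦ p ⟧ ‖∞
      0≤2-ε : 0# ≤ fromℕ 2 - ε
      0≤2-ε = ≤-trans (x≤y⇒0≤y-x 2ε≤1) (≤-from (0≤1 ⊕ <⇒≤ 0<ε)
        (solve 1 (λ e → :2 :- e := :1 :- e :* :2 :+ (:1 :+ e)) refl ε))
      0<4-ε : 0# < fromℕ 4 - ε
      0<4-ε = <-respʳ (solve 1 (λ e → :2 :+ (:2 :- e) := con (+ 4) :- e) refl ε)
        (+-pos-nonNeg (fromℕ-pos 1) 0≤2-ε)

  -- The ceiling enters only through C d ≤ m ε, so `m` is a variable here and can be split into zero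
  -- and successor.
  robust-fit : ∀ {ε α} → 0# < ε → ε < 1# / fromℕ 2 → α < 1# / fromℕ 2 →
    ∀ d → 1 ℕ.≤ d → ∀ m → C * fromℕ d ≤ fromℕ m * ε →
    ∀ (p : Poly d) (σ : Carrier) → 0# ≤ σ →
    ∀ (S : Samples p σ) → Samples.IsGood S α m →
    ∀ (x̃ : Fin m → Carrier) → (∀ j → ChebyshevInterval m j (x̃ j)) →
    ∀ (p̂ : Poly d) → IsMinimaxFit p̂ x̃ (λ j → medianIn S (ChebyshevInterval m j)) →
    ‖ (λ x → ⟦ p̂ ⟧ x - ⟦ p ⟧ x) ‖∞ ≤ (fromℕ 2 + ε) * σ + ε * ‖ ⟦ p ⟧ ‖∞
  -- An empty partition would force C d ≤ 0.
  robust-fit {ε} 0<ε ε<½ α<½ (suc d-1) _ zero Cd≤mε =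
    ⊥-elim (<⇒≱ (*-pos 0<C (fromℕ-pos d-1)) (≤-respʳ (zeroˡ ε) Cd≤mε))
  robust-fit 0<ε ε<½ α<½ (suc d-1) _ (suc m-1) Cd≤mε p σ 0≤σ S good x̃ x̃∈ p̂ minimax =
    Fit.error-bound 0<ε (<½⇒*2≤1 ε<½) (<½⇒*2≤1 α<½) d-1 m-1 Cd≤mε p σ 0≤σ S good x̃ x̃∈ p̂ minimax

lemma1p3 : (em : ExcludedMiddle 0ℓ) (ℝ : CompleteOrderedField) →
    let open Reals em ℝ in
    ∃[ C ] 0# < C ∧
    (∀ (ε α : Carrier) → 0# < ε → ε < 1# / fromℕ 2 → 0# ≤ α → α < 1# / fromℕ 2 →
    ∀ (d : ℕ) → 1 ℕ.≤ d →
    let m = ⌈ C * fromℕ d / ε ⌉ in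
    ∀ (p : Poly d) (σ : Carrier) → 0# ≤ σ →
    ∀ (S : Samples p σ) → Samples.IsGood S α m →
    ∀ (x̃ : Fin m → Carrier) → (∀ j → ChebyshevInterval m j (x̃ j)) →
    let ỹ = λ (j : Fin m) → medianIn S (ChebyshevInterval m j) in
    ∀ (p̂ : Poly d) → IsMinimaxFit p̂ x̃ ỹ →
    ‖ (λ x → ⟦ p̂ ⟧ x - ⟦ p ⟧ x) ‖∞ ≤ (fromℕ 2 + ε) * σ + ε * ‖ ⟦ p ⟧ ‖∞)
lemma1p3 em ℝ = C , 0<C , λ ε α 0<ε ε<½ _ α<½ d 1≤d →
  robust-fit 0<ε ε<½ α<½ d 1≤d _ (x/y≤z⇒x≤z*y 0<ε (x≤⌈x⌉ (C * fromℕ d / ε)))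
  where
  open Reals em ℝ
  open OrderedField em ℝ using (x/y≤z⇒x≤z*y)
  open Limits em ℝ using (x≤⌈x⌉)
  open RobustFit em ℝ using (C; 0<C; robust-fit)
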